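{- Let $\phi$ be a fixed constant. For Server Cloud Scheduling instances whose task graph has maximum cardinality source and sink dividing cut at most $\phi$, there is an FPTAS for budget-restrained makespan minimization: given $\varepsilon>0$ and a budget $b$, it computes in time polynomial in $n=|\mathcal{J}|$ and $1/\varepsilon$ a valid schedule with cost at most $b$ and makespan at most $(1+\varepsilon)$ times the minimum makespan of a valid schedule with cost at most $b$.
   Context: Server Cloud Scheduling: the input is a directed acyclic task graph $G=(\mathcal{J},E)$ with exactly one source $s$ and one sink $t$; each job $j\in\mathcal{J}$ has a server processing time $p_s(j)\in\mathbb{N}_0$ and a cloud processing time $p_c(j)\in\mathbb{N}_0$, where $p_s(s)=p_s(t)=0$ and $p_c(s)=p_c(t)=\infty$; each edge $(i,j)\in E$ has a communication delay $c(i,j)\in\mathbb{N}_0$. There is one server machine (processing at most one job at a time) and unboundedly many cloud machines. A schedule is a partition $\mathcal{J}=\mathcal{J}_s\cup\mathcal{J}_c$ together with completion times $C:\mathcal{J}\to\mathbb{N}_0$; let $p_\pi(j)=p_s(j)$ if $j\in\mathcal{J}_s$ and $p_\pi(j)=p_c(j)$ if $j\in\mathcal{J}_c$. It is valid if (a) for distinct $i,j\in\mathcal{J}_s$: $C(i)\le C(j)-p_\pi(j)$ or $C(i)-p_\pi(i)\ge C(j)$; (b) for every edge $(i,j)$ with $i,j$ on the same side: $C(i)\le C(j)-p_\pi(j)$, and for every edge with $i,j$ on different sides: $C(i)+c(i,j)\le C(j)-p_\pi(j)$. The makespan is $C(t)$ and the cost is $\sum_{j\in\mathcal{J}_c}p_c(j)$.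 Maximum cardinality source and sink dividing cut: let $\mathcal{S}$ be the family of all sets $A\subseteq\mathcal{J}$ with $s\in A$ such that there is no edge $(j,k)\in E$ with $j\notin A$ and $k\in A$; then $\phi(G)=\max_{A\in\mathcal{S}}|\{(j,k)\in E: j\in A,\ k\notin A\}|$. -}

module Defs where

open import Data.Bool using (Bool; true; false)
open import Data.Fin using (Fin)
open import Data.Fin.Subset using (Subset; _∈_; _∉_)
open import Data.Fin.Subset.Properties using (_∈?_)
import Data.Integer as ℤ
open import Data.List using (List; []; _∷_; foldr; length; filter; tabulate; allFin; cartesianProduct)
open import Data.Maybe using (Maybe; just; nothing; Is-just; maybe′)
import Data.Maybe.Relation.Unary.Any as Any
open import Data.Nat using (ℕ; zero; suc; _+_; _∸_; _*_; _^_; _≤_)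
open import Data.Nat.DivMod using (_/_)
open import Data.Nat.GeneralisedArithmetic using (fold)
open import Data.Product using (Σ-syntax; ∃-syntax; _×_; _,_; proj₁; proj₂)
import Data.Rational as ℚ
open ℚ using (ℚ; 1ℚ)
import Data.Rational.Properties as ℚₚ
open import Data.Sum using (_⊎_)
open import Data.Unit using (tt)
open import Relation.Binary.Construct.Add.Supremum.NonStrict _≤_ using (_≤⁺_)
open import Relation.Binary.Construct.Closure.Transitive using (TransClosure)
open import Relation.Binary.PropositionalEquality using (_≡_; _≢_)
open import Relation.Nullary using (¬_; Dec; yes)
open import Relation.Nullary.Construct.Add.Supremum using (_⁺; [_]; ⊤⁺)
open import Relation.Nullary.Decidable using (_×-dec_; ¬?)

ℕ∞ : Set
ℕ∞ = ℕ ⁺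

infixl 6 _+∞_
_+∞_ : ℕ∞ → ℕ∞ → ℕ∞
[ m ] +∞ [ n ] = [ m + n ]
[ _ ] +∞ ⊤⁺    = ⊤⁺
⊤⁺    +∞ _     = ⊤⁺

record Instance : Set where
  field
    n     : ℕ

  Job : Set
  Job = Fin n

  field
    -- delay i j ≡ just d  means (i , j) ∈ E and c (i , j) = d;
    -- delay i j ≡ nothing means (i , j) ∉ E.
    delay : Job → Job → Maybe ℕ
    ps    : Job → ℕ
    pc    : Job → ℕ∞
    s t   : Job

  Edge : Job → Job → Set
  Edge i j = Is-just (delay i j)

  edge? : ∀ i j → Dec (Edge i j)
  edge? i j = Any.dec (λ _ → yes tt) (delay i j)

  IsSource : Job → Set
  IsSource j = ∀ i → ¬ Edge i j

  IsSink : Job → Set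
  IsSink j = ∀ k → ¬ Edge j k

  field
    acyclic       : ∀ j → ¬ TransClosure Edge j j
    s-source      : IsSource s
    source-unique : ∀ j → IsSource j → j ≡ s
    t-sink        : IsSink t
    sink-unique   : ∀ j → IsSink j → j ≡ t
    ps-s          : ps s ≡ 0
    ps-t          : ps t ≡ 0
    pc-s          : pc s ≡ ⊤⁺
    pc-t          : pc t ≡ ⊤⁺
    pc-finite     : ∀ j → j ≢ s → j ≢ t → ∃[ k ] pc j ≡ [ k ]

data Side : Set where
  server cloud : Side

module _ (G : Instance) where
  open Instance G

  record Schedule : Set where
    field
      side : Job → Side
      C    : Job → ℕ

    pπ : Job → ℕ∞
    pπ j with side j
    ... | server = [ ps j ]
    ... | cloud  = pc j

    -- x ≤ C(j) − pπ(j), with the subtraction moved across since it is not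
    -- truncated at 0.
    _≤start_ : ℕ → Job → Set
    x ≤start j = [ x ] +∞ pπ j ≤⁺ [ C j ]

    record Valid : Set where
      field
        server-exclusive : ∀ i j → i ≢ j → side i ≡ server → side j ≡ server →
                           C i ≤start j ⊎ C j ≤start i
        precedence-same  : ∀ i j → Edge i j → side i ≡ side j → C i ≤start j
        precedence-cross : ∀ i j d → delay i j ≡ just d → side i ≢ side j →
                           (C i + d) ≤start j

    makespan : ℕ
    makespan = C t

    cloudCost : Job → ℕ∞
    cloudCost j with side j
    ... | server = [ 0 ]
    ... | cloud  = pc j

    cost : ℕ∞
    cost = foldr _+∞_ [ 0 ] (tabulate cloudCost)

  open Schedule

  Feasible : ℕ → Schedule → Set
  Feasible b σ = Valid σ × cost σ ≤⁺ [ b ]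

  IsMinMakespan : ℕ → ℕ → Set
  IsMinMakespan b m = (Σ[ σ ∈ Schedule ] Feasible b σ × makespan σ ≡ m)
                    × (∀ σ → Feasible b σ → m ≤ makespan σ)

  Dividing : Subset n → Set
  Dividing A = s ∈ A × (∀ j k → Edge j k → j ∉ A → k ∉ A)

  cut : Subset n → List (Job × Job)
  cut A = filter (λ (j , k) → edge? j k ×-dec (j ∈? A) ×-dec ¬? (k ∈? A))
                 (cartesianProduct (allFin n) (allFin n))

  IsMaxDividingCut : ℕ → Set
  IsMaxDividingCut m = (Σ[ A ∈ Subset n ] Dividing A × length (cut A) ≡ m)
                     × (∀ A → Dividing A → length (cut A) ≤ m)

-- The model of computation: first-order programs over naturals, pairs and lists,
-- in combinator form, with values passed by reference; every executed primitive
-- costs one time unit.  Arithmetic is unit-cost on unbounded naturals, but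
-- without a multiplication primitive: program constants aside, a step lengthens
-- the binary representation of the largest number in memory by at most one bit,
-- so, as for the unit-cost RAM with addition and subtraction, running times
-- agree with Turing machine time up to a polynomial in the time and the bit
-- length of the input.  The quotient is a primitive because some operation must
-- be able to turn two large numbers into a small loop bound (e.g. ⌈1/ε⌉ from
-- the numerator and denominator of ε).

infixr 7 _⊗_
data Ty : Set where
  nat  : Ty
  _⊗_  : Ty → Ty → Ty
  list : Ty → Ty

⟦_⟧ : Ty → Set
⟦ nat ⟧    = ℕ
⟦ A ⊗ B ⟧  = ⟦ A ⟧ × ⟦ B ⟧
⟦ list A ⟧ = List ⟦ A ⟧

private variable A B D : Ty

infix  4 _⇒_
infixl 5 _⨾_
data _⇒_ : Ty → Ty → Set where
  idₚ            : A ⇒ A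
  _⨾_            : A ⇒ B → B ⇒ D → A ⇒ D
  ⟨_,_⟩          : A ⇒ B → A ⇒ D → A ⇒ B ⊗ D
  fstₚ           : A ⊗ B ⇒ A
  sndₚ           : A ⊗ B ⇒ B
  lit            : ℕ → A ⇒ nat
  add monus quot : nat ⊗ nat ⇒ nat
  ifz_then_else_ : A ⇒ nat → A ⇒ B → A ⇒ B → A ⇒ B
  loop           : A ⇒ A → A ⊗ nat ⇒ A
  nil            : A ⇒ list B
  cons           : A ⊗ list A ⇒ list A
  caseList       : B ⇒ D → (A ⊗ list A) ⊗ B ⇒ D → list A ⊗ B ⇒ D
  foldList       : A ⊗ B ⇒ B → list A ⊗ B ⇒ B

-- Division by zero yields zero.
quotient : ℕ → ℕ → ℕ
quotient m zero    = 0
quotient m (suc n) = m / suc n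

eval : A ⇒ B → ⟦ A ⟧ → ⟦ B ⟧
eval idₚ                    x            = x
eval (f ⨾ g)                x            = eval g (eval f x)
eval ⟨ f , g ⟩              x            = eval f x , eval g x
eval fstₚ                   (x , y)      = x
eval sndₚ                   (x , y)      = y
eval (lit k)                x            = k
eval add                    (m , k)      = m + k
eval monus                  (m , k)      = m ∸ k
eval quot                   (m , k)      = quotient m k
eval (ifz c then f else g)  x with eval c x
... | zero  = eval f x
... | suc _ = eval g x
eval (loop f)               (x , k)      = fold x (eval f) k
eval nil                    x            = []
eval cons                   (x , xs)     = x ∷ xs
eval (caseList f g)         ([] , y)     = eval f y
eval (caseList f g)         (x ∷ xs , y) = eval g ((x , xs) , y)
eval (foldList f)           (xs , y)     = foldr (λ a b → eval f (a , b)) y xs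

loopTime : {X : Set} (step : X → X) (stepTime : X → ℕ) → X → ℕ → ℕ
loopTime step stepTime x zero    = 1
loopTime step stepTime x (suc k) =
  suc (stepTime (fold x step k) + loopTime step stepTime x k)

foldTime : {X Y : Set} (step : X → Y → Y) (stepTime : X → Y → ℕ) → Y → List X → ℕ
foldTime step stepTime y []       = 1
foldTime step stepTime y (x ∷ xs) =
  suc (stepTime x (foldr step y xs) + foldTime step stepTime y xs)

time : A ⇒ B → ⟦ A ⟧ → ℕ
time idₚ                    x            = 1
time (f ⨾ g)                x            = suc (time f x + time g (eval f x))
time ⟨ f , g ⟩              x            = suc (time f x + time g x)
time fstₚ                   x            = 1
time sndₚ                   x            = 1
time (lit k)                x            = 1
time add                    x            = 1
time monus                  x            = 1
time quot                   x            = 1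
time (ifz c then f else g)  x with eval c x
... | zero  = suc (time c x + time f x)
... | suc _ = suc (time c x + time g x)
time (loop f)               (x , k)      = loopTime (eval f) (time f) x k
time nil                    x            = 1
time cons                   x            = 1
time (caseList f g)         ([] , y)     = suc (time f y)
time (caseList f g)         (x ∷ xs , y) = suc (time g ((x , xs) , y))
time (foldList f)           (xs , y)     =
  foldTime (λ a b → eval f (a , b)) (λ a b → time f (a , b)) y xs

-- Used both for delays (nothing = no edge) and for ℕ∞ (⊤⁺ = nothing).
encodeMaybe : Maybe ℕ → ℕ
encodeMaybe = maybe′ suc 0

-- One entry per job j: (ps j , pc j , the delays from j to all jobs).
GraphTy : Ty
GraphTy = list (nat ⊗ nat ⊗ list nat)

encodeInstance : Instance → ⟦ GraphTy ⟧
encodeInstance G = tabulate λ j →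
  ps j , encodeMaybe (pc j) , tabulate (λ k → encodeMaybe (delay j k))
  where open Instance G

-- The graph, the budget, and the numerator and denominator of ε.
Input : Ty
Input = GraphTy ⊗ nat ⊗ nat ⊗ nat

encodeInput : Instance → ℕ → ℚ → ⟦ Input ⟧
encodeInput G b ε = encodeInstance G , b , ℤ.∣ ℚ.numerator ε ∣ , ℚ.denominatorℕ ε

-- One entry per job j: (side j , C j).
Output : Ty
Output = list (nat ⊗ nat)

encodeSide : Side → ℕ
encodeSide server = 0
encodeSide cloud  = 1

encodeSchedule : ∀ {G} → Schedule G → ⟦ Output ⟧
encodeSchedule σ = tabulate λ j → encodeSide (side j) , C j
  where open Schedule σ

ℕtoℚ : ℕ → ℚ
ℕtoℚ m = ℤ.+ m ℚ./ 1

⌈1/_⌉ : (ε : ℚ) .{{_ : ℚ.Positive ε}} → ℕ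
⌈1/ ε ⌉ = ℤ.∣ ℚ.ceiling ((ℚ.1/ ε) {{ℚₚ.pos⇒nonZero ε}}) ∣

Approximates : (G : Instance) (b : ℕ) (ε : ℚ) → Schedule G → Set
Approximates G b ε σ =
  Feasible G b σ ×
  (∀ opt → IsMinMakespan G b opt →
     ℕtoℚ (Schedule.makespan σ) ℚ.≤ (1ℚ ℚ.+ ε) ℚ.* ℕtoℚ opt)

-- Since n and ⌈1/ε⌉ are at least 1 and ⌈1/ε⌉ < 1 + 1/ε, a time is bounded by a
-- polynomial in n and 1/ε iff it is bounded by K * (n + ⌈1/ε⌉) ^ d for some K, d.
IsFPTASOn : (Instance → Set) → Input ⇒ Output → Set
IsFPTASOn P prog =
  Σ[ K ∈ ℕ ] Σ[ d ∈ ℕ ]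
    ((G : Instance) → P G → (b : ℕ) (ε : ℚ) .{{_ : ℚ.Positive ε}} →
      (Σ[ σ ∈ Schedule G ]
         eval prog (encodeInput G b ε) ≡ encodeSchedule σ × Approximates G b ε σ)
      × time prog (encodeInput G b ε) ≤ K * (Instance.n G + ⌈1/ ε ⌉) ^ d)

HasMaxDividingCutAtMost : ℕ → Instance → Set
HasMaxDividingCutAtMost φ G = Σ[ m ∈ ℕ ] IsMaxDividingCut G m × m ≤ φ

{-# OPTIONS --safe #-}
-- Guess the largest number L occurring in the instance with L ≤ OPT: no feasible
-- schedule of makespan OPT involves a larger processing time or crossing delay.
-- Put u = ⌊ L / (n E) ⌋ with E = 1 + ⌊ 1/ε ⌋.  A dynamic program extends partial
-- schedules job by job, each job starting as early as possible.  The future of a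
-- partial schedule depends on the set of assigned jobs, the earliest start left to
-- each unassigned job on either side, the time at which the server is free, and the
-- cost; among the states which agree after rounding all times up to multiples of
-- 1 + u only a cheapest one is kept.  The set of assigned jobs is closed under
-- predecessors, so at most φ edges leave it.  Their heads determine the set and are
-- the only unassigned jobs with a nontrivial earliest start; hence, for fixed φ, the
-- number of kept states is polynomial in n and E, whatever the size of the numbers.
-- Followed along an optimal schedule, each of the n trimming steps delays the kept
-- state by at most u, and n u ≤ L / E ≤ ε OPT.
module Submission where

open import Defs
open import Data.Empty using (⊥; ⊥-elim)
open import Data.Fin using (Fin; zero; suc; toℕ; fromℕ<; combine; punchIn; finToFun; funToFin)
open import Data.Fin.Induction using (spo-wellFounded; spo-noetherian)
import Data.Fin.Properties as Finₚ
import Data.Fin.Subset as Sub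
import Data.Integer as ℤ
import Data.Integer.Properties as ℤₚ
open import Data.List using (List; []; _∷_; foldr; length; filter; tabulate; allFin; drop; map; lookup)
open import Data.List.Membership.Propositional using (_∈_)
import Data.List.Membership.Propositional.Properties as ∈ₚ
import Data.List.Properties as Listₚ
open import Data.List.Relation.Unary.All using (All; []; _∷_)
import Data.List.Relation.Unary.All as All
open import Data.List.Relation.Unary.AllPairs using (AllPairs; []; _∷_)
open import Data.List.Relation.Unary.Any using (here; there; index)
import Data.List.Relation.Unary.Any.Properties as Anyₚ
open import Data.List.Relation.Unary.Unique.Propositional using (Unique)
import Data.List.Relation.Unary.Unique.Propositional.Properties as Uniqueₚ
open import Data.Maybe using (Maybe; just; nothing; Is-just)
import Data.Maybe.Relation.Unary.Any as MAny
open import Data.Nat using (ℕ; zero; suc; _+_; _*_; _∸_; _^_; _≤_; _<_; z≤n; s≤s)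
open import Data.Nat.DivMod using (_/_; _%_; m≡m%n+[m/n]*n; m<n*o⇒m/o<n; m%n<n; m/n*n≤m; m≥n⇒m/n>0)
open import Data.Nat.GeneralisedArithmetic using (fold)
open import Data.Nat.Induction using (<-wellFounded)
open import Data.Nat.Properties
open import Data.Product using (Σ-syntax; ∃-syntax; _×_; _,_; proj₁; proj₂)
import Data.Rational as ℚ
open ℚ using (ℚ; mkℚ; 1ℚ)
import Data.Rational.Properties as ℚₚ
import Data.Rational.Unnormalised as ℚᵘ
import Data.Rational.Unnormalised.Properties as ℚᵘₚ
open import Data.Sum using (_⊎_; inj₁; inj₂)
open import Data.Unit using (⊤; tt)
import Data.Vec as Vec
open import Data.Vec.Functional using (removeAt)
import Data.Vec.Properties as Vecₚ
open import Function using (_∘_; id)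
open import Induction.WellFounded using (WellFounded; Acc; acc; module Subrelation)
open import Relation.Binary.Construct.Add.Supremum.NonStrict _≤_ as ≤⁺ using (_≤⁺_)
import Relation.Binary.Construct.Closure.Transitive as Plus
open import Relation.Binary.Definitions using (tri<; tri≈; tri>)
open import Relation.Binary.PropositionalEquality using 
  (_≡_; _≢_; refl; sym; trans; cong; cong₂; subst; subst₂; resp₂; module ≡-Reasoning)
open import Relation.Binary.PropositionalEquality.Properties using (isEquivalence)
open import Relation.Binary.Structures using (IsStrictPartialOrder)
open import Relation.Nullary using (¬_; Dec; yes; no; contradiction)
open import Relation.Nullary.Construct.Add.Supremum using ([_]; ⊤⁺)
open import Relation.Nullary.Decidable using (_×-dec_; _⊎-dec_; ¬?; does; dec-true; dec-false)
open import Algebra.Properties.CommutativeMonoid.Sum +-0-commutativeMonoid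
  using (sum; sum-remove; sum-cong-≗; ∑-distrib-+)
open import Algebra.Properties.CommutativeSemigroup *-commutativeSemigroup
  using () renaming (interchange to *-interchange)

-- The largest number of the instance may exceed the optimum by any factor, for example through a
-- cloud time that no good schedule pays for, so it cannot set the scale. The guess acts in two
-- directions. Being at most OPT, it limits the accumulated rounding error. Being a cap, it confines
-- all times to `n * (L + L)`, because longer processing times and crossing delays are discarded;
-- only polynomially many multiples of `1 + u` lie in that range. The modulus is `1 + u` since the
-- quotient `u` may be 0. No guess has to be recognised as the right one. Rounding only serves to
-- compare states, and every kept state has exact times, so whatever a guess yields is feasible;
-- among all final states one with the server free earliest is taken. Errors add up instead of
-- multiplying because a start is a maximum of earlier completion times shifted by constants: if all
-- of these are at most `e` late, so is the start. The program is the same for every φ; only its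
-- time bound depends on φ, through the exponent in the number of states.

infix 4 _≤ₚ_
private variable
  A B D Γ : Ty
  X Y : Set

-- Programs with their meaning

if0 : ℕ → X → X → X
if0 zero    x y = x
if0 (suc _) x y = y

caseL : List X → Y → (X → List X → Y) → Y
caseL []       y f = y
caseL (x ∷ xs) y f = f x xs

-- `fun` is the readable meaning on which all later arguments rest, and `correct` is the only bridge
-- to `eval`. The shuffling of contexts inside programs is thus dealt with once per combinator.
record Code (A B : Ty) : Set where
  no-eta-equality
  constructor mkCode
  field
    prog    : A ⇒ B
    fun     : ⟦ A ⟧ → ⟦ B ⟧
    correct : ∀ x → eval prog x ≡ fun x
open Code

infixl 5 _▸_
infixl 6 _⊕_ _⊖_
infixr 5 _∷ᶜ_

_▸_ : Code A B → Code B D → Code A D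
prog    (c ▸ e)   = prog c ⨾ prog e
fun     (c ▸ e) x = fun e (fun c x)
correct (c ▸ e) x = trans (correct e (eval (prog c) x)) (cong (fun e) (correct c x))

⟪_,_⟫ : Code Γ A → Code Γ B → Code Γ (A ⊗ B)
prog    ⟪ c , e ⟫   = ⟨ prog c , prog e ⟩
fun     ⟪ c , e ⟫ x = fun c x , fun e x
correct ⟪ c , e ⟫ x = cong₂ _,_ (correct c x) (correct e x)

idᶜ : Code A A
idᶜ = mkCode idₚ id (λ _ → refl)

fstᶜ : Code (A ⊗ B) A
fstᶜ = mkCode fstₚ proj₁ (λ _ → refl)

sndᶜ : Code (A ⊗ B) B
sndᶜ = mkCode sndₚ proj₂ (λ _ → refl)

litᶜ : ℕ → Code A nat
litᶜ k = mkCode (lit k) (λ _ → k) (λ _ → refl)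

addᶜ monusᶜ quotᶜ : Code (nat ⊗ nat) nat
addᶜ   = mkCode add   (λ (m , k) → m + k) (λ _ → refl)
monusᶜ = mkCode monus (λ (m , k) → m ∸ k) (λ _ → refl)
quotᶜ  = mkCode quot  (λ (m , k) → quotient m k) (λ _ → refl)

_⊕_ _⊖_ : Code Γ nat → Code Γ nat → Code Γ nat
c ⊕ e = ⟪ c , e ⟫ ▸ addᶜ
c ⊖ e = ⟪ c , e ⟫ ▸ monusᶜ

if0ᶜ : Code Γ nat → Code Γ A → Code Γ A → Code Γ A
prog    (if0ᶜ c e f)   = ifz prog c then prog e else prog f
fun     (if0ᶜ c e f) x = if0 (fun c x) (fun e x) (fun f x)
correct (if0ᶜ c e f) x with eval (prog c) x | correct c x
... | zero  | eq rewrite sym eq = correct e x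
... | suc _ | eq rewrite sym eq = correct f x

nilᶜ : Code Γ (list A)
nilᶜ = mkCode nil (λ _ → []) (λ _ → refl)

consᶜ : Code (A ⊗ list A) (list A)
consᶜ = mkCode cons (λ (a , as) → a ∷ as) (λ _ → refl)

_∷ᶜ_ : Code Γ A → Code Γ (list A) → Code Γ (list A)
c ∷ᶜ e = ⟪ c , e ⟫ ▸ consᶜ

caseᶜ : Code Γ (list A) → Code Γ B → Code (Γ ⊗ (A ⊗ list A)) B → Code Γ B
prog    (caseᶜ c e f)   = ⟨ prog c , idₚ ⟩ ⨾ caseList (prog e) (⟨ sndₚ , fstₚ ⟩ ⨾ prog f)
fun     (caseᶜ c e f) γ = caseL (fun c γ) (fun e γ) (λ a as → fun f (γ , a , as))
correct (caseᶜ c e f) γ with eval (prog c) γ | correct c γ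
... | []     | eq rewrite sym eq = correct e γ
... | a ∷ as | eq rewrite sym eq = correct f (γ , a , as)

-- The primitive fold has no access to its surroundings, so the ambient value is
-- carried along in the accumulator.
foldBody : (Γ ⊗ (A ⊗ B)) ⇒ B → A ⊗ (Γ ⊗ B) ⇒ Γ ⊗ B
foldBody f = ⟨ sndₚ ⨾ fstₚ , ⟨ sndₚ ⨾ fstₚ , ⟨ fstₚ , sndₚ ⨾ sndₚ ⟩ ⟩ ⨾ f ⟩

foldBody-eval : (f : Code (Γ ⊗ (A ⊗ B)) B) (γ : ⟦ Γ ⟧) (b : ⟦ B ⟧) (xs : List ⟦ A ⟧) →
  foldr (λ a p → eval (foldBody (prog f)) (a , p)) (γ , b) xs
    ≡ (γ , foldr (λ a b → fun f (γ , a , b)) b xs)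
foldBody-eval f γ b []       = refl
foldBody-eval f γ b (x ∷ xs) rewrite foldBody-eval f γ b xs = cong (γ ,_) (correct f _)

foldᶜ : Code Γ (list A) → Code Γ B → Code (Γ ⊗ (A ⊗ B)) B → Code Γ B
prog    (foldᶜ c e f)   =
  ⟨ prog c , ⟨ idₚ , prog e ⟩ ⟩ ⨾ foldList (foldBody (prog f)) ⨾ sndₚ
fun     (foldᶜ c e f) γ = foldr (λ a b → fun f (γ , a , b)) (fun e γ) (fun c γ)
correct (foldᶜ c e f) γ rewrite correct c γ | correct e γ =
  cong proj₂ (foldBody-eval f γ (fun e γ) (fun c γ))

dropᶜ : Code (list A ⊗ nat) (list A)
prog    dropᶜ = loop (⟨ idₚ , idₚ ⟩ ⨾ caseList nil (fstₚ ⨾ sndₚ))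
fun     dropᶜ (xs , k) = drop k xs
correct (dropᶜ {A}) (xs , k) = go k xs
  where
  tail : List ⟦ A ⟧ → List ⟦ A ⟧
  tail = eval {list A} (⟨ idₚ , idₚ ⟩ ⨾ caseList nil (fstₚ ⨾ sndₚ))
  -- `fold` puts the additional application outermost, whereas `drop` removes the head first; moving
  -- one application inside reconciles them.
  shift : ∀ k xs → fold (tail xs) tail k ≡ tail (fold xs tail k)
  shift zero    xs = refl
  shift (suc k) xs = cong tail (shift k xs)
  go : ∀ k xs → fold xs tail k ≡ drop k xs
  go zero    xs       = refl
  go (suc k) []       = trans (sym (shift k [])) (trans (go k []) (Listₚ.drop-[] k))
  go (suc k) (x ∷ xs) = trans (sym (shift k (x ∷ xs))) (go k xs)

-- Polynomial bounds

-- The base `suc N` is never 0, so a larger exponent never lowers the bound and sums can share the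
-- exponent `d + d′`.
_≤ₚ_ : (ℕ → ℕ) → ℕ × ℕ → Set
f ≤ₚ (K , d) = ∀ N → f N ≤ K * suc N ^ d

IsPoly : (ℕ → ℕ) → Set
IsPoly f = Σ[ p ∈ ℕ × ℕ ] f ≤ₚ p

poly-const : ∀ k → IsPoly (λ _ → k)
poly-const k = (k , 0) , λ N → ≤-reflexive (sym (*-identityʳ k))

poly-id : IsPoly (λ N → N)
poly-id = (1 , 1) , λ N → ≤-trans (n≤1+n N) (≤-reflexive (sym (trans (*-identityˡ _) (*-identityʳ _))))

poly-+ : ∀ {f g} → IsPoly f → IsPoly g → IsPoly (λ N → f N + g N)
poly-+ ((K , d) , p) ((K′ , d′) , p′) = (K + K′ , d + d′) , λ N →
  ≤-trans (+-mono-≤ (≤-trans (p N)  (*-monoʳ-≤ K  (^-monoʳ-≤ (suc N) (m≤m+n d d′))))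
                    (≤-trans (p′ N) (*-monoʳ-≤ K′ (^-monoʳ-≤ (suc N) (m≤n+m d′ d)))))
          (≤-reflexive (sym (*-distribʳ-+ (suc N ^ (d + d′)) K K′)))

poly-* : ∀ {f g} → IsPoly f → IsPoly g → IsPoly (λ N → f N * g N)
poly-* ((K , d) , p) ((K′ , d′) , p′) = (K * K′ , d + d′) , λ N →
  ≤-trans (*-mono-≤ (p N) (p′ N))
          (≤-reflexive (trans (*-interchange K (suc N ^ d) K′ (suc N ^ d′))
                              (cong (K * K′ *_) (sym (^-distribˡ-+-* (suc N) d d′)))))

poly-^ : ∀ {f} k → IsPoly f → IsPoly (λ N → f N ^ k)
poly-^ zero    p = poly-const 1
poly-^ (suc k) p = poly-* p (poly-^ k p)

-- Running times: Q N x says that x is an admissible argument of size N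

record TimeOn (Q : ℕ → ⟦ A ⟧ → Set) (c : Code A B) : Set where
  constructor timed
  field
    bound  : ℕ → ℕ
    poly   : IsPoly bound
    within : ∀ {N x} → Q N x → time (prog c) x ≤ bound N
open TimeOn

-- Without `loop` and `foldList` the time is bounded by a number that can be read off the program
-- text. Most of the timing analysis is therefore done by evaluation.
constTime : A ⇒ B → Maybe ℕ
constTime₂ : A ⇒ B → A ⇒ D → Maybe ℕ
constTime idₚ         = just 1
constTime (f ⨾ g) with constTime f | constTime g
... | just a | just b = just (suc (a + b))
... | _      | _      = nothing
constTime ⟨ f , g ⟩   = constTime₂ f g
constTime fstₚ        = just 1
constTime sndₚ        = just 1
constTime (lit _)     = just 1
constTime add         = just 1
constTime monus       = just 1
constTime quot        = just 1
constTime (ifz c then f else g) with constTime c | constTime₂ f g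
... | just a | just b = just (suc (a + b))
... | _      | _      = nothing
constTime (loop _)    = nothing
constTime nil         = just 1
constTime cons        = just 1
constTime (caseList f g) with constTime f | constTime g
... | just a | just b = just (suc (a + b))
... | _      | _      = nothing
constTime (foldList _) = nothing
constTime₂ f g with constTime f | constTime g
... | just a | just b = just (suc (a + b))
... | _      | _      = nothing

constTime-sound : (p : A ⇒ B) {K : ℕ} → constTime p ≡ just K → ∀ x → time p x ≤ K
constTime-sound idₚ refl x = ≤-refl
constTime-sound (f ⨾ g) eq x with constTime f in ef | constTime g in eg
constTime-sound (f ⨾ g) refl x | just a | just b =
  s≤s (+-mono-≤ (constTime-sound f ef x) (constTime-sound g eg _))
constTime-sound ⟨ f , g ⟩ eq x with constTime f in ef | constTime g in eg
constTime-sound ⟨ f , g ⟩ refl x | just a | just b =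
  s≤s (+-mono-≤ (constTime-sound f ef x) (constTime-sound g eg x))
constTime-sound fstₚ refl x = ≤-refl
constTime-sound sndₚ refl x = ≤-refl
constTime-sound (lit _) refl x = ≤-refl
constTime-sound add refl x = ≤-refl
constTime-sound monus refl x = ≤-refl
constTime-sound quot refl x = ≤-refl
constTime-sound (ifz c then f else g) eq x with constTime c in ec | constTime f in ef | constTime g in eg
constTime-sound (ifz c then f else g) refl x | just k | just a | just b with eval c x
... | zero  = s≤s (+-mono-≤ (constTime-sound c ec x)
                    (≤-trans (constTime-sound f ef x) (≤-trans (m≤m+n a b) (n≤1+n _))))
... | suc _ = s≤s (+-mono-≤ (constTime-sound c ec x)
                    (≤-trans (constTime-sound g eg x) (≤-trans (m≤n+m b a) (n≤1+n _))))
constTime-sound nil refl x = ≤-refl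
constTime-sound cons refl x = ≤-refl
constTime-sound (caseList f g) eq x with constTime f in ef | constTime g in eg
constTime-sound (caseList f g) refl ([]     , y) | just a | just b =
  s≤s (≤-trans (constTime-sound f ef y) (m≤m+n a b))
constTime-sound (caseList f g) refl (x ∷ xs , y) | just a | just b =
  s≤s (≤-trans (constTime-sound g eg _) (m≤n+m b a))

IsJust? : Maybe ℕ → Set
IsJust? (just _) = ⊤
IsJust? nothing  = ⊥

-- The hidden argument has type `⊤` as soon as `constTime` evaluates to `just`, and is then filled
-- in silently.
t-const : {Q : ℕ → ⟦ A ⟧ → Set} {c : Code A B} {_ : IsJust? (constTime (prog c))} → TimeOn Q c
t-const {c = c} {j} with constTime (prog c) in eq
... | just K = timed (λ _ → K) (poly-const K) (λ _ → constTime-sound (prog c) eq _)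

t-▸ : {Q : ℕ → ⟦ A ⟧ → Set} {R : ℕ → ⟦ B ⟧ → Set} {c : Code A B} {e : Code B D} →
  TimeOn Q c → TimeOn R e → (∀ {N x} → Q N x → R N (fun c x)) → TimeOn Q (c ▸ e)
t-▸ {R = R} {c = c} (timed b p w) (timed b′ p′ w′) f =
  timed (λ N → 1 + (b N + b′ N)) (poly-+ (poly-const 1) (poly-+ p p′))
    λ {N} {x} q → s≤s (+-mono-≤ (w q) (w′ (subst (R N) (sym (correct c x)) (f q))))

t-⟪⟫ : {Q : ℕ → ⟦ A ⟧ → Set} {c : Code A B} {e : Code A D} →
  TimeOn Q c → TimeOn Q e → TimeOn Q ⟪ c , e ⟫
t-⟪⟫ (timed b p w) (timed b′ p′ w′) =
  timed (λ N → 1 + (b N + b′ N)) (poly-+ (poly-const 1) (poly-+ p p′))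
    λ q → s≤s (+-mono-≤ (w q) (w′ q))

t-if0 : {Q : ℕ → ⟦ A ⟧ → Set} {c : Code A nat} {e f : Code A B} →
  TimeOn Q c → TimeOn Q e → TimeOn Q f → TimeOn Q (if0ᶜ c e f)
t-if0 {Q = Q} {c} {e} {f} (timed b p w) (timed b′ p′ w′) (timed b″ p″ w″) =
  timed (λ N → 1 + (b N + (b′ N + b″ N))) (poly-+ (poly-const 1) (poly-+ p (poly-+ p′ p″))) bnd
  where
  bnd : ∀ {N x} → Q N x → time (prog (if0ᶜ c e f)) x ≤ 1 + (b N + (b′ N + b″ N))
  bnd {N} {x} q with eval (prog c) x
  ... | zero  = s≤s (+-mono-≤ (w q) (≤-trans (w′ q) (m≤m+n _ _)))
  ... | suc _ = s≤s (+-mono-≤ (w q) (≤-trans (w″ q) (m≤n+m _ _)))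

-- The premise on `f` remembers which list was split; `t-main` needs this to know that head and tail
-- consist of final states.
t-case : {Q : ℕ → ⟦ Γ ⟧ → Set} {c : Code Γ (list A)} {e : Code Γ B} {f : Code (Γ ⊗ (A ⊗ list A)) B} →
  TimeOn Q c → TimeOn Q e →
  TimeOn (λ N (γ , a , as) → Q N γ × fun c γ ≡ a ∷ as) f →
  TimeOn Q (caseᶜ c e f)
t-case {Q = Q} {c} {e} {f} (timed b p w) (timed b′ p′ w′) (timed b″ p″ w″) =
  timed (λ N → 10 + (b N + (b′ N + b″ N))) (poly-+ (poly-const 10) (poly-+ p (poly-+ p′ p″))) bnd
  where
  bnd : ∀ {N x} → Q N x → time (prog (caseᶜ c e f)) x ≤ 10 + (b N + (b′ N + b″ N))
  bnd {N} {x} q with eval (prog c) x | correct c x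
  ... | [] | eq = begin
    suc (suc (time (prog c) x + 1) + suc (time (prog e) x))
      ≤⟨ +-monoʳ-≤ 1 (+-mono-≤ (s≤s (+-monoˡ-≤ 1 (w q))) (s≤s (≤-trans (w′ q) (m≤m+n (b′ N) (b″ N))))) ⟩
    suc (suc (b N + 1) + suc (b′ N + b″ N))
      ≡⟨ cong (2 +_) (trans (+-assoc (b N) 1 _) (trans (+-suc (b N) (1 + _)) (cong suc (+-suc (b N) _)))) ⟩
    4 + (b N + (b′ N + b″ N))
      ≤⟨ +-monoˡ-≤ _ (s≤s (s≤s (s≤s (s≤s (z≤n {6}))))) ⟩
    10 + (b N + (b′ N + b″ N)) ∎
    where open ≤-Reasoning
  ... | a ∷ as | eq = begin
    suc (suc (time (prog c) x + 1) + suc (4 + time (prog f) (x , a , as)))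
      ≤⟨ +-monoʳ-≤ 1 (+-mono-≤ (s≤s (+-monoˡ-≤ 1 (w q)))
           (+-monoʳ-≤ 5 (≤-trans (w″ (q , sym eq)) (m≤n+m (b″ N) (b′ N))))) ⟩
    suc (suc (b N + 1) + (5 + (b′ N + b″ N)))
      ≡⟨ cong (2 +_) (trans (+-assoc (b N) 1 _) (trans (sym (+-assoc (b N) 6 _))
           (trans (cong (_+ (b′ N + b″ N)) (+-comm (b N) 6)) (+-assoc 6 (b N) _)))) ⟩
    8 + (b N + (b′ N + b″ N))
      ≤⟨ +-monoˡ-≤ _ (m≤m+n 8 2) ⟩
    10 + (b N + (b′ N + b″ N)) ∎
    where open ≤-Reasoning

-- `J` is an invariant of the accumulator. The time of a round may depend on how large the
-- accumulator has grown, which the context alone does not control.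
t-fold : {Q : ℕ → ⟦ Γ ⟧ → Set} {c : Code Γ (list A)} {e : Code Γ B} {f : Code (Γ ⊗ (A ⊗ B)) B}
  (J : ℕ → ⟦ Γ ⟧ → ⟦ B ⟧ → Set) {ℓ : ℕ → ℕ} → IsPoly ℓ →
  TimeOn Q c → TimeOn Q e →
  TimeOn (λ N (γ , a , b) → Q N γ × a ∈ fun c γ × J N γ b) f →
  (∀ {N γ} → Q N γ → length (fun c γ) ≤ ℓ N) →
  (∀ {N γ} → Q N γ → J N γ (fun e γ)) →
  (∀ {N γ a b} → Q N γ → a ∈ fun c γ → J N γ b → J N γ (fun f (γ , a , b))) →
  TimeOn Q (foldᶜ c e f)
t-fold {Γ} {A} {B} {Q} {c} {e} {f} J {ℓ} pℓ (timed b p w) (timed b′ p′ w′) (timed b″ p″ w″) len ini pres =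
  -- The constants leave slack: the actual overheads are 7 outside the rounds and 15 per round.
  timed (λ N → 10 + (b N + b′ N) + ℓ N * (20 + b″ N))
    (poly-+ (poly-+ (poly-const 10) (poly-+ p p′)) (poly-* pℓ (poly-+ (poly-const 20) p″))) bnd
  where
  stepT : ⟦ A ⟧ → ⟦ Γ ⟧ × ⟦ B ⟧ → ℕ
  stepT a q = time (foldBody (prog f)) (a , q)
  stepV : ⟦ A ⟧ → ⟦ Γ ⟧ × ⟦ B ⟧ → ⟦ Γ ⟧ × ⟦ B ⟧
  stepV a q = eval (foldBody (prog f)) (a , q)
  holds : ∀ {N γ} → Q N γ → ∀ xs → (∀ {a} → a ∈ xs → a ∈ fun c γ) →
    J N γ (foldr (λ a b → fun f (γ , a , b)) (fun e γ) xs)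
  holds q []       sub = ini q
  holds q (x ∷ xs) sub = pres q (sub (here refl)) (holds q xs (λ m → sub (there m)))
  go : ∀ {N γ} → Q N γ → ∀ xs → (∀ {a} → a ∈ xs → a ∈ fun c γ) →
    foldTime stepV stepT (γ , fun e γ) xs ≤ 1 + length xs * (20 + b″ N)
  go q [] sub = ≤-refl
  go {N} {γ} q (x ∷ xs) sub rewrite foldBody-eval f γ (fun e γ) xs = begin
    15 + time (prog f) _ + foldTime stepV stepT (γ , fun e γ) xs
      ≤⟨ +-mono-≤ (+-monoʳ-≤ 15 (w″ (q , sub (here refl) , holds q xs (λ m → sub (there m)))))
                  (go q xs (λ m → sub (there m))) ⟩
    15 + b″ N + (1 + length xs * (20 + b″ N))
      ≤⟨ +-monoˡ-≤ _ (+-monoˡ-≤ (b″ N) (m≤m+n 15 5)) ⟩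
    20 + b″ N + (1 + length xs * (20 + b″ N))
      ≡⟨ +-suc (20 + b″ N) (length xs * (20 + b″ N)) ⟩
    1 + (20 + b″ N + length xs * (20 + b″ N)) ∎
    where open ≤-Reasoning
  bnd : ∀ {N x} → Q N x → time (prog (foldᶜ c e f)) x ≤ 10 + (b N + b′ N) + ℓ N * (20 + b″ N)
  bnd {N} {x} q rewrite correct c x | correct e x = begin
    suc (suc (suc (time (prog c) x + suc (1 + time (prog e) x)) + T) + 1)
      ≡⟨ cong (2 +_) (+-comm _ 1) ⟩
    4 + (time (prog c) x + (2 + time (prog e) x) + T)
      ≤⟨ +-monoʳ-≤ 4 (+-mono-≤ (+-mono-≤ (w q) (+-monoʳ-≤ 2 (w′ q)))
           (≤-trans (go q (fun c x) id) (+-monoʳ-≤ 1 (*-monoˡ-≤ (20 + b″ N) (len q))))) ⟩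
    4 + (b N + (2 + b′ N) + (1 + R))
      ≡⟨ cong (4 +_) (trans (+-suc _ R) (cong (λ z → 1 + (z + R)) (trans (sym (+-assoc (b N) 2 (b′ N)))
           (trans (cong (_+ b′ N) (+-comm (b N) 2)) (+-assoc 2 (b N) (b′ N)))))) ⟩
    7 + (b N + b′ N) + R
      ≤⟨ +-monoˡ-≤ R (+-monoˡ-≤ _ (m≤m+n 7 3)) ⟩
    10 + (b N + b′ N) + R ∎
    where
    open ≤-Reasoning
    T = foldTime stepV stepT (x , fun e x) (fun c x)
    R = ℓ N * (20 + b″ N)

t-drop : TimeOn {list A ⊗ nat} (λ N (_ , k) → k ≤ N) dropᶜ
t-drop {A} = timed (λ N → 1 + N * 10) (poly-+ (poly-const 1) (poly-* poly-id (poly-const 10)))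
  λ {N} {x} k≤N → ≤-trans (go (proj₁ x) (proj₂ x)) (+-monoʳ-≤ 1 (*-monoˡ-≤ 10 k≤N))
  where
  tailₚ : list A ⇒ list A
  tailₚ = ⟨ idₚ , idₚ ⟩ ⨾ caseList nil (fstₚ ⨾ sndₚ)
  tail≤ : ∀ xs → time tailₚ xs ≤ 9
  tail≤ []       = m≤m+n _ _
  tail≤ (x ∷ xs) = m≤m+n _ _
  go : ∀ xs k → loopTime (eval tailₚ) (time tailₚ) xs k ≤ 1 + k * 10
  go xs zero    = ≤-refl
  go xs (suc k) = begin
    1 + (time tailₚ (fold xs (eval tailₚ) k) + loopTime (eval tailₚ) (time tailₚ) xs k)
      ≤⟨ +-monoʳ-≤ 1 (+-mono-≤ (tail≤ (fold xs (eval tailₚ) k)) (go xs k)) ⟩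
    1 + (9 + (1 + k * 10))
      ≡⟨⟩
    1 + (10 + k * 10) ∎
    where open ≤-Reasoning

-- The program

CellTy RowTy EntryTy StateTy : Ty
-- (pending , server arrival , cloud arrival) , (side , completion time)
CellTy  = (nat ⊗ nat ⊗ nat) ⊗ (nat ⊗ nat)
RowTy   = nat ⊗ nat ⊗ list nat
EntryTy = nat ⊗ RowTy ⊗ CellTy
-- entries , time at which the server is free , cost
StateTy = list EntryTy ⊗ nat ⊗ nat

-- Only addition and truncated subtraction are at hand. The sum of both truncated differences
-- vanishes exactly for equal numbers and serves as equality test. In `mergeᶜ` the value 0 is
-- absorbing: once a predecessor excludes a side, it stays excluded.
maxᶜ distᶜ mergeᶜ : Code Γ nat → Code Γ nat → Code Γ nat
maxᶜ   c e = c ⊕ (e ⊖ c)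
distᶜ  c e = (c ⊖ e) ⊕ (e ⊖ c)
mergeᶜ c e = if0ᶜ c (litᶜ 0) (if0ᶜ e (litᶜ 0) (maxᶜ c e))

nthᶜ : Code (list nat ⊗ nat) nat
nthᶜ = caseᶜ dropᶜ (litᶜ 0) (sndᶜ ▸ fstᶜ)

pendᶜ asᶜ acᶜ : Code CellTy nat
pendᶜ = fstᶜ ▸ fstᶜ
asᶜ   = fstᶜ ▸ sndᶜ ▸ fstᶜ
acᶜ   = fstᶜ ▸ sndᶜ ▸ sndᶜ

cellᶜ : Code EntryTy CellTy
cellᶜ = sndᶜ ▸ sndᶜ

psᶜ pcᶜ : Code EntryTy nat
psᶜ = sndᶜ ▸ fstᶜ ▸ fstᶜ
pcᶜ = sndᶜ ▸ fstᶜ ▸ sndᶜ ▸ fstᶜ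

delaysᶜ : Code EntryTy (list nat)
delaysᶜ = sndᶜ ▸ fstᶜ ▸ sndᶜ ▸ sndᶜ

-- Informs a job of a completion at time C on side z over an edge of coded delay d.
pushᶜ : Code (nat ⊗ nat ⊗ nat ⊗ nat ⊗ CellTy) CellTy
pushᶜ = if0ᶜ d cell (if0ᶜ (cell ▸ pendᶜ) cell ⟪ ⟪ (cell ▸ pendᶜ) ⊖ litᶜ 1 ,
    ⟪ mergeᶜ (cell ▸ asᶜ) (if0ᶜ z same cross) , mergeᶜ (cell ▸ acᶜ) (if0ᶜ z cross same) ⟫ ⟫ ,
    cell ▸ sndᶜ ⟫)
  where
  T = nat ⊗ nat ⊗ nat ⊗ nat ⊗ CellTy
  L z C d same cross : Code T nat
  L = fstᶜ
  z = sndᶜ ▸ fstᶜ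
  C = sndᶜ ▸ sndᶜ ▸ fstᶜ
  d = sndᶜ ▸ sndᶜ ▸ sndᶜ ▸ fstᶜ
  cell : Code T CellTy
  cell  = sndᶜ ▸ sndᶜ ▸ sndᶜ ▸ sndᶜ
  same  = litᶜ 1 ⊕ C
  -- The coded delay is 1 + the delay, so `C ⊕ d` is already a coded arrival. A crossing delay above
  -- the guess excludes the side.
  cross = if0ᶜ ((d ⊖ litᶜ 1) ⊖ L) (C ⊕ d) (litᶜ 0)

AssignTy : Ty
AssignTy = nat ⊗ EntryTy ⊗ nat ⊗ nat ⊗ list EntryTy

updateᶜ : Code (AssignTy ⊗ EntryTy) EntryTy
updateᶜ = ⟪ idx , ⟪ sndᶜ ▸ sndᶜ ▸ fstᶜ , if0ᶜ (distᶜ idx (e ▸ fstᶜ))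
      -- The arrivals of an assigned job are erased, so that states differing only in their past
      -- receive equal keys.
      ⟪ ⟪ litᶜ 0 , ⟪ litᶜ 0 , litᶜ 0 ⟫ ⟫ , ⟪ z , C ⟫ ⟫
      (⟪ fstᶜ ▸ fstᶜ , ⟪ z , ⟪ C , ⟪ ⟪ e ▸ delaysᶜ , idx ⟫ ▸ nthᶜ , sndᶜ ▸ cellᶜ ⟫ ⟫ ⟫ ⟫ ▸ pushᶜ) ⟫ ⟫
  where
  T = AssignTy ⊗ EntryTy
  idx z C : Code T nat
  idx = sndᶜ ▸ fstᶜ
  z   = fstᶜ ▸ sndᶜ ▸ sndᶜ ▸ fstᶜ
  C   = fstᶜ ▸ sndᶜ ▸ sndᶜ ▸ sndᶜ ▸ fstᶜ
  e : Code T EntryTy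
  e   = fstᶜ ▸ sndᶜ ▸ fstᶜ

assignᶜ : Code AssignTy (list EntryTy)
assignᶜ = foldᶜ (sndᶜ ▸ sndᶜ ▸ sndᶜ ▸ sndᶜ) nilᶜ
  ((⟪ fstᶜ , sndᶜ ▸ fstᶜ ⟫ ▸ updateᶜ) ∷ᶜ (sndᶜ ▸ sndᶜ))

-- Arguments: ((L , b) , state) , (side , arrival , coded processing time) , entry , output
TryTy : Ty
TryTy = ((nat ⊗ nat) ⊗ StateTy) ⊗ (nat ⊗ nat ⊗ nat) ⊗ EntryTy ⊗ list StateTy

module _ where
  private
    L b F cost z a pr p C extra violation : Code TryTy nat
    L     = fstᶜ ▸ fstᶜ ▸ fstᶜ
    b     = fstᶜ ▸ fstᶜ ▸ sndᶜ
    F     = fstᶜ ▸ sndᶜ ▸ sndᶜ ▸ fstᶜ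
    cost  = fstᶜ ▸ sndᶜ ▸ sndᶜ ▸ sndᶜ
    z     = sndᶜ ▸ fstᶜ ▸ fstᶜ
    a     = sndᶜ ▸ fstᶜ ▸ sndᶜ ▸ fstᶜ
    pr    = sndᶜ ▸ fstᶜ ▸ sndᶜ ▸ sndᶜ
    e : Code TryTy EntryTy
    e     = sndᶜ ▸ sndᶜ ▸ fstᶜ
    p     = pr ⊖ litᶜ 1
    C     = maxᶜ (if0ᶜ z F (litᶜ 0)) (a ⊖ litᶜ 1) ⊕ p
    extra = if0ᶜ z (litᶜ 0) p
    -- Each summand is 0 exactly when one condition holds: the job is unassigned with all
    -- predecessors assigned, the side is not excluded, the processing time is finite, it is within
    -- the guess, the budget suffices. One zero test decides the conjunction.
    violation = distᶜ (e ▸ cellᶜ ▸ pendᶜ) (litᶜ 1) ⊕ (litᶜ 1 ⊖ a) ⊕ (litᶜ 1 ⊖ pr) ⊕ (p ⊖ L) ⊕ ((cost ⊕ extra) ⊖ b)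

  violationᶜ : Code TryTy nat
  violationᶜ = violation

  assignArgᶜ : Code TryTy AssignTy
  assignArgᶜ = ⟪ L , ⟪ e , ⟪ z , ⟪ C , fstᶜ ▸ sndᶜ ▸ fstᶜ ⟫ ⟫ ⟫ ⟫

  accountᶜ : Code TryTy (nat ⊗ nat)
  accountᶜ = ⟪ if0ᶜ z C F , cost ⊕ extra ⟫

tryᶜ : Code TryTy (list StateTy)
tryᶜ = if0ᶜ violationᶜ (⟪ assignArgᶜ ▸ assignᶜ , accountᶜ ⟫ ∷ᶜ (sndᶜ ▸ sndᶜ ▸ sndᶜ)) (sndᶜ ▸ sndᶜ ▸ sndᶜ)

ExpandTy : Ty
ExpandTy = ((nat ⊗ nat) ⊗ StateTy) ⊗ list StateTy

expandᶜ : Code ExpandTy (list StateTy)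
expandᶜ = foldᶜ (fstᶜ ▸ sndᶜ ▸ fstᶜ) sndᶜ
  (⟪ ctx , ⟪ ⟪ litᶜ 1 , ⟪ e ▸ cellᶜ ▸ acᶜ , e ▸ pcᶜ ⟫ ⟫ , ⟪ e ,
    -- The server time is raised by 1 to share the coding of cloud times, in which 0 stands for ∞.
    ⟪ ctx , ⟪ ⟪ litᶜ 0 , ⟪ e ▸ cellᶜ ▸ asᶜ , litᶜ 1 ⊕ (e ▸ psᶜ) ⟫ ⟫ , ⟪ e , sndᶜ ▸ sndᶜ ⟫ ⟫ ⟫ ▸ tryᶜ
    ⟫ ⟫ ⟫ ▸ tryᶜ)
  where
  T = ExpandTy ⊗ EntryTy ⊗ list StateTy
  ctx : Code T ((nat ⊗ nat) ⊗ StateTy)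
  ctx = fstᶜ ▸ fstᶜ
  e : Code T EntryTy
  e = sndᶜ ▸ fstᶜ

-- ⌈ a / (1 + u) ⌉
ceilᶜ : Code Γ nat → Code Γ nat → Code Γ nat
ceilᶜ u a = ⟪ a ⊕ u , litᶜ 1 ⊕ u ⟫ ▸ quotᶜ

DiffTy : Ty
DiffTy = nat ⊗ StateTy ⊗ StateTy

-- Of `pend` only its vanishing is compared: the exact count of unassigned predecessors follows from
-- the set of assigned jobs.
cellDiffᶜ : Code (nat ⊗ CellTy ⊗ CellTy) nat
cellDiffᶜ = distᶜ (litᶜ 1 ⊖ (x ▸ pendᶜ)) (litᶜ 1 ⊖ (y ▸ pendᶜ))
  ⊕ distᶜ (ceilᶜ fstᶜ (x ▸ asᶜ)) (ceilᶜ fstᶜ (y ▸ asᶜ))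
  ⊕ distᶜ (ceilᶜ fstᶜ (x ▸ acᶜ)) (ceilᶜ fstᶜ (y ▸ acᶜ))
  where
  x y : Code (nat ⊗ CellTy ⊗ CellTy) CellTy
  x = sndᶜ ▸ fstᶜ
  y = sndᶜ ▸ sndᶜ

diffᶜ : Code DiffTy nat
diffᶜ = foldᶜ (sndᶜ ▸ fstᶜ ▸ fstᶜ)
  (distᶜ (ceilᶜ fstᶜ (sndᶜ ▸ fstᶜ ▸ sndᶜ ▸ fstᶜ)) (ceilᶜ fstᶜ (sndᶜ ▸ sndᶜ ▸ sndᶜ ▸ fstᶜ)))
  (caseᶜ (⟪ fstᶜ ▸ sndᶜ ▸ sndᶜ ▸ fstᶜ , sndᶜ ▸ fstᶜ ▸ fstᶜ ⟫ ▸ dropᶜ) (sndᶜ ▸ sndᶜ)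
    ((fstᶜ ▸ sndᶜ ▸ sndᶜ) ⊕ (⟪ fstᶜ ▸ fstᶜ ▸ fstᶜ , ⟪ fstᶜ ▸ sndᶜ ▸ fstᶜ ▸ cellᶜ , sndᶜ ▸ fstᶜ ▸ cellᶜ ⟫ ⟫ ▸ cellDiffᶜ)))

-- The fold carries the cheapest state found so far that is equivalent to the new one, and
-- separately the states that are not equivalent to it.
insertᶜ : Code (nat ⊗ StateTy ⊗ list StateTy) (list StateTy)
insertᶜ = foldᶜ (sndᶜ ▸ sndᶜ) ⟪ sndᶜ ▸ fstᶜ , nilᶜ ⟫
  (if0ᶜ (⟪ fstᶜ ▸ fstᶜ , ⟪ fstᶜ ▸ sndᶜ ▸ fstᶜ , y ⟫ ⟫ ▸ diffᶜ)
    (if0ᶜ ((best ▸ sndᶜ ▸ sndᶜ) ⊖ (y ▸ sndᶜ ▸ sndᶜ)) ⟪ best , rest ⟫ ⟪ y , rest ⟫)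
    ⟪ best , y ∷ᶜ rest ⟫)
  ▸ consᶜ
  where
  T = (nat ⊗ StateTy ⊗ list StateTy) ⊗ (StateTy ⊗ (StateTy ⊗ list StateTy))
  y best : Code T StateTy
  y    = sndᶜ ▸ fstᶜ
  best = sndᶜ ▸ sndᶜ ▸ fstᶜ
  rest : Code T (list StateTy)
  rest = sndᶜ ▸ sndᶜ ▸ sndᶜ

trimᶜ : Code (nat ⊗ list StateTy) (list StateTy)
trimᶜ = foldᶜ sndᶜ nilᶜ (⟪ fstᶜ ▸ fstᶜ , sndᶜ ⟫ ▸ insertᶜ)

StepTy : Ty
StepTy = (nat ⊗ nat) ⊗ nat ⊗ list StateTy

successorsᶜ : Code StepTy (list StateTy)
successorsᶜ = foldᶜ (sndᶜ ▸ sndᶜ) nilᶜ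
  (⟪ ⟪ fstᶜ ▸ fstᶜ , sndᶜ ▸ fstᶜ ⟫ , sndᶜ ▸ sndᶜ ⟫ ▸ expandᶜ)

stepᶜ : Code StepTy (list StateTy)
stepᶜ = ⟪ sndᶜ ▸ fstᶜ , successorsᶜ ⟫ ▸ trimᶜ

RunTy : Ty
RunTy = GraphTy ⊗ StateTy ⊗ (nat ⊗ nat) ⊗ nat

-- The graph serves as a counter: one round per job.
runᶜ : Code RunTy (list StateTy)
runᶜ = foldᶜ fstᶜ ((sndᶜ ▸ fstᶜ) ∷ᶜ nilᶜ)
  (⟪ fstᶜ ▸ sndᶜ ▸ sndᶜ ▸ fstᶜ , ⟪ fstᶜ ▸ sndᶜ ▸ sndᶜ ▸ sndᶜ , sndᶜ ▸ sndᶜ ⟫ ⟫ ▸ stepᶜ)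

countᶜ : Code GraphTy nat
countᶜ = foldᶜ idᶜ (litᶜ 0) ((sndᶜ ▸ sndᶜ) ⊕ litᶜ 1)

indegreeᶜ : Code (GraphTy ⊗ nat) nat
indegreeᶜ = foldᶜ fstᶜ (litᶜ 0)
  (if0ᶜ (⟪ sndᶜ ▸ fstᶜ ▸ sndᶜ ▸ sndᶜ , fstᶜ ▸ sndᶜ ⟫ ▸ nthᶜ) (litᶜ 0) (litᶜ 1) ⊕ (sndᶜ ▸ sndᶜ))

-- The accumulated counter is 1 + the index of the row last visited.
entriesᶜ : Code GraphTy (nat ⊗ list EntryTy)
entriesᶜ = foldᶜ idᶜ ⟪ countᶜ , nilᶜ ⟫
  ⟪ idx , ⟪ idx , ⟪ sndᶜ ▸ fstᶜ ,
      ⟪ ⟪ litᶜ 1 ⊕ (⟪ fstᶜ , idx ⟫ ▸ indegreeᶜ) , ⟪ litᶜ 1 , litᶜ 1 ⟫ ⟫ , ⟪ litᶜ 0 , litᶜ 0 ⟫ ⟫ ⟫ ⟫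
    ∷ᶜ (sndᶜ ▸ sndᶜ ▸ sndᶜ) ⟫
  where
  idx : Code (GraphTy ⊗ RowTy ⊗ nat ⊗ list EntryTy) nat
  idx = (sndᶜ ▸ sndᶜ ▸ fstᶜ) ⊖ litᶜ 1

initᶜ : Code GraphTy StateTy
initᶜ = ⟪ entriesᶜ ▸ sndᶜ , ⟪ litᶜ 0 , litᶜ 0 ⟫ ⟫

-- Absent edges and infinite times decode to 0. Such guesses do no harm, since the states found
-- under any guess are sound.
guessesᶜ : Code GraphTy (list nat)
guessesᶜ = foldᶜ idᶜ nilᶜ
  ((row ▸ fstᶜ) ∷ᶜ ((row ▸ sndᶜ ▸ fstᶜ) ⊖ litᶜ 1) ∷ᶜ
    foldᶜ (row ▸ sndᶜ ▸ sndᶜ) (sndᶜ ▸ sndᶜ) (((sndᶜ ▸ fstᶜ) ⊖ litᶜ 1) ∷ᶜ (sndᶜ ▸ sndᶜ)))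
  where
  row : Code (GraphTy ⊗ RowTy ⊗ list nat) RowTy
  row = sndᶜ ▸ fstᶜ

-- n * (1 + ⌊ 1/ε ⌋)
precisionᶜ : Code Input nat
precisionᶜ = foldᶜ fstᶜ (litᶜ 0)
  (litᶜ 1 ⊕ (⟪ fstᶜ ▸ sndᶜ ▸ sndᶜ ▸ sndᶜ , fstᶜ ▸ sndᶜ ▸ sndᶜ ▸ fstᶜ ⟫ ▸ quotᶜ) ⊕ (sndᶜ ▸ sndᶜ))

runArgᶜ : Code (Input ⊗ nat) RunTy
runArgᶜ = ⟪ g , ⟪ g ▸ initᶜ , ⟪ ⟪ sndᶜ , fstᶜ ▸ sndᶜ ▸ fstᶜ ⟫ , ⟪ sndᶜ , fstᶜ ▸ precisionᶜ ⟫ ▸ quotᶜ ⟫ ⟫ ⟫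
  where
  g : Code (Input ⊗ nat) GraphTy
  g = fstᶜ ▸ fstᶜ

finalsᶜ : Code Input (list StateTy)
finalsᶜ = foldᶜ (fstᶜ ▸ guessesᶜ) nilᶜ
  (foldᶜ (⟪ fstᶜ , sndᶜ ▸ fstᶜ ⟫ ▸ runArgᶜ ▸ runᶜ) (sndᶜ ▸ sndᶜ) (sndᶜ ▸ consᶜ))

bestᶜ : Code (StateTy ⊗ list StateTy) StateTy
bestᶜ = foldᶜ sndᶜ fstᶜ
  (if0ᶜ ((sndᶜ ▸ fstᶜ ▸ sndᶜ ▸ fstᶜ) ⊖ (sndᶜ ▸ sndᶜ ▸ sndᶜ ▸ fstᶜ)) (sndᶜ ▸ fstᶜ) (sndᶜ ▸ sndᶜ))

scheduleᶜ : Code StateTy Output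
scheduleᶜ = foldᶜ fstᶜ nilᶜ ((sndᶜ ▸ fstᶜ ▸ cellᶜ ▸ sndᶜ) ∷ᶜ (sndᶜ ▸ sndᶜ))

mainᶜ : Code Input Output
mainᶜ = caseᶜ finalsᶜ nilᶜ (sndᶜ ▸ bestᶜ ▸ scheduleᶜ)

-- Sums and lists indexed by Fin

-- Only the term at `j` changes; the crosswise form avoids subtraction.
sum-update : ∀ {n} {f g : Fin n → ℕ} (j : Fin n) → (∀ k → k ≢ j → f k ≡ g k) →
  sum f + g j ≡ sum g + f j
sum-update {suc n} {f} {g} j agree = begin
  sum f + g j                      ≡⟨ cong (_+ g j) (sum-remove {i = j} f) ⟩
  f j + sum (removeAt f j) + g j   ≡⟨ cong (λ z → f j + z + g j)
                                            (sum-cong-≗ λ i → agree (punchIn j i) (Finₚ.punchInᵢ≢i j i)) ⟩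
  f j + sum (removeAt g j) + g j   ≡⟨ +-comm _ (g j) ⟩
  g j + (f j + sum (removeAt g j)) ≡⟨ cong (g j +_) (+-comm (f j) _) ⟩
  g j + (sum (removeAt g j) + f j) ≡⟨ sym (+-assoc (g j) _ (f j)) ⟩
  g j + sum (removeAt g j) + f j   ≡⟨ cong (_+ f j) (sym (sum-remove {i = j} g)) ⟩
  sum g + f j                      ∎
  where open ≡-Reasoning

sum-mono : ∀ {n} {f g : Fin n → ℕ} → (∀ k → f k ≤ g k) → sum f ≤ sum g
sum-mono {zero}  h = z≤n
sum-mono {suc n} h = +-mono-≤ (h zero) (sum-mono (h ∘ suc))

term≤sum : ∀ {n} (f : Fin n → ℕ) k → f k ≤ sum f
term≤sum f zero    = m≤m+n _ _
term≤sum f (suc k) = ≤-trans (term≤sum (f ∘ suc) k) (m≤n+m _ _)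

sum-const : ∀ n c → sum {n} (λ _ → c) ≡ n * c
sum-const zero    c = refl
sum-const (suc n) c = cong (c +_) (sum-const n c)

sum≡0 : ∀ {n} (f : Fin n → ℕ) → (∀ k → f k ≡ 0) → sum f ≡ 0
sum≡0 {zero}  f h = refl
sum≡0 {suc n} f h = cong₂ _+_ (h zero) (sum≡0 (f ∘ suc) (h ∘ suc))

foldr-sum : ∀ {n} {f : X → ℕ → ℕ} (e : Fin n → X) (h : Fin n → ℕ) {c} →
  (∀ k b → f (e k) b ≡ h k + b) → foldr f c (tabulate e) ≡ sum h + c
foldr-sum {n = zero}  e h eq = refl
foldr-sum {n = suc n} e h {c} eq =
  trans (eq zero _) (trans (cong (h zero +_) (foldr-sum (e ∘ suc) (h ∘ suc) (λ k → eq (suc k))))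
                           (sym (+-assoc (h zero) _ c)))

foldr-tabulate : ∀ {n} {f : X → List Y → List Y} (e : Fin n → X) (e′ : Fin n → Y) →
  (∀ k b → f (e k) b ≡ e′ k ∷ b) → foldr f [] (tabulate e) ≡ tabulate e′
foldr-tabulate {n = zero}  e e′ eq = refl
foldr-tabulate {n = suc n} e e′ eq =
  trans (eq zero _) (cong (e′ zero ∷_) (foldr-tabulate (e ∘ suc) (e′ ∘ suc) (λ k → eq (suc k))))

drop-tabulate : ∀ {n} (f : Fin n → X) k → ∃[ r ] drop (toℕ k) (tabulate f) ≡ f k ∷ r
drop-tabulate f zero    = _ , refl
drop-tabulate f (suc k) = drop-tabulate (f ∘ suc) k

nth-tabulate : ∀ {n} (f : Fin n → ℕ) k → fun nthᶜ (tabulate f , toℕ k) ≡ f k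
nth-tabulate f k rewrite proj₂ (drop-tabulate f k) = refl

∈-foldr⁻ : {R : X → Y → Set} {f : X → List Y → List Y} {y : Y} (xs : List X) {b₀ : List Y} →
  (∀ {a} b → a ∈ xs → y ∈ f a b → y ∈ b ⊎ R a y) → y ∈ foldr f b₀ xs →
  y ∈ b₀ ⊎ (∃[ a ] a ∈ xs × R a y)
∈-foldr⁻ []       h m = inj₁ m
∈-foldr⁻ {R = R} (x ∷ xs) h m with h _ (here refl) m
... | inj₂ r  = inj₂ (x , here refl , r)
... | inj₁ m′ with ∈-foldr⁻ {R = R} xs (λ b i → h b (there i)) m′
...   | inj₁ m″          = inj₁ m″
...   | inj₂ (a , i , r) = inj₂ (a , there i , r)

∈-foldr-tabulate⁺ : ∀ {n} (e : Fin n → X) {f : X → List Y → List Y} {y : Y} {b₀} k →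
  (∀ k b → y ∈ b → y ∈ f (e k) b) → (∀ b → y ∈ f (e k) b) → y ∈ foldr f b₀ (tabulate e)
∈-foldr-tabulate⁺ e zero    mono h = h _
∈-foldr-tabulate⁺ e (suc k) mono h = mono zero _ (∈-foldr-tabulate⁺ (e ∘ suc) k (λ i → mono (suc i)) h)

∈-foldr-tabulate-mono : ∀ {n} (e : Fin n → X) {f : X → List Y → List Y} {y : Y} {b₀} →
  (∀ k b → y ∈ b → y ∈ f (e k) b) → y ∈ b₀ → y ∈ foldr f b₀ (tabulate e)
∈-foldr-tabulate-mono {n = zero}  e mono m = m
∈-foldr-tabulate-mono {n = suc n} e mono m = mono zero _ (∈-foldr-tabulate-mono (e ∘ suc) (λ i → mono (suc i)) m)

dist : ℕ → ℕ → ℕ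
dist m n = (m ∸ n) + (n ∸ m)

dist≡0⇒≡ : ∀ m n → dist m n ≡ 0 → m ≡ n
dist≡0⇒≡ m n eq = ≤-antisym (m∸n≡0⇒m≤n (m+n≡0⇒m≡0 (m ∸ n) eq)) (m∸n≡0⇒m≤n (m+n≡0⇒n≡0 (m ∸ n) eq))

dist-refl : ∀ {m n} → m ≡ n → dist m n ≡ 0
dist-refl {m} refl = cong₂ _+_ (n∸n≡0 m) (n∸n≡0 m)

terms≡0 : ∀ a {b c d e} → a + b + c + d + e ≡ 0 → a ≡ 0 × b ≡ 0 × c ≡ 0 × d ≡ 0 × e ≡ 0
terms≡0 zero {zero} {zero} {zero} {zero} _ = refl , refl , refl , refl , refl

max : ℕ → ℕ → ℕ
max m n = m + (n ∸ m)

m≤max : ∀ m n → m ≤ max m n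
m≤max m n = m≤m+n m (n ∸ m)

n≤max : ∀ m n → n ≤ max m n
n≤max m n = m≤n+m∸n n m

max-lub : ∀ {m n k} → m ≤ k → n ≤ k → max m n ≤ k
max-lub {m} {n} {k} m≤k n≤k with ≤-total m n
... | inj₁ m≤n = ≤-trans (≤-reflexive (m+[n∸m]≡n m≤n)) n≤k
... | inj₂ n≤m = ≤-trans (≤-reflexive (trans (cong (m +_) (m≤n⇒m∸n≡0 n≤m)) (+-identityʳ m))) m≤k

merge : ℕ → ℕ → ℕ
merge zero    _         = 0
merge (suc m) zero      = 0
merge (suc m) v@(suc _) = max (suc m) v

ceil : ℕ → ℕ → ℕ
ceil u a = quotient (a + u) (suc u)

-- Partial schedules

-- pend is 0 for an assigned job and 1 + the number of unassigned predecessors for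
-- an unassigned one.  An arrival is 1 + the earliest time at which the job may
-- start on that side as far as its assigned predecessors are concerned, or 0 if
-- one of them excludes that side.
record Cell : Set where
  constructor mkCell
  field
    pend as ac : ℕ
    sd         : Side
    C          : ℕ
open Cell public

arrival : Cell → Side → ℕ
arrival c server = as c
arrival c cloud  = ac c

encCell : Cell → ⟦ CellTy ⟧
encCell c = (pend c , as c , ac c) , encodeSide (sd c) , C c

other : ℕ → ℕ → ℕ → ℕ
other L t d = if0 (d ∸ L) (t + suc d) 0

reach : ℕ → ℕ → ℕ → Side → Side → ℕ
reach L t d server server = suc t
reach L t d server cloud  = other L t d
reach L t d cloud  server = other L t d
reach L t d cloud  cloud  = suc t

push : ℕ → Side → ℕ → ℕ → Cell → Cell
push L z t zero    c                          = c
push L z t (suc d) c@(mkCell zero    _ _ _ _) = c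
push L z t (suc d) (mkCell (suc q) a₁ a₂ z′ t′) =
  mkCell q (merge a₁ (reach L t d z server)) (merge a₂ (reach L t d z cloud)) z′ t′

merge-if0 : ∀ m v → if0 m 0 (if0 v 0 (max m v)) ≡ merge m v
merge-if0 zero    v       = refl
merge-if0 (suc m) zero    = refl
merge-if0 (suc m) (suc v) = refl

pushᶜ-push : ∀ L z t d c → fun pushᶜ (L , encodeSide z , t , d , encCell c) ≡ encCell (push L z t d c)
pushᶜ-push L z      t zero    c                          = refl
pushᶜ-push L z      t (suc d) c@(mkCell zero    _ _ _ _) = refl
pushᶜ-push L server t (suc d) (mkCell (suc q) a₁ a₂ z′ t′) =
  cong₂ (λ a b → (q , a , b) , encodeSide z′ , t′) (merge-if0 a₁ (suc t)) (merge-if0 a₂ (other L t d))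
pushᶜ-push L cloud  t (suc d) (mkCell (suc q) a₁ a₂ z′ t′) =
  cong₂ (λ a b → (q , a , b) , encodeSide z′ , t′) (merge-if0 a₁ (other L t d)) (merge-if0 a₂ (suc t))

onServer : Side → ℕ → ℕ → ℕ
onServer server x y = x
onServer cloud  x y = y

module Semantics (G : Instance) where
  open Instance G

  dl : Job → Job → ℕ
  dl i k = encodeMaybe (delay i k)

  -- One more than the processing time, and 0 for ∞; hence the many `∸ 1` below.
  proc : Side → Job → ℕ
  proc server j = suc (ps j)
  proc cloud  j = encodeMaybe (pc j)

  record St : Set where
    constructor mkSt
    field
      cell   : Job → Cell
      F cost : ℕ
  open St public

  row : Job → ⟦ RowTy ⟧
  row j = ps j , encodeMaybe (pc j) , tabulate (dl j)

  encEntry : St → Job → ⟦ EntryTy ⟧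
  encEntry x k = toℕ k , row k , encCell (cell x k)

  enc : St → ⟦ StateTy ⟧
  enc x = tabulate (encEntry x) , F x , cost x

  startTime completion : St → Side → Job → ℕ
  startTime  x z j = max (onServer z (F x) 0) (arrival (cell x j) z ∸ 1)
  completion x z j = startTime x z j + (proc z j ∸ 1)

  extra : Side → Job → ℕ
  extra z j = onServer z 0 (proc z j ∸ 1)

  assignCell : ℕ → St → Side → Job → Job → Cell
  assignCell L x z j k with k Finₚ.≟ j
  ... | yes _ = mkCell 0 0 0 z (completion x z j)
  ... | no  _ = push L z (completion x z j) (dl j k) (cell x k)

  assign : ℕ → St → Side → Job → St
  assign L x z j = mkSt (assignCell L x z j) (onServer z (completion x z j) (F x)) (cost x + extra z j)

  assign-same : ∀ L x z j → cell (assign L x z j) j ≡ mkCell 0 0 0 z (completion x z j)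
  assign-same L x z j with j Finₚ.≟ j
  ... | yes _ = refl
  ... | no  j≢j = contradiction refl j≢j

  assign-other : ∀ L x z {j k} → k ≢ j →
    cell (assign L x z j) k ≡ push L z (completion x z j) (dl j k) (cell x k)
  assign-other L x z {j} {k} k≢j with k Finₚ.≟ j
  ... | yes eq = contradiction eq k≢j
  ... | no  _ = refl

  updateᶜ-enc : ∀ L x z j k es →
    fun updateᶜ ((L , encEntry x j , encodeSide z , completion x z j , es) , encEntry x k)
      ≡ encEntry (assign L x z j) k
  updateᶜ-enc L x z j k es with k Finₚ.≟ j
  ... | yes refl rewrite dist-refl {toℕ k} refl = refl
  ... | no  k≢j with dist (toℕ k) (toℕ j) in eq
  ...   | zero  = contradiction (Finₚ.toℕ-injective (dist≡0⇒≡ (toℕ k) (toℕ j) eq)) k≢j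
  ...   | suc _ rewrite nth-tabulate (dl j) k = cong (λ c → toℕ k , row k , c) (pushᶜ-push L z _ (dl j k) (cell x k))

  assignᶜ-enc : ∀ L x z j →
    fun assignᶜ (L , encEntry x j , encodeSide z , completion x z j , tabulate (encEntry x))
      ≡ tabulate (encEntry (assign L x z j))
  assignᶜ-enc L x z j = foldr-tabulate (encEntry x) _
    λ k b → cong (_∷ b) (updateᶜ-enc L x z j k (tabulate (encEntry x)))

  record Allowed (L b : ℕ) (x : St) (z : Side) (j : Job) : Set where
    constructor mkAllowed
    field
      ready      : pend (cell x j) ≡ 1
      reachable  : 1 ≤ arrival (cell x j) z
      executable : 1 ≤ proc z j
      short      : proc z j ∸ 1 ≤ L
      affordable : cost x + extra z j ≤ b

  tryArg : ℕ → ℕ → St → Side → Job → List ⟦ StateTy ⟧ → ⟦ TryTy ⟧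
  tryArg L b x z j out =
    ((L , b) , enc x) , (encodeSide z , arrival (cell x j) z , proc z j) , encEntry x j , out

  violation : ℕ → ℕ → St → Side → Job → ℕ
  violation L b x z j = dist (pend (cell x j)) 1 + (1 ∸ arrival (cell x j) z) + (1 ∸ proc z j)
    + (proc z j ∸ 1 ∸ L) + (cost x + extra z j ∸ b)

  violation≡0⇒ : ∀ {L b x z j} → violation L b x z j ≡ 0 → Allowed L b x z j
  violation≡0⇒ {L} {b} {x} {z} {j} v =
    let v₁ , v₂ , v₃ , v₄ , v₅ = terms≡0 (dist (pend (cell x j)) 1) v in
    mkAllowed (dist≡0⇒≡ _ 1 v₁) (m∸n≡0⇒m≤n v₂) (m∸n≡0⇒m≤n v₃) (m∸n≡0⇒m≤n v₄) (m∸n≡0⇒m≤n v₅)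

  violation≡0⇐ : ∀ {L b x z j} → Allowed L b x z j → violation L b x z j ≡ 0
  violation≡0⇐ (mkAllowed r a e s c) =
    cong₂ _+_ (cong₂ _+_ (cong₂ _+_ (cong₂ _+_ (dist-refl r) (m≤n⇒m∸n≡0 a)) (m≤n⇒m∸n≡0 e)) (m≤n⇒m∸n≡0 s)) (m≤n⇒m∸n≡0 c)

  tryᶜ-enc : ∀ L b x z j out →
    fun tryᶜ (tryArg L b x z j out) ≡ if0 (violation L b x z j) (enc (assign L x z j) ∷ out) out
  tryᶜ-enc L b x server j out rewrite assignᶜ-enc L x server j = refl
  tryᶜ-enc L b x cloud  j out rewrite assignᶜ-enc L x cloud j  = refl

  ∈-if0⁻ : ∀ v {y w : Y} {out} → y ∈ if0 v (w ∷ out) out → y ∈ out ⊎ (v ≡ 0 × y ≡ w)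
  ∈-if0⁻ zero    (here eq) = inj₂ (refl , eq)
  ∈-if0⁻ zero    (there m) = inj₁ m
  ∈-if0⁻ (suc v) m         = inj₁ m

  ∈-if0⁺ : ∀ v {y w : Y} {out} → y ∈ out → y ∈ if0 v (w ∷ out) out
  ∈-if0⁺ zero    m = there m
  ∈-if0⁺ (suc v) m = m

  record Successor (L b : ℕ) (x : St) (s : ⟦ StateTy ⟧) : Set where
    constructor mkSuccessor
    field
      z       : Side
      j       : Job
      allowed : Allowed L b x z j
      is      : s ≡ enc (assign L x z j)

  expandBody : ℕ → ℕ → St → Job → List ⟦ StateTy ⟧ → List ⟦ StateTy ⟧
  expandBody L b x j out =
    fun tryᶜ (tryArg L b x cloud j (fun tryᶜ (tryArg L b x server j out)))

  ∈-try⁻ : ∀ L b x z j {out s} → s ∈ fun tryᶜ (tryArg L b x z j out) → s ∈ out ⊎ Successor L b x s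
  ∈-try⁻ L b x z j {out} m rewrite tryᶜ-enc L b x z j out with ∈-if0⁻ (violation L b x z j) m
  ... | inj₁ m′        = inj₁ m′
  ... | inj₂ (v , eq)  = inj₂ (mkSuccessor z j (violation≡0⇒ v) eq)

  ∈-try⁺ : ∀ L b x z j {out s} → s ∈ out → s ∈ fun tryᶜ (tryArg L b x z j out)
  ∈-try⁺ L b x z j {out} m rewrite tryᶜ-enc L b x z j out = ∈-if0⁺ (violation L b x z j) m

  ∈-try-new : ∀ {L b x z j} out → Allowed L b x z j →
    enc (assign L x z j) ∈ fun tryᶜ (tryArg L b x z j out)
  ∈-try-new {L} {b} {x} {z} {j} out al rewrite tryᶜ-enc L b x z j out | violation≡0⇐ al = here refl

  ∈-expand⁻ : ∀ L b x {out s} → s ∈ fun expandᶜ (((L , b) , enc x) , out) → s ∈ out ⊎ Successor L b x s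
  ∈-expand⁻ L b x {out} {s} m
    with ∈-foldr⁻ {R = λ _ s → Successor L b x s} (tabulate (encEntry x)) body m
    where
    body : ∀ {e} out′ → e ∈ tabulate (encEntry x) → _ → s ∈ out′ ⊎ Successor L b x s
    body out′ i m with ∈ₚ.∈-tabulate⁻ i
    ... | j , refl with ∈-try⁻ L b x cloud j m
    ...   | inj₂ r  = inj₂ r
    ...   | inj₁ m′ = ∈-try⁻ L b x server j m′
  ... | inj₁ m′          = inj₁ m′
  ... | inj₂ (_ , _ , r) = inj₂ r

  ∈-expand⁺ : ∀ L b x {out s} → s ∈ out → s ∈ fun expandᶜ (((L , b) , enc x) , out)
  ∈-expand⁺ L b x m = ∈-foldr-tabulate-mono (encEntry x)
    (λ j out′ m → ∈-try⁺ L b x cloud j (∈-try⁺ L b x server j m)) m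

  ∈-expand-new : ∀ {L b x z j} out → Allowed L b x z j →
    enc (assign L x z j) ∈ fun expandᶜ (((L , b) , enc x) , out)
  ∈-expand-new {L} {b} {x} {z} {j} out al = ∈-foldr-tabulate⁺ (encEntry x) j
    (λ j out′ m → ∈-try⁺ L b x cloud j (∈-try⁺ L b x server j m)) (new z al)
    where
    new : ∀ z → Allowed L b x z j → ∀ out′ → enc (assign L x z j) ∈ expandBody L b x j out′
    new server al out′ = ∈-try⁺ L b x cloud j (∈-try-new out′ al)
    new cloud  al out′ = ∈-try-new _ al

  Rep : ⟦ StateTy ⟧ → Set
  Rep s = Σ[ x ∈ St ] s ≡ enc x

  ∈-successors⁻ : ∀ {Q : St → Set} {L b u xs s} → (∀ {r} → r ∈ xs → Σ[ x ∈ St ] r ≡ enc x × Q x) →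
    s ∈ fun successorsᶜ ((L , b) , u , xs) → ∃[ x ] Q x × Successor L b x s
  ∈-successors⁻ {Q} {L} {b} {u} {xs} {s} rep m
    with ∈-foldr⁻ {R = λ r s → ∃[ x ] Q x × Successor L b x s} xs body m
    where
    body : ∀ {r} out′ → r ∈ xs → s ∈ fun expandᶜ (((L , b) , r) , out′) →
      s ∈ out′ ⊎ (∃[ x ] Q x × Successor L b x s)
    body out′ i m with rep i
    ... | x , refl , q with ∈-expand⁻ L b x m
    ...   | inj₁ m′ = inj₁ m′
    ...   | inj₂ r  = inj₂ (x , q , r)
  ... | inj₂ (_ , _ , r) = r

  ∈-successors⁺ : ∀ {L b u xs x z j} → (∀ {r} → r ∈ xs → Rep r) → enc x ∈ xs → Allowed L b x z j →
    enc (assign L x z j) ∈ fun successorsᶜ ((L , b) , u , xs)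
  ∈-successors⁺ {L} {b} {u} {xs} rep i al = go xs rep i
    where
    go : ∀ xs → (∀ {r} → r ∈ xs → Rep r) → _ ∈ xs → _ ∈ fun successorsᶜ ((L , b) , u , xs)
    go (_ ∷ xs) rep (here refl) = ∈-expand-new _ al
    go (r ∷ xs) rep (there i) with rep (here refl)
    ... | y , refl = ∈-expand⁺ L b y (go xs (rep ∘ there) i)

-- Trimming, the initial state, and the selection of the output

∈-foldr⁺ : {f : X → List Y → List Y} {y : Y} (xs : List X) {b₀ : List Y} {a : X} →
  (∀ {a} b → a ∈ xs → y ∈ b → y ∈ f a b) → a ∈ xs → (∀ b → y ∈ f a b) → y ∈ foldr f b₀ xs
∈-foldr⁺ (x ∷ xs) mono (here refl) h = h _
∈-foldr⁺ (x ∷ xs) mono (there i)   h = mono _ (here refl) (∈-foldr⁺ xs (λ b j → mono b (there j)) i h)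

foldr-∷-∈⁻ : {y : X} (xs : List X) {ys : List X} → y ∈ foldr _∷_ ys xs → y ∈ ys ⊎ y ∈ xs
foldr-∷-∈⁻ []       m           = inj₁ m
foldr-∷-∈⁻ (x ∷ xs) (here refl) = inj₂ (here refl)
foldr-∷-∈⁻ (x ∷ xs) (there m) with foldr-∷-∈⁻ xs m
... | inj₁ m′ = inj₁ m′
... | inj₂ m′ = inj₂ (there m′)

foldr-∷-∈⁺ˡ : {y : X} (xs : List X) {ys : List X} → y ∈ ys → y ∈ foldr _∷_ ys xs
foldr-∷-∈⁺ˡ []       m = m
foldr-∷-∈⁺ˡ (x ∷ xs) m = there (foldr-∷-∈⁺ˡ xs m)

foldr-∷-∈⁺ʳ : {y : X} (xs : List X) {ys : List X} → y ∈ xs → y ∈ foldr _∷_ ys xs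
foldr-∷-∈⁺ʳ (x ∷ xs) (here refl) = here refl
foldr-∷-∈⁺ʳ (x ∷ xs) (there m)   = there (foldr-∷-∈⁺ʳ xs m)

foldr-count : (c : ℕ) (xs : List X) → foldr (λ _ b → c + b) 0 xs ≡ length xs * c
foldr-count c []       = refl
foldr-count c (x ∷ xs) = cong (c +_) (foldr-count c xs)

foldr-length : (xs : List X) → foldr (λ _ b → b + 1) 0 xs ≡ length xs
foldr-length []       = refl
foldr-length (x ∷ xs) = trans (+-comm _ 1) (cong suc (foldr-length xs))

-- `foldr` treats the last row first, so the counter starts above all indices and counts down.
foldr-index : ∀ {n} (E : ℕ → X → Y) (f : Fin n → X) c →
  foldr (λ a (p : ℕ × List Y) → (proj₁ p ∸ 1) , E (proj₁ p ∸ 1) a ∷ proj₂ p) (n + c , []) (tabulate f)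
    ≡ (c , tabulate (λ k → E (toℕ k + c) (f k)))
foldr-index {n = zero}  E f c = refl
foldr-index {n = suc n} E f c
  rewrite sym (+-suc n c) | foldr-index E (f ∘ suc) (suc c) =
  cong (λ l → c , E c (f zero) ∷ l) (Listₚ.tabulate-cong λ k → cong (λ i → E i (f (suc k))) (+-suc (toℕ k) c))

ind : ℕ → ℕ
ind d = if0 d 0 1

cellKey : ℕ → Cell → ℕ × ℕ × ℕ
cellKey u c = 1 ∸ pend c , ceil u (as c) , ceil u (ac c)

cellDiff : ℕ → Cell → Cell → ℕ
cellDiff u c e = dist (1 ∸ pend c) (1 ∸ pend e) + dist (ceil u (as c)) (ceil u (as e))
  + dist (ceil u (ac c)) (ceil u (ac e))

cellDiff≡0⇒ : ∀ u c e → cellDiff u c e ≡ 0 → cellKey u c ≡ cellKey u e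
cellDiff≡0⇒ u c e eq = cong₂ _,_ (dist≡0⇒≡ _ _ (m+n≡0⇒m≡0 _ eq′))
  (cong₂ _,_ (dist≡0⇒≡ _ _ (m+n≡0⇒n≡0 (dist (1 ∸ pend c) (1 ∸ pend e)) eq′))
             (dist≡0⇒≡ _ _ (m+n≡0⇒n≡0 (dist (1 ∸ pend c) (1 ∸ pend e) + _) eq)))
  where eq′ = m+n≡0⇒m≡0 (dist (1 ∸ pend c) (1 ∸ pend e) + dist (ceil u (as c)) (ceil u (as e))) eq

cellDiff≡0⇐ : ∀ u c e → cellKey u c ≡ cellKey u e → cellDiff u c e ≡ 0
cellDiff≡0⇐ u c e eq = cong₂ _+_ (cong₂ _+_ (dist-refl (cong proj₁ eq))
  (dist-refl (cong (proj₁ ∘ proj₂) eq))) (dist-refl (cong (proj₂ ∘ proj₂) eq))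

costOf freeOf : ⟦ StateTy ⟧ → ℕ
costOf s = proj₂ (proj₂ s)
freeOf s = proj₁ (proj₂ s)

best-spec : ∀ s ss → (fun bestᶜ (s , ss) ∈ s ∷ ss) × (∀ {r} → r ∈ s ∷ ss → freeOf (fun bestᶜ (s , ss)) ≤ freeOf r)
best-spec s []       = here refl , λ { (here refl) → ≤-refl }
best-spec s (r ∷ rs) with best-spec s rs
... | i , h with freeOf r ∸ freeOf (fun bestᶜ (s , rs)) in eq
...   | zero  = there (here refl) , λ where
        (here refl)         → ≤-trans r≤ (h (here refl))
        (there (here refl)) → ≤-refl
        (there (there m))   → ≤-trans r≤ (h (there m))
  where r≤ = m∸n≡0⇒m≤n {freeOf r} eq
...   | suc _ = skip i , λ where
        (here refl)         → h (here refl)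
        (there (here refl)) → <⇒≤ (m∸n≢0⇒n<m {freeOf r} λ eq′ → 1+n≢0 (trans (sym eq) eq′))
        (there (there m))   → h (there m)
  where
  skip : ∀ {t} → t ∈ s ∷ rs → t ∈ s ∷ r ∷ rs
  skip (here eq) = here eq
  skip (there m) = there (there m)

∈-finals⁻ : ∀ (I : ⟦ Input ⟧) {s} → s ∈ fun finalsᶜ I →
  ∃[ L ] L ∈ fun guessesᶜ (proj₁ I) × s ∈ fun runᶜ (fun runArgᶜ (I , L))
∈-finals⁻ I {s} m with ∈-foldr⁻ {R = λ L s → s ∈ fun runᶜ (fun runArgᶜ (I , L))} (fun guessesᶜ (proj₁ I))
  (λ {L} b _ → foldr-∷-∈⁻ (fun runᶜ (fun runArgᶜ (I , L)))) m
... | inj₂ r = r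

∈-finals⁺ : ∀ (I : ⟦ Input ⟧) {s L} → L ∈ fun guessesᶜ (proj₁ I) → s ∈ fun runᶜ (fun runArgᶜ (I , L)) →
  s ∈ fun finalsᶜ I
∈-finals⁺ I i m = ∈-foldr⁺ (fun guessesᶜ (proj₁ I))
  (λ {L} b _ → foldr-∷-∈⁺ˡ (fun runᶜ (fun runArgᶜ (I , L)))) i (λ b → foldr-∷-∈⁺ʳ _ m)

precision-eq : ∀ g b p q → fun precisionᶜ (g , b , p , q) ≡ length g * suc (quotient q p)
precision-eq g b p q = foldr-count (suc (quotient q p)) g

-- Equivalence of states after rounding, and pruning

module Trimming (G : Instance) (u : ℕ) where
  open Instance G
  open Semantics G

  SameKey : St → St → Set
  SameKey x y = (∀ k → cellKey u (cell x k) ≡ cellKey u (cell y k)) × ceil u (F x) ≡ ceil u (F y)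

  diff-eq : ∀ x y → fun diffᶜ (u , enc x , enc y)
    ≡ sum (λ k → cellDiff u (cell x k) (cell y k)) + dist (ceil u (F x)) (ceil u (F y))
  diff-eq x y = foldr-sum (encEntry x) _ λ k b →
    trans (cong (λ l → caseL l b (λ e _ → b + fun cellDiffᶜ (u , encCell (cell x k) , proj₂ (proj₂ e))))
                (proj₂ (drop-tabulate (encEntry y) k)))
          (+-comm b _)

  _~_ : ⟦ StateTy ⟧ → ⟦ StateTy ⟧ → Set
  s ~ t = fun diffᶜ (u , s , t) ≡ 0

  ~⇒SameKey : ∀ x y → enc x ~ enc y → SameKey x y
  ~⇒SameKey x y eq = (λ k → cellDiff≡0⇒ u (cell x k) (cell y k)
    (n≤0⇒n≡0 (≤-trans (term≤sum (λ k → cellDiff u (cell x k) (cell y k)) k) (≤-reflexive (m+n≡0⇒m≡0 _ eq′)))))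
    , dist≡0⇒≡ _ _ (m+n≡0⇒n≡0 (sum (λ k → cellDiff u (cell x k) (cell y k))) eq′)
    where eq′ = trans (sym (diff-eq x y)) eq

  SameKey⇒~ : ∀ x y → SameKey x y → enc x ~ enc y
  SameKey⇒~ x y (h , f) = trans (diff-eq x y) (cong₂ _+_
    (sum≡0 _ λ k → cellDiff≡0⇐ u (cell x k) (cell y k) (h k)) (dist-refl f))

  ~-refl : ∀ {s} → Rep s → s ~ s
  ~-refl (x , refl) = SameKey⇒~ x x ((λ _ → refl) , refl)

  ~-sym : ∀ {s t} → Rep s → Rep t → s ~ t → t ~ s
  ~-sym (x , refl) (y , refl) e with ~⇒SameKey x y e
  ... | h , f = SameKey⇒~ y x ((λ k → sym (h k)) , sym f)

  -- Restricted to codes of states: `diffᶜ` skips missing entries, so a state without entries could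
  -- link inequivalent ones.
  ~-trans : ∀ {s t r} → Rep s → Rep t → Rep r → s ~ t → t ~ r → s ~ r
  ~-trans (x , refl) (y , refl) (z , refl) e e′ with ~⇒SameKey x y e | ~⇒SameKey y z e′
  ... | h , f | h′ , f′ = SameKey⇒~ x z ((λ k → trans (h k) (h′ k)) , trans f f′)

  Distinct : List ⟦ StateTy ⟧ → Set
  Distinct = AllPairs (λ s t → ¬ s ~ t)

  merged : ⟦ StateTy ⟧ → List ⟦ StateTy ⟧ → ⟦ StateTy ⟧ × List ⟦ StateTy ⟧
  merged s ss = foldr (λ y p → if0 (fun diffᶜ (u , s , y))
    (if0 (costOf (proj₁ p) ∸ costOf y) p (y , proj₂ p)) (proj₁ p , y ∷ proj₂ p)) (s , []) ss

  -- Loop invariant of the insertion. `cover` says that nothing is lost: a state disappears only in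
  -- favour of an equivalent one that costs no more.
  record Merged (s : ⟦ StateTy ⟧) (ss : List ⟦ StateTy ⟧) (p : ⟦ StateTy ⟧ × List ⟦ StateTy ⟧) : Set where
    field
      best∈    : proj₁ p ∈ s ∷ ss
      best~    : s ~ proj₁ p
      best≤    : costOf (proj₁ p) ≤ costOf s
      rest⊆    : ∀ {y} → y ∈ proj₂ p → y ∈ ss
      rest≁    : ∀ {y} → y ∈ proj₂ p → ¬ s ~ y
      cover    : ∀ {y} → y ∈ ss → y ∈ proj₂ p ⊎ (s ~ y × costOf (proj₁ p) ≤ costOf y)
      distinct : Distinct ss → Distinct (proj₂ p)
  open Merged

  skip : ∀ {X : Set} {s y t : X} {ss} → t ∈ s ∷ ss → t ∈ s ∷ y ∷ ss
  skip (here eq) = here eq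
  skip (there m) = there (there m)

  merged-spec : ∀ {s} → Rep s → ∀ ss → Merged s ss (merged s ss)
  merged-spec rep [] = record
    { best∈ = here refl ; best~ = ~-refl rep ; best≤ = ≤-refl ; rest⊆ = λ () ; rest≁ = λ ()
    ; cover = λ () ; distinct = λ _ → [] }
  merged-spec {s} rep (y ∷ ys) with merged s ys | merged-spec rep ys
  ... | best , rest | M with fun diffᶜ (u , s , y) in eq
  ...   | suc _ = record
          { best∈ = skip (best∈ M) ; best~ = best~ M ; best≤ = best≤ M
          ; rest⊆ = λ { (here e) → here e ; (there m) → there (rest⊆ M m) }
          ; rest≁ = λ { (here refl) e → 1+n≢0 (trans (sym eq) e) ; (there m) → rest≁ M m }
          ; cover = λ { (here e) → inj₁ (here e) ; (there m) → grow (cover M m) }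
          ; distinct = λ { (a ∷ d) → All.tabulate (λ m → All.lookup a (rest⊆ M m)) ∷ distinct M d } }
    where
    grow : ∀ {t} → _ ⊎ _ → t ∈ y ∷ rest ⊎ (s ~ t × costOf best ≤ costOf t)
    grow (inj₁ m) = inj₁ (there m)
    grow (inj₂ e) = inj₂ e
  ...   | zero with costOf best ∸ costOf y in eq′
  ...     | zero = record
            { best∈ = skip (best∈ M) ; best~ = best~ M ; best≤ = best≤ M
            ; rest⊆ = λ m → there (rest⊆ M m) ; rest≁ = rest≁ M
            ; cover = λ { (here refl) → inj₂ (eq , m∸n≡0⇒m≤n {costOf best} eq′) ; (there m) → cover M m }
            ; distinct = λ { (_ ∷ d) → distinct M d } }
  ...     | suc _ = record
            { best∈ = there (here refl) ; best~ = eq ; best≤ = ≤-trans y≤ (best≤ M)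
            ; rest⊆ = λ m → there (rest⊆ M m) ; rest≁ = rest≁ M
            ; cover = λ { (here refl) → inj₂ (eq , ≤-refl) ; (there m) → grow (cover M m) }
            ; distinct = λ { (_ ∷ d) → distinct M d } }
    where
    y≤ : costOf y ≤ costOf best
    y≤ = <⇒≤ (m∸n≢0⇒n<m {costOf best} λ e → 1+n≢0 (trans (sym eq′) e))
    grow : ∀ {t} → _ ⊎ _ → t ∈ rest ⊎ (s ~ t × costOf y ≤ costOf t)
    grow (inj₁ m)       = inj₁ m
    grow (inj₂ (e , c)) = inj₂ (e , ≤-trans y≤ c)

  AllRep : List ⟦ StateTy ⟧ → Set
  AllRep ss = ∀ {s} → s ∈ ss → Rep s

  Covered : ⟦ StateTy ⟧ → List ⟦ StateTy ⟧ → Set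
  Covered s ss = ∃[ y ] y ∈ ss × s ~ y × costOf y ≤ costOf s

  insert-⊆ : ∀ {s ss} → Rep s → ∀ {t} → t ∈ fun insertᶜ (u , s , ss) → t ∈ s ∷ ss
  insert-⊆ {s} {ss} rep (here refl) = best∈ (merged-spec rep ss)
  insert-⊆ {s} {ss} rep (there m)   = there (rest⊆ (merged-spec rep ss) m)

  insert-cover : ∀ {s ss} → AllRep (s ∷ ss) → ∀ {t} → t ∈ s ∷ ss → Covered t (fun insertᶜ (u , s , ss))
  insert-cover {s} {ss} rep (here refl) =
    let M = merged-spec (rep (here refl)) ss in _ , here refl , best~ M , best≤ M
  insert-cover {s} {ss} rep (there m) with merged-spec (rep (here refl)) ss
  ... | M with cover M m
  ...   | inj₁ m′      = _ , there m′ , ~-refl (rep (there m)) , ≤-refl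
  ...   | inj₂ (e , c) = _ , here refl ,
          ~-trans (rep (there m)) (rep (here refl)) (rep (best∈ M))
            (~-sym (rep (here refl)) (rep (there m)) e) (best~ M) , c

  insert-distinct : ∀ {s ss} → AllRep (s ∷ ss) → Distinct ss → Distinct (fun insertᶜ (u , s , ss))
  insert-distinct {s} {ss} rep d with merged-spec (rep (here refl)) ss
  ... | M = All.tabulate (λ m e → rest≁ M m
      (~-trans (rep (here refl)) (rep (best∈ M)) (rep (there (rest⊆ M m))) (best~ M) e)) ∷ distinct M d

  trim-⊆ : ∀ {ss} → AllRep ss → ∀ {t} → t ∈ fun trimᶜ (u , ss) → t ∈ ss
  trim-⊆ {s ∷ ss} rep m with insert-⊆ (rep (here refl)) m
  ... | here e   = here e
  ... | there m′ = there (trim-⊆ (rep ∘ there) m′)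

  insertRep : ∀ {s ss} → AllRep (s ∷ ss) → AllRep (s ∷ fun trimᶜ (u , ss))
  insertRep rep (here e)  = rep (here e)
  insertRep rep (there m) = rep (there (trim-⊆ (rep ∘ there) m))

  -- A representative may itself be displaced by a later insertion, but being equivalent and no more
  -- expensive is transitive.
  trim-cover : ∀ {ss} → AllRep ss → ∀ {t} → t ∈ ss → Covered t (fun trimᶜ (u , ss))
  trim-cover {s ∷ ss} rep (here refl) = insert-cover (insertRep rep) (here refl)
  trim-cover {s ∷ ss} rep (there m) with trim-cover (rep ∘ there) m
  ... | y , i , e , c with insert-cover (insertRep rep) (there i)
  ...   | z , i′ , e′ , c′ = z , i′ ,
          ~-trans (rep (there m)) (insertRep rep (there i)) (insertRep rep (insert-⊆ (rep (here refl)) i′)) e e′ ,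
          ≤-trans c′ c

  trim-distinct : ∀ {ss} → AllRep ss → Distinct (fun trimᶜ (u , ss))
  trim-distinct {[]}     rep = []
  trim-distinct {s ∷ ss} rep = insert-distinct (insertRep rep) (trim-distinct (rep ∘ there))

-- The initial state and the list of guesses

module Preparation (G : Instance) where
  open Instance G
  open Semantics G

  graph : ⟦ GraphTy ⟧
  graph = encodeInstance G

  initial : St
  -- Arrival 1 codes the start time 0. The `+ 0` is the initial accumulator of the indegree fold.
  initial = mkSt (λ k → mkCell (suc (sum (λ i → ind (dl i k)) + 0)) 1 1 server 0) 0 0

  length-graph : length graph ≡ n
  length-graph = Listₚ.length-tabulate row

  indegree-eq : ∀ k → fun indegreeᶜ (graph , toℕ k) ≡ sum (λ i → ind (dl i k)) + 0
  indegree-eq k = foldr-sum row _ (λ i b → cong (λ d → ind d + b) (nth-tabulate (dl i) k))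

  init-eq : fun initᶜ graph ≡ enc initial
  init-eq = cong (λ p → proj₂ p , 0 , 0) (begin
    fun entriesᶜ graph
      ≡⟨ cong (λ c → foldr body (c , []) graph) (trans (trans (foldr-length graph) length-graph) (sym (+-identityʳ n))) ⟩
    foldr body (n + 0 , []) graph
      ≡⟨ foldr-index E row 0 ⟩
    0 , tabulate (λ k → E (toℕ k + 0) (row k))
      ≡⟨ cong (0 ,_) (Listₚ.tabulate-cong λ k → trans (cong (λ i → E i (row k)) (+-identityʳ (toℕ k)))
           (cong (λ q → toℕ k , row k , (suc q , 1 , 1) , 0 , 0) (indegree-eq k))) ⟩
    0 , tabulate (encEntry initial) ∎)
    where
    open ≡-Reasoning
    E : ℕ → ⟦ RowTy ⟧ → ⟦ EntryTy ⟧
    E i r = i , r , (suc (fun indegreeᶜ (graph , i)) , 1 , 1) , 0 , 0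
    body : ⟦ RowTy ⟧ → ℕ × List ⟦ EntryTy ⟧ → ℕ × List ⟦ EntryTy ⟧
    body r p = (proj₁ p ∸ 1) , E (proj₁ p ∸ 1) r ∷ proj₂ p

  guesses : List ℕ
  guesses = fun guessesᶜ graph

  foldr-grow : (f : X → Y) (xs : List X) {ys : List Y} {y : Y} → y ∈ ys → y ∈ foldr (λ a b → f a ∷ b) ys xs
  foldr-grow f []       m = m
  foldr-grow f (x ∷ xs) m = there (foldr-grow f xs m)

  ∈-guesses : ∀ {v} j → (∀ b → v ∈ ps j ∷ (encodeMaybe (pc j) ∸ 1) ∷ foldr (λ d b → d ∸ 1 ∷ b) b (tabulate (dl j))) →
    v ∈ guesses
  ∈-guesses j h = ∈-foldr-tabulate⁺ row j (λ k b m → there (there (foldr-grow (_∸ 1) (tabulate (dl k)) m))) h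

  ps∈guesses : ∀ j → ps j ∈ guesses
  ps∈guesses j = ∈-guesses j λ b → here refl

  pc∈guesses : ∀ j → encodeMaybe (pc j) ∸ 1 ∈ guesses
  pc∈guesses j = ∈-guesses j λ b → there (here refl)

  delay∈guesses : ∀ i j → dl i j ∸ 1 ∈ guesses
  delay∈guesses i j = ∈-guesses i λ b → there (there
    (∈-foldr-tabulate⁺ (dl i) j (λ _ _ → there) (λ _ → here refl)))

  length-guesses : length guesses ≡ n * (2 + n)
  length-guesses = go row (λ j b → cong (2 +_) (inner (dl j) b))
    where
    inner : ∀ {m} (f : Fin m → ℕ) b → length (foldr (λ d b → d ∸ 1 ∷ b) b (tabulate f)) ≡ m + length b
    inner {zero}  f b = refl
    inner {suc m} f b = cong suc (inner (f ∘ suc) b)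
    go : ∀ {m} (r : Fin m → X) {f : X → List Y → List Y} → (∀ j b → length (f (r j) b) ≡ 2 + n + length b) →
      length (foldr f [] (tabulate r)) ≡ m * (2 + n)
    go {m = zero}  r h = refl
    go {m = suc m} r h = trans (h zero _) (cong (2 + n +_) (go (r ∘ suc) (h ∘ suc)))

  schedule-eq : ∀ x → fun scheduleᶜ (enc x) ≡ tabulate (λ k → encodeSide (sd (cell x k)) , C (cell x k))
  schedule-eq x = foldr-tabulate (encEntry x) _ (λ _ _ → refl)

-- Invariants of the reachable states

delayed : Side → Side → ℕ → ℕ → ℕ
delayed server server d t = t
delayed server cloud  d t = t + d
delayed cloud  server d t = t + d
delayed cloud  cloud  d t = t

merge-≢0 : ∀ a v → merge a v ≢ 0 → a ≢ 0 × v ≢ 0 × merge a v ≡ max a v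
merge-≢0 zero    v       h = contradiction refl h
merge-≢0 (suc a) zero    h = contradiction refl h
merge-≢0 (suc a) (suc v) h = 1+n≢0 , 1+n≢0 , refl

merge-nonzero : ∀ {a v} → a ≢ 0 → v ≢ 0 → merge a v ≡ max a v
merge-nonzero {zero}  a≢0 v≢0 = contradiction refl a≢0
merge-nonzero {suc a} {zero}  a≢0 v≢0 = contradiction refl v≢0
merge-nonzero {suc a} {suc v} a≢0 v≢0 = refl

merge-≤ : ∀ {a v k} → a ≤ k → v ≤ k → merge a v ≤ k
merge-≤ {zero}          a≤k v≤k = z≤n
merge-≤ {suc a} {zero}  a≤k v≤k = z≤n
merge-≤ {suc a} {suc v} a≤k v≤k = max-lub a≤k v≤k

other-≢0 : ∀ L t d → other L t d ≢ 0 → other L t d ≡ suc (t + d)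
other-≢0 L t d h with d ∸ L
... | zero  = +-suc t d
... | suc _ = contradiction refl h

other-≤ : ∀ L t d → other L t d ≤ suc (t + L)
other-≤ L t d with d ∸ L in eq
... | zero  = ≤-trans (≤-reflexive (+-suc t d)) (s≤s (+-monoʳ-≤ t (m∸n≡0⇒m≤n eq)))
... | suc _ = z≤n

other-short : ∀ L t {d} → d ≤ L → other L t d ≡ suc (t + d)
other-short L t {d} d≤L rewrite m≤n⇒m∸n≡0 d≤L = +-suc t d

reach-≢0 : ∀ L t d z z′ → reach L t d z z′ ≢ 0 → reach L t d z z′ ≡ suc (delayed z z′ d t)
reach-≢0 L t d server server h = refl
reach-≢0 L t d server cloud  h = other-≢0 L t d h
reach-≢0 L t d cloud  server h = other-≢0 L t d h
reach-≢0 L t d cloud  cloud  h = refl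

-- Crossing delays above the guess exclude a side instead of postponing it, so no push can carry an
-- arrival beyond the completion time plus `L`.
reach-≤ : ∀ L t d z z′ → reach L t d z z′ ≤ suc (t + L)
reach-≤ L t d server server = s≤s (m≤m+n t L)
reach-≤ L t d server cloud  = other-≤ L t d
reach-≤ L t d cloud  server = other-≤ L t d
reach-≤ L t d cloud  cloud  = s≤s (m≤m+n t L)

push-assigned : ∀ L z t d c → pend c ≡ 0 → push L z t d c ≡ c
push-assigned L z t zero    c                        refl = refl
push-assigned L z t (suc d) (mkCell zero _ _ _ _) refl = refl

arrival-push : ∀ L z t d c z′ → pend c ≢ 0 →
  arrival (push L z t (suc d) c) z′ ≡ merge (arrival c z′) (reach L t d z z′)
arrival-push L z t d (mkCell zero    _ _ _ _) z′     h = contradiction refl h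
arrival-push L z t d (mkCell (suc _) _ _ _ _) server h = refl
arrival-push L z t d (mkCell (suc _) _ _ _ _) cloud  h = refl

pend-push : ∀ L z t d c → pend (push L z t (suc d) c) ≡ pend c ∸ 1
pend-push L z t d (mkCell zero    _ _ _ _) = refl
pend-push L z t d (mkCell (suc _) _ _ _ _) = refl

ind≡0 : ∀ d → ind d ≡ 0 → d ≡ 0
ind≡0 zero _ = refl

ind-≢0 : ∀ {d} → d ≢ 0 → ind d ≡ 1
ind-≢0 {zero}  h = contradiction refl h
ind-≢0 {suc d} h = refl

≢0⇒suc : ∀ {m} → m ≢ 0 → ∃[ q ] m ≡ suc q
≢0⇒suc {zero}  h = contradiction refl h
≢0⇒suc {suc q} h = q , refl

module Invariants (G : Instance) (L b : ℕ) where
  open Instance G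
  open Semantics G
  open Preparation G

  P : St → Job → ℕ
  P x k = pend (cell x k)

  openPreds : St → Job → ℕ
  openPreds x k = sum (λ i → ind (P x i) * ind (dl i k))

  cloudPart : St → Job → ℕ
  cloudPart x k = if0 (P x k) (extra (sd (cell x k)) k) 0

  assigned : St → ℕ
  assigned x = sum (λ k → 1 ∸ P x k)

  -- `excl`, `free`, `prec`, `finite`, `costEq` and `afford` make a complete state a feasible
  -- schedule, with `arr` preparing `prec` for jobs still to come. `closed`, `zeroed`, `fresh`,
  -- `early` and `Fearly` bound the number of keys. `count` links `pend` to the graph.
  record Inv (x : St) : Set where
    field
      closed : ∀ {i k} → P x k ≡ 0 → dl i k ≢ 0 → P x i ≡ 0
      count  : ∀ {k} → P x k ≢ 0 → P x k ≡ suc (openPreds x k)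
      zeroed : ∀ {k} → P x k ≡ 0 → ∀ z → arrival (cell x k) z ≡ 0
      excl   : ∀ {i k} → i ≢ k → P x i ≡ 0 → P x k ≡ 0 → sd (cell x i) ≡ server → sd (cell x k) ≡ server →
               C (cell x i) + ps k ≤ C (cell x k) ⊎ C (cell x k) + ps i ≤ C (cell x i)
      free   : ∀ {i} → P x i ≡ 0 → sd (cell x i) ≡ server → C (cell x i) ≤ F x
      prec   : ∀ {i k d} → P x k ≡ 0 → dl i k ≡ suc d →
               delayed (sd (cell x i)) (sd (cell x k)) d (C (cell x i)) + (proc (sd (cell x k)) k ∸ 1) ≤ C (cell x k)
      arr    : ∀ {i k d} z → P x i ≡ 0 → P x k ≢ 0 → dl i k ≡ suc d → arrival (cell x k) z ≢ 0 →
               suc (delayed (sd (cell x i)) z d (C (cell x i))) ≤ arrival (cell x k) z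
      finite : ∀ {k} → P x k ≡ 0 → 1 ≤ proc (sd (cell x k)) k
      costEq : cost x ≡ sum (cloudPart x)
      afford : cost x ≤ b
      fresh  : ∀ {k} → P x k ≢ 0 → (∀ i → dl i k ≢ 0 → P x i ≢ 0) → ∀ z → arrival (cell x k) z ≡ 1
      early  : ∀ k z → arrival (cell x k) z ≤ suc (assigned x * (L + L))
      Fearly : F x ≤ assigned x * (L + L)

  initial-Inv : Inv initial
  initial-Inv = record
    { closed = λ ()
    ; count = λ {k} _ → cong suc (trans (+-identityʳ _) (sum-cong-≗ λ i → sym (*-identityˡ (ind (dl i k)))))
    ; zeroed = λ () ; excl = λ _ () ; free = λ () ; prec = λ () ; arr = λ _ () ; finite = λ ()
    ; costEq = sym (sum≡0 (cloudPart initial) λ _ → refl) ; afford = z≤n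
    ; fresh = λ { _ _ server → refl ; _ _ cloud → refl }
    ; early = λ { _ server → s≤s z≤n ; _ cloud → s≤s z≤n } ; Fearly = z≤n }

  module Assign {x : St} (inv : Inv x) {z : Side} {j : Job} (al : Allowed L b x z j) where
    open Inv inv
    open Allowed al

    private
      x′ = assign L x z j
      τ  = completion x z j

    j-open : P x j ≢ 0
    j-open eq = 1+n≢0 (trans (sym ready) eq)

    -- By `ready` and `count` the number of unassigned predecessors is 0, so every term of that sum
    -- vanishes.
    preds-assigned : ∀ {i} → dl i j ≢ 0 → P x i ≡ 0
    preds-assigned {i} h = ind≡0 _ (trans (sym (*-identityʳ (ind (P x i))))
        (trans (cong (ind (P x i) *_) (sym (ind-≢0 h))) zero-term))
      where
      zero-term : ind (P x i) * ind (dl i j) ≡ 0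
      zero-term = n≤0⇒n≡0 (≤-trans (term≤sum (λ i → ind (P x i) * ind (dl i j)) i)
        (≤-reflexive (suc-injective (trans (sym (count j-open)) ready))))

    same? : ∀ k → k ≡ j ⊎ k ≢ j
    same? k with k Finₚ.≟ j
    ... | yes k≡j = inj₁ k≡j
    ... | no  k≢j = inj₂ k≢j

    same : cell x′ j ≡ mkCell 0 0 0 z τ
    same = assign-same L x z j

    P-same : P x′ j ≡ 0
    P-same = cong pend same

    no-edge : ∀ {k} → k ≢ j → dl j k ≡ 0 → cell x′ k ≡ cell x k
    no-edge {k} k≢j e = trans (assign-other L x z k≢j) (cong (λ d → push L z τ d (cell x k)) e)

    edge : ∀ {k d} → k ≢ j → dl j k ≡ suc d → cell x′ k ≡ push L z τ (suc d) (cell x k)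
    edge {k} k≢j e = trans (assign-other L x z k≢j) (cong (λ d → push L z τ d (cell x k)) e)

    kept : ∀ {k} → P x k ≡ 0 → cell x′ k ≡ cell x k
    kept {k} h = trans (assign-other L x z (λ { refl → j-open h })) (push-assigned L z τ (dl j k) (cell x k) h)

    openPreds-≥1 : ∀ {k d} → dl j k ≡ suc d → 1 ≤ openPreds x k
    openPreds-≥1 {k} e = ≤-trans (≤-reflexive (sym (cong₂ (λ p q → ind p * ind q) ready e)))
      (term≤sum (λ i → ind (P x i) * ind (dl i k)) j)

    -- A push lowers `pend` by 1 but never to 0: a successor of `j` still counted `j` as unassigned,
    -- so its `pend` was at least 2.
    P-open : ∀ {k} → k ≢ j → P x k ≢ 0 → P x′ k ≢ 0
    P-open {k} k≢j h with dl j k in e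
    ... | zero  = λ eq → h (trans (sym (cong pend (no-edge k≢j e))) eq)
    ... | suc d = λ eq → 1+n≢0 (sym (≤-antisym z≤n (≤-trans (openPreds-≥1 e) (≤-reflexive
        (trans (sym (cong (_∸ 1) (count h)))
            (trans (sym (trans (cong pend (edge k≢j e)) (pend-push L z τ d (cell x k)))) eq))))))

    split : ∀ k → P x′ k ≡ 0 → k ≡ j ⊎ P x k ≡ 0
    split k h with same? k
    ... | inj₁ k≡j = inj₁ k≡j
    ... | inj₂ k≢j with P x k in e
    ...   | zero  = inj₂ refl
    ...   | suc _ = contradiction h (P-open k≢j (λ eq → 1+n≢0 (trans (sym e) eq)))

    open⇒≢j : ∀ {k} → P x′ k ≢ 0 → k ≢ j
    open⇒≢j h refl = h P-same

    open⇒open : ∀ {k} → P x′ k ≢ 0 → P x k ≢ 0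
    open⇒open h e = h (trans (cong pend (kept e)) e)

    kept′ : ∀ {k} → P x k ≡ 0 → P x′ k ≡ 0
    kept′ e = trans (cong pend (kept e)) e

    ind-same : ∀ k → k ≢ j → ind (P x k) ≡ ind (P x′ k)
    ind-same k k≢j with P x k in e
    ... | zero  = cong ind (sym (kept′ e))
    ... | suc _ = sym (ind-≢0 (P-open k≢j (λ eq → 1+n≢0 (trans (sym e) eq))))

    openPreds-eq : ∀ k → openPreds x k ≡ openPreds x′ k + ind (dl j k)
    openPreds-eq k = trans (sym (+-identityʳ _)) (trans
      (cong (λ q → openPreds x k + q) (sym (cong (λ p → ind p * ind (dl j k)) P-same)))
      (trans (sum-update {g = λ i → ind (P x′ i) * ind (dl i k)} j (λ i i≢j → cong (_* ind (dl i k)) (ind-same i i≢j)))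
             (cong (openPreds x′ k +_) (trans (cong (λ p → ind p * ind (dl j k)) ready) (*-identityˡ _)))))

    assigned-suc : assigned x′ ≡ suc (assigned x)
    assigned-suc = sym (trans (+-comm 1 (assigned x)) (trans
      (cong (assigned x +_) (sym (cong (1 ∸_) P-same)))
      (trans (sum-update {f = λ k → 1 ∸ P x k} {g = λ k → 1 ∸ P x′ k} j agree)
             (trans (cong (λ p → assigned x′ + (1 ∸ p)) ready) (+-identityʳ _)))))
      where
      agree : ∀ k → k ≢ j → 1 ∸ P x k ≡ 1 ∸ P x′ k
      agree k k≢j with P x k in e
      ... | zero  = cong (1 ∸_) (sym (kept′ e))
      ... | suc q with P x′ k in e′
      ...   | zero  = contradiction e′ (P-open k≢j (λ eq → 1+n≢0 (trans (sym e) eq)))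
      ...   | suc q′ = trans (0∸n≡0 q) (sym (0∸n≡0 q′))

    start-≤ : startTime x z j ≤ assigned x * (L + L)
    start-≤ = max-lub (server-≤ z) (≤-trans (∸-monoˡ-≤ 1 (early j z)) ≤-refl)
      where
      server-≤ : ∀ z → onServer z (F x) 0 ≤ assigned x * (L + L)
      server-≤ server = Fearly
      server-≤ cloud  = z≤n

    -- An assignment adds one processing time, and the push that follows at most one crossing delay,
    -- each at most `L`. This is the origin of `L + L`.
    t-≤ : τ + L ≤ assigned x′ * (L + L)
    t-≤ = begin
      startTime x z j + (proc z j ∸ 1) + L ≤⟨ +-monoˡ-≤ L (+-mono-≤ start-≤ short) ⟩
      assigned x * (L + L) + L + L         ≡⟨ +-assoc (assigned x * (L + L)) L L ⟩
      assigned x * (L + L) + (L + L)       ≡⟨ +-comm _ (L + L) ⟩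
      suc (assigned x) * (L + L)           ≡⟨ cong (_* (L + L)) (sym assigned-suc) ⟩
      assigned x′ * (L + L)                ∎
      where open ≤-Reasoning

    assigned-mono : assigned x * (L + L) ≤ assigned x′ * (L + L)
    assigned-mono = *-monoˡ-≤ (L + L) (≤-trans (n≤1+n _) (≤-reflexive (sym assigned-suc)))

    arrival-start : arrival (cell x j) z ∸ 1 ≤ startTime x z j
    arrival-start = n≤max (onServer z (F x) 0) _

    assign-Inv : Inv x′
    assign-Inv = record
      { closed = λ {i} {k} → closed′ {i} {k} ; count = λ {k} → count′ {k} ; zeroed = λ {k} → zeroed′ {k}
      ; excl = excl′ ; free = λ {i} → free′ z refl {i} ; prec = λ {i} {k} → prec′ {i} {k}
      ; arr = λ {i} {k} → arr′ {i} {k} ; finite = λ {k} → finite′ {k}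
      ; costEq = costEq′ ; afford = affordable ; fresh = λ {k} → fresh′ {k}
      ; early = early′ ; Fearly = Fearly′ z refl }
      where
      closed′ : ∀ {i k} → P x′ k ≡ 0 → dl i k ≢ 0 → P x′ i ≡ 0
      closed′ {k = k} h e with split k h
      ... | inj₁ refl = kept′ (preds-assigned e)
      ... | inj₂ h′   = kept′ (closed h′ e)
      count′ : ∀ {k} → P x′ k ≢ 0 → P x′ k ≡ suc (openPreds x′ k)
      count′ {k} h with dl j k in e | openPreds-eq k
      ... | zero  | eq = trans (cong pend (no-edge (open⇒≢j h) e)) (trans (count (open⇒open h))
                           (cong suc (trans eq (+-identityʳ _))))
      ... | suc d | eq = trans (trans (cong pend (edge (open⇒≢j h) e)) (pend-push L z τ d (cell x k)))
                           (trans (cong (_∸ 1) (count (open⇒open h)))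
                             (trans eq (+-comm _ 1)))
      zeroed′ : ∀ {k} → P x′ k ≡ 0 → ∀ z → arrival (cell x′ k) z ≡ 0
      zeroed′ {k} h w with split k h
      ... | inj₂ h′ = trans (cong (λ c → arrival c w) (kept h′)) (zeroed h′ w)
      ... | inj₁ refl with w
      ...   | server = cong as same
      ...   | cloud  = cong ac same
      -- Exclusivity rests on this: `F x` bounds all server completions, and a new server job starts
      -- no earlier than `F x`.
      free-start : ∀ {k} → P x k ≡ 0 → sd (cell x k) ≡ server → z ≡ server → C (cell x k) ≤ startTime x z j
      free-start h s refl = ≤-trans (free h s) (m≤max (F x) _)
      after : ∀ {k} → P x k ≡ 0 → sd (cell x k) ≡ server → z ≡ server → C (cell x k) + ps j ≤ τ
      after h s refl = +-monoˡ-≤ (ps j) (free-start h s refl)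
      excl′ : ∀ {i k} → i ≢ k → P x′ i ≡ 0 → P x′ k ≡ 0 → sd (cell x′ i) ≡ server → sd (cell x′ k) ≡ server →
              C (cell x′ i) + ps k ≤ C (cell x′ k) ⊎ C (cell x′ k) + ps i ≤ C (cell x′ i)
      excl′ {i} {k} i≢k hi hk si sk with split i hi | split k hk
      ... | inj₁ refl | inj₁ refl = contradiction refl i≢k
      ... | inj₁ refl | inj₂ hk′ rewrite same | kept hk′ = inj₂ (after hk′ sk si)
      ... | inj₂ hi′ | inj₁ refl rewrite same | kept hi′ = inj₁ (after hi′ si sk)
      ... | inj₂ hi′ | inj₂ hk′ rewrite kept hi′ | kept hk′ = excl i≢k hi′ hk′ si sk
      free′ : ∀ w → w ≡ z → ∀ {i} → P x′ i ≡ 0 → sd (cell x′ i) ≡ server → C (cell x′ i) ≤ onServer z τ (F x)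
      free′ server refl {i} h s with split i h
      ... | inj₁ refl rewrite same    = ≤-refl
      ... | inj₂ h′   rewrite kept h′ = ≤-trans (free-start h′ s refl) (m≤m+n _ _)
      free′ cloud refl {i} h s with split i h
      ... | inj₁ refl rewrite same with s
      ...   | ()
      free′ cloud refl {i} h s | inj₂ h′ rewrite kept h′ = free h′ s
      prec′ : ∀ {i k d} → P x′ k ≡ 0 → dl i k ≡ suc d →
        delayed (sd (cell x′ i)) (sd (cell x′ k)) d (C (cell x′ i)) + (proc (sd (cell x′ k)) k ∸ 1) ≤ C (cell x′ k)
      prec′ {k = k} h e with split k h
      -- By `reachable` the arrival on the chosen side is nonzero, so `arr` applies to every
      -- predecessor of the new job.
      ... | inj₁ refl rewrite same | kept (preds-assigned (λ eq → 1+n≢0 (trans (sym e) eq))) =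
            +-monoˡ-≤ (proc z j ∸ 1) (≤-trans
              (∸-monoˡ-≤ 1 (arr z (preds-assigned (λ eq → 1+n≢0 (trans (sym e) eq))) j-open e (m<n⇒n≢0 reachable)))
              arrival-start)
      ... | inj₂ h′ rewrite kept h′ | kept (closed h′ (λ eq → 1+n≢0 (trans (sym e) eq))) = prec h′ e
      arr′ : ∀ {i k d} w → P x′ i ≡ 0 → P x′ k ≢ 0 → dl i k ≡ suc d → arrival (cell x′ k) w ≢ 0 →
        suc (delayed (sd (cell x′ i)) w d (C (cell x′ i))) ≤ arrival (cell x′ k) w
      arr′ {i} {k} {d} w hi hk e a with dl j k in ej
      arr′ {i} {k} {d} w hi hk e a | zero with split i hi
      ... | inj₁ refl = contradiction (trans (sym e) ej) 1+n≢0
      ... | inj₂ hi′ rewrite kept hi′ | no-edge (open⇒≢j hk) ej = arr w hi′ (open⇒open hk) e a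
      -- A nonzero merge has two nonzero parts and is their maximum; it therefore respects the
      -- earlier predecessors as well as `j`.
      arr′ {i} {k} {d} w hi hk e a | suc d₀
        with merge-≢0 (arrival (cell x k) w) (reach L τ d₀ z w) (λ eq → a (trans arrival-eq eq))
        where
        arrival-eq : arrival (cell x′ k) w ≡ merge (arrival (cell x k) w) (reach L τ d₀ z w)
        arrival-eq = trans (cong (λ c → arrival c w) (edge (open⇒≢j hk) ej)) (arrival-push L z τ d₀ (cell x k) w (open⇒open hk))
      ... | a≢0 , r≢0 , m≡ = ≤-trans (bound′ (split i hi)) (≤-reflexive (sym (trans
              (trans (cong (λ c → arrival c w) (edge (open⇒≢j hk) ej)) (arrival-push L z τ d₀ (cell x k) w (open⇒open hk))) m≡)))
        where
        bound′ : i ≡ j ⊎ P x i ≡ 0 →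
          suc (delayed (sd (cell x′ i)) w d (C (cell x′ i))) ≤ max (arrival (cell x k) w) (reach L τ d₀ z w)
        bound′ (inj₁ refl) with trans (sym e) ej
        ... | refl rewrite same = ≤-trans (≤-reflexive (sym (reach-≢0 L τ d z w r≢0))) (n≤max (arrival (cell x k) w) _)
        bound′ (inj₂ hi′) rewrite kept hi′ = ≤-trans (arr w hi′ (open⇒open hk) e a≢0) (m≤max _ _)
      finite′ : ∀ {k} → P x′ k ≡ 0 → 1 ≤ proc (sd (cell x′ k)) k
      finite′ {k} h with split k h
      ... | inj₁ refl rewrite same    = executable
      ... | inj₂ h′   rewrite kept h′ = finite h′
      costEq′ : cost x + extra z j ≡ sum (cloudPart x′)
      costEq′ = trans (cong₂ _+_ costEq (sym (cong (λ c → if0 (pend c) (extra (sd c) j) 0) same)))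
        (trans (sum-update {f = cloudPart x} {g = cloudPart x′} j agree)
               (trans (cong (λ p → sum (cloudPart x′) + if0 p (extra (sd (cell x j)) j) 0) ready) (+-identityʳ _)))
        where
        agree : ∀ k → k ≢ j → cloudPart x k ≡ cloudPart x′ k
        agree k k≢j with P x k in e
        ... | zero  = sym (trans (cong (λ c → if0 (pend c) (extra (sd c) k) 0) (kept e))
                                 (cong (λ p → if0 p (extra (sd (cell x k)) k) 0) e))
        ... | suc _ with P x′ k in e′
        ...   | zero  = contradiction e′ (P-open k≢j (λ eq → 1+n≢0 (trans (sym e) eq)))
        ...   | suc _ = refl
      fresh′ : ∀ {k} → P x′ k ≢ 0 → (∀ i → dl i k ≢ 0 → P x′ i ≢ 0) → ∀ w → arrival (cell x′ k) w ≡ 1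
      fresh′ {k} h none w with dl j k in e
      ... | suc _ = contradiction P-same (none j (λ eq → 1+n≢0 (trans (sym e) eq)))
      ... | zero  = trans (cong (λ c → arrival c w) (no-edge (open⇒≢j h) e))
                          (fresh (open⇒open h) (λ i ei → open⇒open (none i ei)) w)
      early′ : ∀ k w → arrival (cell x′ k) w ≤ suc (assigned x′ * (L + L))
      early′ k w with same? k
      ... | inj₁ refl = ≤-trans (≤-reflexive (zeroed′ {k} P-same w)) z≤n
      ... | inj₂ k≢j with P x k in p
      ...   | zero = ≤-trans (≤-reflexive (zeroed′ {k} (kept′ p) w)) z≤n
      ...   | suc q with dl j k in e
      ...     | zero  = ≤-trans (≤-reflexive (cong (λ c → arrival c w) (no-edge k≢j e)))
                          (≤-trans (early k w) (s≤s assigned-mono))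
      ...     | suc d = ≤-trans (≤-reflexive (trans (cong (λ c → arrival c w) (edge k≢j e))
                            (arrival-push L z τ d (cell x k) w (λ eq → 1+n≢0 (trans (sym p) eq)))))
                          (merge-≤ {arrival (cell x k) w} (≤-trans (early k w) (s≤s assigned-mono))
                                   (≤-trans (reach-≤ L τ d z w) (s≤s t-≤)))
      Fearly′ : ∀ w → w ≡ z → onServer z τ (F x) ≤ assigned x′ * (L + L)
      Fearly′ server refl = ≤-trans (m≤m+n τ L) t-≤
      Fearly′ cloud  refl = ≤-trans Fearly assigned-mono

  Good : ⟦ StateTy ⟧ → Set
  Good r = Σ[ x ∈ St ] r ≡ enc x × Inv x

  Good⇒Rep : ∀ {r} → Good r → Rep r
  Good⇒Rep (x , eq , _) = x , eq

-- Counting keys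

ceil-≤ : ∀ u {a q} → a ≤ q * suc u → ceil u a ≤ q
ceil-≤ u {a} {q} h = ≤-pred (m<n*o⇒m/o<n {a + u} {suc q} {suc u} (begin-strict
  a + u              <⟨ +-mono-≤-< h (n<1+n u) ⟩
  q * suc u + suc u  ≡⟨ +-comm (q * suc u) (suc u) ⟩
  suc q * suc u      ∎))
  where open ≤-Reasoning

-- Equal ceilings place both numbers in one block of `1 + u` consecutive values, so they differ by
-- at most `u`.
ceil-cancel : ∀ u {a c} → ceil u a ≡ ceil u c → c ≤ a + u
ceil-cancel u {a} {c} eq = ≤-pred (+-cancelʳ-≤ u _ _ (begin
  suc c + u                                     ≡⟨ cong suc (m≡m%n+[m/n]*n (c + u) (suc u)) ⟩
  suc ((c + u) % suc u) + (c + u) / suc u * suc u ≤⟨ +-mono-≤ (m%n<n (c + u) (suc u)) (≤-reflexive (cong (_* suc u) (sym eq))) ⟩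
  suc u + (a + u) / suc u * suc u               ≤⟨ +-monoʳ-≤ (suc u) (m/n*n≤m (a + u) (suc u)) ⟩
  suc u + (a + u)                               ≡⟨ +-comm (suc u) (a + u) ⟩
  a + u + suc u                                 ≡⟨ +-suc (a + u) u ⟩
  suc (a + u) + u                               ∎))
  where open ≤-Reasoning

-- Rounding up, unlike rounding down, keeps 0 apart from all positive arrivals. Equivalent states
-- thus exclude the same sides.
ceil-≢0 : ∀ u {a c} → ceil u a ≡ ceil u c → a ≢ 0 → c ≢ 0
ceil-≢0 u {suc a} {zero} eq _ _ = contradiction
  (subst (1 ≤_) eq (m≥n⇒m/n>0 {suc a + u} {suc u} (s≤s (m≤n+m u a))))
  (<⇒≱ (s≤s (ceil-≤ u {0} z≤n)))
ceil-≢0 u {zero}  {c} eq a≢0 = contradiction refl a≢0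

AllPairs-lookup : {R : X → X → Set} {xs : List X} → AllPairs R xs →
  ∀ i j → toℕ i < toℕ j → R (lookup xs i) (lookup xs j)
AllPairs-lookup (r ∷ rs) zero    (suc j) _       = All.lookup r (∈ₚ.∈-lookup j)
AllPairs-lookup (r ∷ rs) (suc i) (suc j) (s≤s h) = AllPairs-lookup rs i j h

-- Pigeonhole principle, with `R` as the relation of being different. The code may use the
-- membership proof, from which the invariant of the member is obtained.
length≤-by-code : {R : X → X → Set} {M : ℕ} (xs : List X) (code : ∀ {x} → x ∈ xs → Fin M) → AllPairs R xs →
  (∀ {x y} (i : x ∈ xs) (j : y ∈ xs) → code i ≡ code j → ¬ R x y) → length xs ≤ M
length≤-by-code xs code distinct clash =
  Finₚ.injective⇒≤ {f = λ i → code (∈ₚ.∈-lookup {xs = xs} i)} λ {i} {j} eq → same i j eq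
  where
  same : ∀ i j → code (∈ₚ.∈-lookup {xs = xs} i) ≡ code (∈ₚ.∈-lookup j) → i ≡ j
  same i j eq with <-cmp (toℕ i) (toℕ j)
  ... | tri< i<j _ _ = contradiction (AllPairs-lookup distinct i j i<j) (clash _ _ eq)
  ... | tri≈ _ i≡j _ = Finₚ.toℕ-injective i≡j
  ... | tri> _ _ j<i = contradiction (AllPairs-lookup distinct j i j<i) (clash _ _ (sym eq))

index-injective : {x y : X} {xs : List X} (i : x ∈ xs) (j : y ∈ xs) → index i ≡ index j → x ≡ y
index-injective {xs = xs} i j eq = trans (Anyₚ.lookup-index i) (trans (cong (lookup xs) eq) (sym (Anyₚ.lookup-index j)))

Unique-⊆-length : {xs ys : List X} → Unique xs → (∀ {x} → x ∈ xs → x ∈ ys) → length xs ≤ length ys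
Unique-⊆-length {xs = xs} {ys} uniq sub = length≤-by-code xs (λ i → index (sub i)) uniq
  (λ i j eq x≢y → x≢y (index-injective {xs = ys} (sub i) (sub j) eq))

-- Reading past the end gives `nothing`, which pads frontiers of varying length to a fixed number of
-- slots.
at : List X → ℕ → Maybe X
at []       _       = nothing
at (x ∷ xs) zero    = just x
at (x ∷ xs) (suc k) = at xs k

∈⇒at : {x : X} {xs : List X} (i : x ∈ xs) → at xs (toℕ (index i)) ≡ just x
∈⇒at (here refl) = refl
∈⇒at (there i)   = ∈⇒at i

at⇒∈ : {x : X} (xs : List X) → ∀ k → at xs k ≡ just x → x ∈ xs
at⇒∈ (y ∷ xs) zero    refl = here refl
at⇒∈ (y ∷ xs) (suc k) eq   = there (at⇒∈ xs k eq)

-- Edges and well-foundedness of the task graph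

module GraphFacts (G : Instance) where
  open Instance G
  open Semantics G

  edge⇒≢0 : ∀ {i k} → Edge i k → dl i k ≢ 0
  edge⇒≢0 {i} {k} e eq with delay i k | e
  ... | just _  | _  = 1+n≢0 eq
  ... | nothing | ()

  just⇒edge : ∀ {i k d} → delay i k ≡ just d → Edge i k
  just⇒edge {i} {k} eq = subst Is-just (sym eq) (MAny.just tt)

  dl⇒just : ∀ {i k d} → dl i k ≡ suc d → delay i k ≡ just d
  dl⇒just {i} {k} eq with delay i k | eq
  ... | just _ | refl = refl

  just⇒dl : ∀ {i k d} → delay i k ≡ just d → dl i k ≡ suc d
  just⇒dl eq = cong encodeMaybe eq

  ≢0⇒edge : ∀ {i k} → dl i k ≢ 0 → Edge i k
  ≢0⇒edge h = just⇒edge (dl⇒just (proj₂ (≢0⇒suc h)))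

  has-pred : ∀ k → k ≢ s → ∃[ i ] Edge i k
  has-pred k k≢s with Finₚ.any? (λ i → edge? i k)
  ... | yes p = p
  ... | no ¬p = contradiction (source-unique k (λ i e → ¬p (i , e))) k≢s

  has-succ : ∀ k → k ≢ t → ∃[ i ] Edge k i
  has-succ k k≢t with Finₚ.any? (λ i → edge? k i)
  ... | yes p = p
  ... | no ¬p = contradiction (sink-unique k (λ i e → ¬p (i , e))) k≢t

  _⇝_ : Job → Job → Set
  _⇝_ = Plus.TransClosure Edge

  -- Acyclicity makes reachability a strict order, and on finitely many jobs such an order is
  -- well-founded in both directions.
  ⇝-strict : IsStrictPartialOrder _≡_ _⇝_
  ⇝-strict = record
    { isEquivalence = isEquivalence ; irrefl = λ { refl p → acyclic _ p }
    ; trans = Plus._++_ ; <-resp-≈ = resp₂ _⇝_ }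

  Edge-wf : WellFounded Edge
  Edge-wf = Subrelation.wellFounded Plus.[_] (spo-wellFounded ⇝-strict)

  Edge-noetherian : WellFounded (λ i j → Edge j i)
  Edge-noetherian = Subrelation.wellFounded Plus.[_] (spo-noetherian ⇝-strict)

-- The number of pairwise inequivalent states

module Counting (G : Instance) (φ : ℕ) (small-cuts : ∀ A → Dividing G A → length (cut G A) ≤ φ)
                (L b u T : ℕ) (coarse : suc (Instance.n G * (L + L)) ≤ T * suc u) where
  open Instance G
  open Semantics G
  open GraphFacts G
  open Invariants G L b
  open Trimming G u
  open Inv

  -- The heads of edges leaving the assigned set. An unassigned source is included; otherwise the
  -- empty and the complete assignment would have the same frontier. This costs one slot beyond `φ`.
  Frontier : St → Job → Set
  Frontier x k = P x k ≢ 0 × (k ≡ s ⊎ (∃[ i ] P x i ≡ 0 × dl i k ≢ 0))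

  frontier? : ∀ x k → Dec (Frontier x k)
  frontier? x k = ¬? (P x k ≟ 0) ×-dec ((k Finₚ.≟ s) ⊎-dec Finₚ.any? (λ i → (P x i ≟ 0) ×-dec ¬? (dl i k ≟ 0)))

  frontier : St → List Job
  frontier x = filter (frontier? x) (allFin n)

  ∈-frontier : ∀ {x k} → Frontier x k → k ∈ frontier x
  ∈-frontier {x} {k} f = ∈ₚ.∈-filter⁺ (frontier? x) (∈ₚ.∈-allFin k) f

  frontier⇒ : ∀ {x k} → k ∈ frontier x → Frontier x k
  frontier⇒ {x} m = proj₂ (∈ₚ.∈-filter⁻ (frontier? x) {xs = allFin n} m)

  module Size (x : St) (inv : Inv x) where
    -- A dividing set has to contain `s` even before `s` is assigned. Adding `s` preserves closure
    -- under predecessors, as it has none.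
    Done : Job → Set
    Done k = k ≡ s ⊎ P x k ≡ 0

    done? : ∀ k → Dec (Done k)
    done? k = (k Finₚ.≟ s) ⊎-dec (P x k ≟ 0)

    doneSet : Sub.Subset n
    doneSet = Vec.tabulate (λ k → does (done? k))

    ∈done : ∀ {k} → Done k → k Sub.∈ doneSet
    ∈done {k} d = Vecₚ.lookup⇒[]= k doneSet (trans (Vecₚ.lookup∘tabulate _ k) (dec-true (done? k) d))

    ∉done : ∀ {k} → ¬ Done k → k Sub.∉ doneSet
    ∉done {k} d m with trans (sym (dec-false (done? k) d)) (trans (sym (Vecₚ.lookup∘tabulate _ k)) (Vecₚ.[]=⇒lookup m))
    ... | ()

    done-dividing : Dividing G doneSet
    done-dividing = ∈done (inj₁ refl) , λ j k e j∉A → ∉done λ where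
      (inj₁ refl) → s-source j e
      (inj₂ h)    → j∉A (∈done (inj₂ (closed inv h (edge⇒≢0 e))))

    frontier-⊆ : ∀ {k} → k ∈ frontier x → k ∈ s ∷ map proj₂ (cut G doneSet)
    frontier-⊆ {k} m with frontier⇒ {x} m
    ... | open-k , inj₁ refl = here refl
    ... | open-k , inj₂ (i , done-i , e) with k Finₚ.≟ s
    ...   | yes k≡s = here k≡s
    ...   | no  k≢s = there (∈ₚ.∈-map⁺ proj₂ (∈ₚ.∈-filter⁺ _ (∈ₚ.∈-cartesianProduct⁺ (∈ₚ.∈-allFin i) (∈ₚ.∈-allFin k))
              (≢0⇒edge e , ∈done (inj₂ done-i) , ∉done λ { (inj₁ k≡s) → k≢s k≡s ; (inj₂ h) → open-k h })))

    frontier-length : length (frontier x) ≤ suc φ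
    frontier-length = ≤-trans
      (Unique-⊆-length (Uniqueₚ.filter⁺ (frontier? x) (Uniqueₚ.allFin⁺ n)) frontier-⊆)
      (s≤s (≤-trans (≤-reflexive (Listₚ.length-map proj₂ (cut G doneSet))) (small-cuts doneSet done-dividing)))

  assigned≤n : ∀ x → assigned x ≤ n
  assigned≤n x = ≤-trans (sum-mono {g = λ _ → 1} (λ k → m∸n≤m 1 (P x k))) (≤-reflexive (trans (sum-const n 1) (*-identityʳ n)))

  arrival-< : ∀ {x} → Inv x → ∀ k z → ceil u (arrival (cell x k) z) < suc T
  arrival-< {x} inv k z = s≤s (ceil-≤ u (≤-trans (early inv k z)
    (≤-trans (s≤s (*-monoˡ-≤ (L + L) (assigned≤n x))) coarse)))

  F-< : ∀ {x} → Inv x → ceil u (F x) < suc T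
  F-< {x} inv = s≤s (ceil-≤ u (≤-trans (Fearly inv)
    (≤-trans (≤-trans (*-monoˡ-≤ (L + L) (assigned≤n x)) (n≤1+n _)) coarse)))

  -- One value for an empty slot; otherwise a frontier job with its two rounded arrivals, each
  -- between 0 and `T`.
  Slot : ℕ
  Slot = suc (n * (suc T * suc T))

  slot : ∀ {x} → Inv x → Maybe Job → Fin Slot
  slot inv nothing  = zero
  slot inv (just k) = suc (combine k (combine (fromℕ< (arrival-< inv k server)) (fromℕ< (arrival-< inv k cloud))))

  code : ∀ {x} → Inv x → Fin (Slot ^ suc φ * suc T)
  code {x} inv = combine (funToFin (λ (p : Fin (suc φ)) → slot inv (at (frontier x) (toℕ p)))) (fromℕ< (F-< inv))

  slot-injective : ∀ {x y} (ix : Inv x) (iy : Inv y) {k m} → slot ix (just k) ≡ slot iy m →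
    m ≡ just k × (∀ z → ceil u (arrival (cell x k) z) ≡ ceil u (arrival (cell y k) z))
  slot-injective ix iy {k} {just l} eq with Finₚ.combine-injective _ _ l _ (Finₚ.suc-injective eq)
  ... | refl , eq′ with Finₚ.combine-injective _ _ (fromℕ< (arrival-< iy k server)) _ eq′
  ...   | eₛ , e꜀ = refl , λ where
          server → Finₚ.fromℕ<-injective _ _ (arrival-< ix k server) (arrival-< iy k server) eₛ
          cloud  → Finₚ.fromℕ<-injective _ _ (arrival-< ix k cloud) (arrival-< iy k cloud) e꜀

  position : ∀ {x} → Inv x → ∀ {k} → k ∈ frontier x →
    Σ[ p ∈ Fin (suc φ) ] at (frontier x) (toℕ p) ≡ just k
  position {x} ix m = fromℕ< pos< , trans (cong (at (frontier x)) (Finₚ.toℕ-fromℕ< pos<)) (∈⇒at m)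
    where
    pos< : toℕ (index m) < suc φ
    pos< = ≤-trans (Finₚ.toℕ<n (index m)) (Size.frontier-length x ix)

  module SameCode {x y} (ix : Inv x) (iy : Inv y) (eq : code ix ≡ code iy) where
    private
      slots : ∀ p → slot ix (at (frontier x) (toℕ p)) ≡ slot iy (at (frontier y) (toℕ p))
      slots p = trans (sym (Finₚ.finToFun-funToFin (λ (p : Fin (suc φ)) → slot ix (at (frontier x) (toℕ p))) p))
        (trans (cong (λ f → finToFun f p) (Finₚ.combine-injectiveˡ _ (fromℕ< (F-< ix)) _ (fromℕ< (F-< iy)) eq))
               (Finₚ.finToFun-funToFin (λ (p : Fin (suc φ)) → slot iy (at (frontier y) (toℕ p))) p))

    F-eq : ceil u (F x) ≡ ceil u (F y)
    F-eq = Finₚ.fromℕ<-injective _ _ (F-< ix) (F-< iy)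
      (Finₚ.combine-injectiveʳ (funToFin (λ (p : Fin (suc φ)) → slot ix (at (frontier x) (toℕ p)))) _
        (funToFin (λ (p : Fin (suc φ)) → slot iy (at (frontier y) (toℕ p)))) _ eq)

    transfer : ∀ {k} → k ∈ frontier x →
      k ∈ frontier y × (∀ z → ceil u (arrival (cell x k) z) ≡ ceil u (arrival (cell y k) z))
    transfer {k} m =
      let p , at-x = position ix m
          at-y , ceils = slot-injective ix iy {k} (trans (cong (slot ix) (sym at-x)) (slots p))
      in at⇒∈ (frontier y) (toℕ p) at-y , ceils

    -- An unassigned job lies behind some frontier job, so the frontier determines
    -- which jobs are assigned.
    open⇒open : ∀ {k} → Acc Edge k → P x k ≢ 0 → P y k ≢ 0
    open⇒open {k} (acc rs) h with frontier? x k
    ... | yes f = proj₁ (frontier⇒ {y} (proj₁ (transfer (∈-frontier {x} f))))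
    ... | no ¬f with has-pred k (λ k≡s → ¬f (h , inj₁ k≡s))
    ...   | i , e = λ done-k → open⇒open (rs e) (λ done-i → ¬f (h , inj₂ (i , done-i , edge⇒≢0 e)))
                                  (closed iy done-k (edge⇒≢0 e))

  -- Off the frontier nothing remains to be recorded: assigned jobs have arrivals 0 by `zeroed`, and
  -- the other unassigned ones have arrivals 1 by `fresh`.
  code-injective : ∀ {x y} (ix : Inv x) (iy : Inv y) → code ix ≡ code iy → SameKey x y
  code-injective {x} {y} ix iy eq = cells , SameCode.F-eq ix iy eq
    where
    module XY = SameCode ix iy eq
    module YX = SameCode iy ix (sym eq)
    initial-arrival : ∀ {w} → Inv w → ∀ {k} → P w k ≢ 0 → ¬ Frontier w k → ∀ z → arrival (cell w k) z ≡ 1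
    initial-arrival iw h ¬f = fresh iw h (λ i e done-i → ¬f (h , inj₂ (i , done-i , e)))
    arrivals : ∀ k → P x k ≢ 0 → P y k ≢ 0 → ∀ z → ceil u (arrival (cell x k) z) ≡ ceil u (arrival (cell y k) z)
    arrivals k hx hy z with frontier? x k | frontier? y k
    ... | yes f | _     = proj₂ (XY.transfer (∈-frontier {x} f)) z
    ... | no ¬f | yes f = contradiction (frontier⇒ {x} (proj₁ (YX.transfer (∈-frontier {y} f)))) ¬f
    ... | no ¬f | no ¬g = cong (ceil u) (trans (initial-arrival ix hx ¬f z) (sym (initial-arrival iy hy ¬g z)))
    cells : ∀ k → cellKey u (cell x k) ≡ cellKey u (cell y k)
    cells k with P x k in ex | P y k in ey
    ... | zero  | suc _ = contradiction ex (YX.open⇒open (Edge-wf k) (λ e → 1+n≢0 (trans (sym ey) e)))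
    ... | suc _ | zero  = contradiction ey (XY.open⇒open (Edge-wf k) (λ e → 1+n≢0 (trans (sym ex) e)))
    ... | zero  | zero  = cong₂ (λ a c → 1 , a , c)
          (cong (ceil u) (trans (zeroed ix ex server) (sym (zeroed iy ey server))))
          (cong (ceil u) (trans (zeroed ix ex cloud) (sym (zeroed iy ey cloud))))
    ... | suc p | suc q = cong₂ (λ e a → e , a) (trans (0∸n≡0 p) (sym (0∸n≡0 q)))
          (cong₂ _,_ (arrivals k (λ e → 1+n≢0 (trans (sym ex) e)) (λ e → 1+n≢0 (trans (sym ey) e)) server)
                     (arrivals k (λ e → 1+n≢0 (trans (sym ex) e)) (λ e → 1+n≢0 (trans (sym ey) e)) cloud))

  distinct-length : ∀ {ss} → (∀ {r} → r ∈ ss → Good r) → Distinct ss → length ss ≤ Slot ^ suc φ * suc T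
  distinct-length {ss} good distinct = length≤-by-code ss (λ i → code (proj₂ (proj₂ (good i)))) distinct clash
    where
    clash : ∀ {r w} (i : r ∈ ss) (j : w ∈ ss) →
      code (proj₂ (proj₂ (good i))) ≡ code (proj₂ (proj₂ (good j))) → ¬ ¬ r ~ w
    clash i j eq with good i | good j
    ... | x , refl , ix | y , refl , iy = λ r≁w → r≁w (SameKey⇒~ x y (code-injective ix iy eq))

-- Correctness of the dynamic program

foldr-iterate : (f : Y → Y) (y : Y) (xs : List X) → foldr (λ _ → f) y xs ≡ fold y f (length xs)
foldr-iterate f y []       = refl
foldr-iterate f y (x ∷ xs) = cong f (foldr-iterate f y xs)

sum∞ : ∀ {n} {f : Fin n → ℕ∞} (g : Fin n → ℕ) → (∀ j → f j ≡ [ g j ]) →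
  foldr _+∞_ [ 0 ] (tabulate f) ≡ [ sum g ]
sum∞ {zero}  g eq = refl
sum∞ {suc n} g eq rewrite eq zero | sum∞ (g ∘ suc) (eq ∘ suc) = refl

sum∞-finite : ∀ {n b} (f : Fin n → ℕ∞) → foldr _+∞_ [ 0 ] (tabulate f) ≤⁺ [ b ] →
  Σ[ g ∈ (Fin n → ℕ) ] (∀ j → f j ≡ [ g j ]) × sum g ≤ b
sum∞-finite {zero}  f ≤b = (λ ()) , (λ ()) , z≤n
sum∞-finite {suc n} {b} f ≤b with f zero in e₀ | foldr _+∞_ [ 0 ] (tabulate (f ∘ suc)) in e
sum∞-finite {suc n} {b} f ≤⁺.[ h ] | [ k ] | [ m ]
  with sum∞-finite {n} {m} (f ∘ suc) (subst (_≤⁺ [ m ]) (sym e) ≤⁺.[ ≤-refl ])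
... | g , eq , ≤m = (λ { zero → k ; (suc j) → g j }) , (λ { zero → e₀ ; (suc j) → eq j }) ,
  ≤-trans (+-monoʳ-≤ k ≤m) h

least : ∀ {n} {Q : Fin n → Set} → (∀ k → Dec (Q k)) → (w : Fin n → ℕ) → ∀ k → Q k → Acc _<_ (w k) →
  Σ[ l ∈ Fin n ] Q l × (∀ m → Q m → w l ≤ w m)
least {Q = Q} Q? w k q (acc rs) with Finₚ.any? (λ l → Q? l ×-dec (w l <? w k))
... | yes (l , q′ , l<k) = least Q? w l q′ (rs l<k)
... | no none            = k , q , λ m q′ → ≮⇒≥ (λ m<k → none (m , q′ , m<k))

same-side : (z z′ : Side) → z ≡ z′ ⊎ z ≢ z′
same-side server server = inj₁ refl
same-side server cloud  = inj₂ λ ()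
same-side cloud  server = inj₂ λ ()
same-side cloud  cloud  = inj₁ refl

delayed-same : ∀ z d t → delayed z z d t ≡ t
delayed-same server d t = refl
delayed-same cloud  d t = refl

delayed-cross : ∀ {z z′} d t → z ≢ z′ → delayed z z′ d t ≡ t + d
delayed-cross {server} {server} d t h = contradiction refl h
delayed-cross {server} {cloud}  d t h = refl
delayed-cross {cloud}  {server} d t h = refl
delayed-cross {cloud}  {cloud}  d t h = contradiction refl h

-- Propagation along an edge is a translation, so it does not amplify a lateness `e`.
delayed-slack : ∀ z z′ d {t t′ e} → t ≤ t′ + e → delayed z z′ d t ≤ delayed z z′ d t′ + e
delayed-slack z z′ d {t} {t′} {e} h with same-side z z′
... | inj₁ refl rewrite delayed-same z d t | delayed-same z d t′ = h
... | inj₂ z≢z′ rewrite delayed-cross d t z≢z′ | delayed-cross d t′ z≢z′ = begin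
  t + d        ≤⟨ +-monoˡ-≤ d h ⟩
  t′ + e + d   ≡⟨ +-assoc t′ e d ⟩
  t′ + (e + d) ≡⟨ cong (t′ +_) (+-comm e d) ⟩
  t′ + (d + e) ≡⟨ sym (+-assoc t′ d e) ⟩
  t′ + d + e   ∎
  where open ≤-Reasoning

reach-short : ∀ L t {d} z z′ → (z ≢ z′ → d ≤ L) → reach L t d z z′ ≡ suc (delayed z z′ d t)
reach-short L t server server h = refl
reach-short L t server cloud  h = other-short L t (h λ ())
reach-short L t cloud  server h = other-short L t (h λ ())
reach-short L t cloud  cloud  h = refl

if0-cong : ∀ {p q} {x y : X} → 1 ∸ p ≡ 1 ∸ q → if0 p x y ≡ if0 q x y
if0-cong {p = zero}  {zero}  eq = refl
if0-cong {p = suc p} {suc q} eq = refl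
if0-cong {p = zero}  {suc q} eq = contradiction (trans eq (0∸n≡0 q)) 1+n≢0
if0-cong {p = suc p} {zero}  eq = contradiction (trans (sym eq) (0∸n≡0 p)) 1+n≢0

open-cong : ∀ {p q} → 1 ∸ p ≡ 1 ∸ q → p ≢ 0 → q ≢ 0
open-cong {p} {q} eq p≢0 refl with p
... | zero  = p≢0 refl
... | suc r = 1+n≢0 (trans (sym eq) (0∸n≡0 r))

module Layers (G : Instance) (L b u : ℕ) where
  open Instance G
  open Semantics G
  open Preparation G
  open Invariants G L b
  open Trimming G u

  step : List ⟦ StateTy ⟧ → List ⟦ StateTy ⟧
  step ss = fun stepᶜ ((L , b) , u , ss)

  layer : ℕ → List ⟦ StateTy ⟧
  layer m = fold (enc initial ∷ []) step m

  run-layer : fun runᶜ (graph , enc initial , (L , b) , u) ≡ layer n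
  run-layer = trans (foldr-iterate step _ graph) (cong layer length-graph)

  AllGood : List ⟦ StateTy ⟧ → Set
  AllGood ss = ∀ {r} → r ∈ ss → Good r

  successors-Good : ∀ {Q : St → Set} {ss} → (∀ {r} → r ∈ ss → Σ[ x ∈ St ] r ≡ enc x × Inv x × Q x) →
    ∀ {r} → r ∈ fun successorsᶜ ((L , b) , u , ss) →
    ∃[ x ] ∃[ y ] Q x × r ≡ enc y × Inv y × assigned y ≡ suc (assigned x)
  successors-Good good m with ∈-successors⁻ {u = u} good m
  ... | x , (inv , q) , mkSuccessor z j al eq =
        x , _ , q , eq , Assign.assign-Inv inv al , Assign.assigned-suc inv al

  good-successors : ∀ {ss} → AllGood ss → AllGood (fun successorsᶜ ((L , b) , u , ss))
  good-successors good m with successors-Good {λ _ → ⊤} (λ i → let x , eq , inv = good i in x , eq , inv , tt) m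
  ... | _ , y , _ , eq , inv , _ = y , eq , inv

  distinct-step : ∀ {ss} → AllGood ss → Distinct (step ss)
  distinct-step good = trim-distinct (λ i → Good⇒Rep (good-successors good i))

  GoodAt : ℕ → ⟦ StateTy ⟧ → Set
  GoodAt m r = Σ[ x ∈ St ] r ≡ enc x × Inv x × assigned x ≡ m

  Good⇐ : ∀ {m r} → GoodAt m r → Good r
  Good⇐ (x , eq , inv , _) = x , eq , inv

  open-sum : ∀ x → assigned x + sum (λ k → ind (P x k)) ≡ n
  open-sum x = trans (sym (∑-distrib-+ (λ k → 1 ∸ P x k) (λ k → ind (P x k))))
    (trans (sum-cong-≗ (λ k → one (P x k))) (trans (sum-const n 1) (*-identityʳ n)))
    where
    one : ∀ p → (1 ∸ p) + ind p ≡ 1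
    one zero    = refl
    one (suc p) = cong (_+ 1) (0∸n≡0 p)

  all-assigned : ∀ {x} → assigned x ≡ n → ∀ k → P x k ≡ 0
  all-assigned {x} eq k = ind≡0 _ (n≤0⇒n≡0 (≤-trans (term≤sum (λ k → ind (P x k)) k) (≤-reflexive
    (+-cancelˡ-≡ n _ _ (trans (cong (_+ sum (λ k → ind (P x k))) (sym eq)) (trans (open-sum x) (sym (+-identityʳ n))))))))

  some-open : ∀ {x} → assigned x < n → ∃[ k ] P x k ≢ 0
  some-open {x} lt with Finₚ.any? (λ k → ¬? (P x k ≟ 0))
  ... | yes p = p
  ... | no ¬p = contradiction (subst (assigned x <_) (sym (trans (sym (+-identityʳ _))
    (trans (cong (assigned x +_) (sym (sum≡0 _ closed-all))) (open-sum x)))) lt) (<-irrefl refl)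
    where
    closed-all : ∀ k → ind (P x k) ≡ 0
    closed-all k with P x k in e
    ... | zero  = refl
    ... | suc _ = contradiction (k , λ eq → 1+n≢0 (trans (sym e) eq)) ¬p

  assigned-initial : assigned initial ≡ 0
  assigned-initial = sum≡0 (λ k → 1 ∸ P initial k) (λ k → 0∸n≡0 (sum (λ i → ind (dl i k)) + 0))

  good-next : ∀ {m ss} → (∀ {r} → r ∈ ss → GoodAt m r) → ∀ {r} → r ∈ step ss → GoodAt (suc m) r
  good-next {m} {ss} good i =
    let _ , y , a , eq , inv , a′ = successors-Good good
          (trim-⊆ (λ i → Good⇒Rep (good-successors (λ j → Good⇐ (good j)) i)) i)
    in y , eq , inv , trans a′ (cong suc a)

  good-layer : ∀ m {r} → r ∈ layer m → GoodAt m r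
  good-layer zero (here refl) = initial , refl , initial-Inv , assigned-initial
  good-layer (suc m) i        = good-next (good-layer m) i

-- Complete states are feasible schedules

module Soundness (G : Instance) (L b : ℕ) (x : Semantics.St G) (inv : Invariants.Inv G L b x)
                 (complete : ∀ k → pend (Semantics.cell x k) ≡ 0) where
  open Instance G
  open Semantics G
  open GraphFacts G
  open Invariants G L b
  open Inv inv

  schedule : Schedule G
  schedule = record { side = λ k → sd (cell x k) ; C = λ k → C (cell x k) }

  open Schedule schedule using (side; pπ) renaming (C to C′; _≤start_ to _≤start′_)

  dur : Job → ℕ
  dur k = proc (side k) k ∸ 1

  finite-cloud : ∀ k → 1 ≤ proc cloud k → pc k ≡ [ proc cloud k ∸ 1 ]
  finite-cloud k h with pc k
  finite-cloud k h  | [ _ ] = refl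
  finite-cloud k () | ⊤⁺

  pπ-dur : ∀ k → pπ k ≡ [ dur k ]
  pπ-dur k with sd (cell x k) | finite {k} (complete k)
  ... | server | _ = refl
  ... | cloud  | f = finite-cloud k f

  ≤start⇐ : ∀ {v} k → v + dur k ≤ C′ k → v ≤start′ k
  ≤start⇐ {v} k h rewrite pπ-dur k = ≤⁺.[ h ]

  on-server : ∀ k → side k ≡ server → dur k ≡ ps k
  on-server k eq = cong (λ z → proc z k ∸ 1) eq

  valid : Schedule.Valid schedule
  valid = record
    { server-exclusive = λ i j i≢j si sj → excl′ i j si sj (excl i≢j (complete i) (complete j) si sj)
    ; precedence-same = λ i j e same → ≤start⇐ j (same-prec (proj₂ (≢0⇒suc (edge⇒≢0 e))) same)
    ; precedence-cross = λ i j d e cross → ≤start⇐ j (subst (λ v → v + dur j ≤ C′ j)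
        (delayed-cross d (C′ i) cross) (prec (complete j) (just⇒dl e))) }
    where
    excl′ : ∀ i j → side i ≡ server → side j ≡ server → C′ i + ps j ≤ C′ j ⊎ C′ j + ps i ≤ C′ i →
      C′ i ≤start′ j ⊎ C′ j ≤start′ i
    excl′ i j si sj (inj₁ h) = inj₁ (≤start⇐ j (subst (λ v → C′ i + v ≤ C′ j) (sym (on-server j sj)) h))
    excl′ i j si sj (inj₂ h) = inj₂ (≤start⇐ i (subst (λ v → C′ j + v ≤ C′ i) (sym (on-server i si)) h))
    same-prec : ∀ {i j d} → dl i j ≡ suc d → side i ≡ side j → C′ i + dur j ≤ C′ j
    same-prec {i} {j} {d} e same = subst (λ v → v + dur j ≤ C′ j)
      (trans (cong (λ z → delayed z (side j) d (C′ i)) same) (delayed-same (side j) d (C′ i)))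
      (prec {i} (complete j) e)

  cost-eq : Schedule.cost schedule ≡ [ cost x ]
  cost-eq = trans (sum∞ (cloudPart x) part) (cong [_] (sym costEq))
    where
    part : ∀ k → Schedule.cloudCost schedule k ≡ [ cloudPart x k ]
    part k rewrite complete k with sd (cell x k) | finite {k} (complete k)
    ... | server | _ = refl
    ... | cloud  | f = finite-cloud k f

  feasible : Feasible G b schedule
  feasible = valid , subst (_≤⁺ [ b ]) (sym cost-eq) ≤⁺.[ afford ]

  -- The infinite cloud time of `t` forces it onto the server, where `F x` bounds every completion.
  -- This is why `bestᶜ` may compare final states by `F`.
  makespan-≤ : Schedule.makespan schedule ≤ F x
  makespan-≤ = free (complete t) t-server
    where
    t-server : sd (cell x t) ≡ server
    t-server with sd (cell x t) | finite {t} (complete t)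
    ... | server | _ = refl
    ... | cloud  | f with subst (λ p → 1 ≤ encodeMaybe p) pc-t f
    ...   | ()

[]-injective : ∀ {m k} → _≡_ {A = ℕ∞} [ m ] [ k ] → m ≡ k
[]-injective refl = refl

-- Following an arbitrary feasible schedule through the layers

module Completeness (G : Instance) (b : ℕ) (σ : Schedule G) (σ-feasible : Feasible G b σ)
  (L u : ℕ) (L-large : ∀ {v} → v ∈ Preparation.guesses G → v ≤ Schedule.makespan σ → v ≤ L) where
  open Instance G
  open Semantics G
  open GraphFacts G
  open Preparation G
  open Invariants G L b
  open Trimming G u
  open Layers G L b u
  open Schedule σ using (side; pπ; makespan; cloudCost) renaming (C to C*; _≤start_ to _≤start*_)
  open Schedule.Valid (proj₁ σ-feasible)

  dur : Job → ℕ
  dur j = proc (side j) j ∸ 1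

  start* : Job → ℕ
  start* j = C* j ∸ dur j

  costs : Σ[ g ∈ (Job → ℕ) ] (∀ j → cloudCost j ≡ [ g j ]) × sum g ≤ b
  costs = sum∞-finite cloudCost (proj₂ σ-feasible)

  proc-finite : ∀ j → 1 ≤ proc (side j) j
  proc-finite j with side j | proj₁ (proj₂ costs) j
  ... | server | _ = s≤s z≤n
  ... | cloud  | eq rewrite eq = s≤s z≤n

  pπ-dur : ∀ j → pπ j ≡ [ dur j ]
  pπ-dur j with side j | proj₁ (proj₂ costs) j
  ... | server | _ = refl
  ... | cloud  | eq rewrite eq = refl

  extra-cost : ∀ j → cloudCost j ≡ [ extra (side j) j ]
  extra-cost j with side j | proj₁ (proj₂ costs) j
  ... | server | _ = refl
  ... | cloud  | eq rewrite eq = refl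

  total-extra : sum (λ j → extra (side j) j) ≤ b
  total-extra = ≤-trans (≤-reflexive (sum-cong-≗ same)) (proj₂ (proj₂ costs))
    where
    same : ∀ j → extra (side j) j ≡ proj₁ costs j
    same j = []-injective (trans (sym (extra-cost j)) (proj₁ (proj₂ costs) j))

  ≤start⇒ : ∀ {v} j → v ≤start* j → v + dur j ≤ C* j
  ≤start⇒ {v} j h with subst (λ p → [ v ] +∞ p ≤⁺ [ C* j ]) (pπ-dur j) h
  ... | ≤⁺.[ h′ ] = h′

  edge-prec : ∀ {i j d} → dl i j ≡ suc d → delayed (side i) (side j) d (C* i) + dur j ≤ C* j
  edge-prec {i} {j} {d} e with same-side (side i) (side j)
  ... | inj₁ eq = subst (λ v → v + dur j ≤ C* j)
        (trans (sym (delayed-same (side j) d (C* i))) (cong (λ z → delayed z (side j) d (C* i)) (sym eq)))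
        (≤start⇒ j (precedence-same i j (just⇒edge (dl⇒just e)) eq))
  ... | inj₂ ≢ = subst (λ v → v + dur j ≤ C* j) (sym (delayed-cross d (C* i) ≢))
        (≤start⇒ j (precedence-cross i j d (dl⇒just e) ≢))

  edge-start : ∀ {i j d} → dl i j ≡ suc d → delayed (side i) (side j) d (C* i) ≤ start* j
  edge-start {j = j} e = m+n≤o⇒m≤o∸n _ (edge-prec e)

  edge-C : ∀ {i j} → Edge i j → C* i ≤ start* j
  edge-C {i} {j} e with ≢0⇒suc (edge⇒≢0 e)
  ... | d , eq = ≤-trans (undelayed (side i) (side j)) (edge-start eq)
    where
    undelayed : ∀ z z′ → C* i ≤ delayed z z′ d (C* i)
    undelayed server server = ≤-refl
    undelayed server cloud  = m≤m+n _ _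
    undelayed cloud  server = m≤m+n _ _
    undelayed cloud  cloud  = ≤-refl

  -- Ensures that the truncated difference `start*` is a true one. A predecessor leaves room for the
  -- processing time; the source has none, but takes time 0 on the server, its only possible side.
  dur≤C : ∀ j → dur j ≤ C* j
  dur≤C j with j Finₚ.≟ s
  ... | no j≢s with has-pred j j≢s
  ...   | i , e with ≢0⇒suc (edge⇒≢0 e)
  ...     | d , eq = ≤-trans (m≤n+m (dur j) _) (edge-prec eq)
  dur≤C j | yes refl with side s | proc-finite s
  ... | server | _ = ≤-trans (≤-reflexive ps-s) z≤n
  ... | cloud  | f with subst (λ p → 1 ≤ encodeMaybe p) pc-s f
  ...   | ()

  start+dur : ∀ j → start* j + dur j ≡ C* j
  start+dur j = m∸n+n≡m (dur≤C j)

  start≤C : ∀ j → start* j ≤ C* j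
  start≤C j = m∸n≤m (C* j) (dur j)

  -- Any job can be followed along edges to the unique sink, and completion times never decrease on
  -- the way.
  C≤makespan : ∀ j → C* j ≤ makespan
  C≤makespan j = go j (Edge-noetherian j)
    where
    go : ∀ j → Acc (λ i j → Edge j i) j → C* j ≤ makespan
    go j (acc rs) with j Finₚ.≟ t
    ... | yes refl = ≤-refl
    ... | no j≢t with has-succ j j≢t
    ...   | k , e = ≤-trans (edge-C e) (≤-trans (start≤C k) (go k (rs e)))

  -- Assigning the jobs by increasing start* + C* respects the edges, up to ties, as
  -- well as the order on the server: if C* j ≤ start* i and rank i ≤ rank j then
  -- the two jobs have length 0 and are simultaneous.
  rank : Job → ℕ
  rank j = start* j + C* j

  edge-rank : ∀ {i j} → Edge i j → rank i ≤ rank j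
  edge-rank {i} {j} e = +-mono-≤ (≤-trans (start≤C i) (edge-C e)) (≤-trans (edge-C e) (start≤C j))

  server-order : ∀ {i j} → i ≢ j → side i ≡ server → side j ≡ server → rank i ≤ rank j → C* i ≤ start* j
  server-order {i} {j} i≢j si sj le with server-exclusive i j i≢j si sj
  ... | inj₁ h = m+n≤o⇒m≤o∸n _ (≤start⇒ j h)
  ... | inj₂ h = +-cancelˡ-≤ (C* j) _ _ (begin
    C* j + C* i    ≤⟨ +-monoˡ-≤ (C* i) (m+n≤o⇒m≤o∸n _ (≤start⇒ i h)) ⟩
    start* i + C* i ≤⟨ le ⟩
    start* j + C* j ≡⟨ +-comm (start* j) (C* j) ⟩
    C* j + start* j ∎)
    where open ≤-Reasoning

  -- What `σ` still spends on unassigned jobs. It depends only on the assigned set, so replacing `x`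
  -- by a cheaper equivalent state keeps the plan affordable.
  remaining : St → Job → ℕ
  remaining x k = if0 (P x k) 0 (extra (side k) k)

  -- The state x, extended by the remaining decisions of σ, stays within e of σ.
  record Follows (x : St) (e : ℕ) : Set where
    field
      segment   : ∀ {j k} → P x j ≡ 0 → P x k ≢ 0 → rank j ≤ rank k
      unblocked : ∀ {k} → P x k ≢ 0 → arrival (cell x k) (side k) ≢ 0
      arrival≤  : ∀ {k} → P x k ≢ 0 → arrival (cell x k) (side k) ≤ suc (start* k + e)
      F≤start   : ∀ {k} → P x k ≢ 0 → side k ≡ server → F x ≤ start* k + e
      F≤        : F x ≤ makespan + e
      budget    : cost x + sum (remaining x) ≤ b

  initial-Follows : Follows initial 0
  initial-Follows = record
    { segment = λ () ; unblocked = λ {k} _ eq → 1+n≢0 (trans (sym (one (side k))) eq)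
    ; arrival≤ = λ {k} _ → ≤-trans (≤-reflexive (one (side k))) (s≤s z≤n)
    ; F≤start = λ _ _ → z≤n ; F≤ = z≤n ; budget = total-extra }
    where
    one : ∀ {k} z → arrival (cell initial k) z ≡ 1
    one server = refl
    one cloud  = refl

  Candidate : St → Job → Set
  Candidate x k = P x k ≢ 0 × (∀ l → P x l ≢ 0 → rank k ≤ rank l)

  Next : St → Job → Set
  Next x k = Candidate x k × (∀ i → dl i k ≢ 0 → P x i ≡ 0)

  open? : ∀ x k → Dec (P x k ≢ 0)
  open? x k = ¬? (P x k ≟ 0)

  -- Ties in `rank` may leave a predecessor of a least job unassigned. By `edge-rank` that
  -- predecessor is again a candidate, and well-foundedness ends the walk at a job that is ready.
  descend : ∀ x k → Acc Edge k → Candidate x k → ∃[ l ] Next x l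
  descend x k (acc rs) (op , min) with Finₚ.any? (λ i → edge? i k ×-dec open? x i)
  ... | yes (i , ed , op′) = descend x i (rs ed) (op′ , λ l op″ → ≤-trans (edge-rank ed) (min l op″))
  ... | no none            = k , (op , min) , closed-pred
    where
    closed-pred : ∀ i → dl i k ≢ 0 → P x i ≡ 0
    closed-pred i h with P x i in eq
    ... | zero  = refl
    ... | suc _ = contradiction (i , ≢0⇒edge h , λ eq′ → 1+n≢0 (trans (sym eq) eq′)) none

  next : ∀ x k → P x k ≢ 0 → ∃[ l ] Next x l
  next x k op with least (open? x) rank k op (<-wellFounded _)
  ... | l , op′ , min = descend x l (Edge-wf l) (op′ , min)

  module Extend {x : St} {e : ℕ} (inv : Inv x) (f : Follows x e) (k : Job) (k-next : Next x k) where
    open Follows f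

    k-open : P x k ≢ 0
    k-open = proj₁ (proj₁ k-next)

    k-least : ∀ l → P x l ≢ 0 → rank k ≤ rank l
    k-least = proj₂ (proj₁ k-next)

    z : Side
    z = side k

    dur∈guesses : dur k ∈ guesses
    dur∈guesses with side k
    ... | server = ps∈guesses k
    ... | cloud  = pc∈guesses k

    extra-share : extra z k ≤ sum (remaining x)
    extra-share = ≤-trans (≤-reflexive (sym (picked (P x k) k-open))) (term≤sum (remaining x) k)
      where
      picked : ∀ p → p ≢ 0 → if0 p 0 (extra z k) ≡ extra z k
      picked zero    h = contradiction refl h
      picked (suc p) h = refl

    allowed : Allowed L b x z k
    allowed = mkAllowed
      (trans (Inv.count inv k-open) (cong suc (sum≡0 _ λ i → zero-term i)))
      (n≢0⇒n>0 (unblocked k-open)) (proc-finite k)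
      (L-large dur∈guesses (≤-trans (dur≤C k) (C≤makespan k)))
      (≤-trans (+-monoʳ-≤ (cost x) extra-share) budget)
      where
      zero-term : ∀ i → ind (P x i) * ind (dl i k) ≡ 0
      zero-term i with dl i k in eq
      ... | zero  = *-zeroʳ (ind (P x i))
      ... | suc d rewrite proj₂ k-next i (λ eq′ → 1+n≢0 (trans (sym eq) eq′)) = refl

    open Assign inv allowed

    x′ : St
    x′ = assign L x z k

    τ : ℕ
    τ = completion x z k

    -- The start is the maximum of the free time and the decoded arrival, or just the latter on the
    -- cloud; each is at most `e` later than in `σ`.
    τ≤ : τ ≤ C* k + e
    τ≤ = begin
      startTime x z k + dur k ≤⟨ +-monoˡ-≤ (dur k) (max-lub (server-free z refl) (∸-monoˡ-≤ 1 (arrival≤ k-open))) ⟩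
      start* k + e + dur k     ≡⟨ +-assoc (start* k) e (dur k) ⟩
      start* k + (e + dur k)   ≡⟨ cong (start* k +_) (+-comm e (dur k)) ⟩
      start* k + (dur k + e)   ≡⟨ sym (+-assoc (start* k) (dur k) e) ⟩
      start* k + dur k + e     ≡⟨ cong (_+ e) (start+dur k) ⟩
      C* k + e                ∎
      where
      open ≤-Reasoning
      server-free : ∀ w → w ≡ z → onServer w (F x) 0 ≤ start* k + e
      server-free server eq = F≤start k-open (sym eq)
      server-free cloud  eq = z≤n

    -- A crossing delay that `σ` observes fits below its makespan. As a number of the instance it is
    -- then within the guess, and the side `σ` wants is not excluded.
    short-delay : ∀ {l d} → dl k l ≡ suc d → z ≢ side l → d ≤ L
    short-delay {l} {d} eq cross = L-large (subst (_∈ guesses) (cong (_∸ 1) eq) (delay∈guesses k l))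
      (≤-trans (≤-trans (m≤n+m d (C* k)) (≤-reflexive (sym (delayed-cross d (C* k) cross))))
               (≤-trans (≤-trans (edge-start eq) (start≤C l)) (C≤makespan l)))

    reach-eq : ∀ {l d} → dl k l ≡ suc d → reach L τ d z (side l) ≡ suc (delayed z (side l) d τ)
    reach-eq {l} eq = reach-short L τ z (side l) (short-delay eq)

    reach-start : ∀ {l d} → dl k l ≡ suc d → reach L τ d z (side l) ≤ suc (start* l + e)
    reach-start {l} {d} eq = ≤-trans (≤-reflexive (reach-eq eq)) (s≤s
      (≤-trans (delayed-slack z (side l) d τ≤) (+-monoˡ-≤ e (edge-start eq))))

    data Arrival′ (l : Job) : Set where
      old : arrival (cell x′ l) (side l) ≡ arrival (cell x l) (side l) → Arrival′ l
      new : ∀ {d} → dl k l ≡ suc d →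
        arrival (cell x′ l) (side l) ≡ max (arrival (cell x l) (side l)) (reach L τ d z (side l)) → Arrival′ l

    arrival′ : ∀ l → P x′ l ≢ 0 → Arrival′ l
    arrival′ l op with dl k l in eq
    ... | zero  = old (cong (λ c → arrival c (side l)) (no-edge (open⇒≢j op) eq))
    ... | suc d = new eq (trans (cong (λ c → arrival c (side l)) (edge (open⇒≢j op) eq))
          (trans (arrival-push L z τ d (cell x l) (side l) (open⇒open op))
                 (merge-nonzero (unblocked (open⇒open op)) (λ eq′ → 1+n≢0 (trans (sym (reach-eq eq)) eq′)))))

    follows : Follows x′ e
    follows = record
      { segment = λ {j} {l} → segment′ j l ; unblocked = λ {l} → unblocked′ l ; arrival≤ = λ {l} → arrival≤′ l
      ; F≤start = λ {l} → F≤start′ z refl l ; F≤ = F≤′ z refl ; budget = budget′ }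
      where
      segment′ : ∀ j l → P x′ j ≡ 0 → P x′ l ≢ 0 → rank j ≤ rank l
      segment′ j l h op with split j h
      ... | inj₁ refl = k-least l (open⇒open op)
      ... | inj₂ h′   = segment h′ (open⇒open op)
      unblocked′ : ∀ l → P x′ l ≢ 0 → arrival (cell x′ l) (side l) ≢ 0
      unblocked′ l op eq with arrival′ l op
      ... | old eq′   = unblocked (open⇒open op) (trans (sym eq′) eq)
      ... | new _ eq′ = unblocked (open⇒open op) (m+n≡0⇒m≡0 _ (trans (sym eq′) eq))
      arrival≤′ : ∀ l → P x′ l ≢ 0 → arrival (cell x′ l) (side l) ≤ suc (start* l + e)
      arrival≤′ l op with arrival′ l op
      ... | old eq′    = ≤-trans (≤-reflexive eq′) (arrival≤ (open⇒open op))
      ... | new ed eq′ = ≤-trans (≤-reflexive eq′) (max-lub (arrival≤ (open⇒open op)) (reach-start ed))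
      F≤start′ : ∀ w → w ≡ z → ∀ l → P x′ l ≢ 0 → side l ≡ server → onServer w τ (F x) ≤ start* l + e
      -- `k` has least rank among the unassigned jobs, so by `server-order` the schedule `σ` starts
      -- all remaining server jobs after `C* k`.
      F≤start′ server eq l op sl = ≤-trans τ≤ (+-monoˡ-≤ e
        (server-order (λ k≡l → open⇒≢j op (sym k≡l)) (sym eq) sl (k-least l (open⇒open op))))
      F≤start′ cloud eq l op sl = F≤start (open⇒open op) sl
      F≤′ : ∀ w → w ≡ z → onServer w τ (F x) ≤ makespan + e
      F≤′ server eq = ≤-trans τ≤ (+-monoˡ-≤ e (C≤makespan k))
      F≤′ cloud  eq = F≤
      budget′ : cost x + extra z k + sum (remaining x′) ≤ b
      budget′ = ≤-trans (≤-reflexive (begin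
        cost x + extra z k + sum (remaining x′)   ≡⟨ +-assoc (cost x) _ _ ⟩
        cost x + (extra z k + sum (remaining x′)) ≡⟨ cong (cost x +_) (+-comm (extra z k) _) ⟩
        cost x + (sum (remaining x′) + extra z k) ≡⟨ cong (cost x +_) (sym sums) ⟩
        cost x + sum (remaining x)                ∎)) budget
        where
        open ≡-Reasoning
        agree : ∀ l → l ≢ k → remaining x l ≡ remaining x′ l
        agree l l≢k = if0-ind (P x l) (P x′ l) (ind-same l l≢k)
          where
          if0-ind : ∀ p q {y : ℕ} → ind p ≡ ind q → if0 p 0 y ≡ if0 q 0 y
          if0-ind zero    zero    _ = refl
          if0-ind (suc p) (suc q) _ = refl
        sums : sum (remaining x) ≡ sum (remaining x′) + extra z k
        sums = trans (sym (+-identityʳ _)) (trans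
          (cong (sum (remaining x) +_) (sym (cong (λ p → if0 p 0 (extra z k)) P-same)))
          (trans (sum-update {f = remaining x} {g = remaining x′} k agree)
                 (cong (λ p → sum (remaining x′) + if0 p 0 (extra z k)) (Allowed.ready allowed))))

  -- Equal keys mean the same assigned jobs and the same excluded sides, and by `ceil-cancel` every
  -- time grows by at most `u`. With no larger cost, the rest of `σ` still extends `y`.
  trim-Follows : ∀ {x y e} → Follows x e → SameKey x y → cost y ≤ cost x → Follows y (u + e)
  trim-Follows {x} {y} {e} f (cells , Fs) c = record
    { segment = λ {j} {l} h op → segment (closed-x j h) (open-x l op)
    ; unblocked = λ {l} op → ceil-≢0 u (arrivals l (side l)) (unblocked (open-x l op))
    ; arrival≤ = λ {l} op → ≤-trans (ceil-cancel u (arrivals l (side l)))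
        (≤-trans (+-monoˡ-≤ u (arrival≤ (open-x l op))) (≤-reflexive (cong suc (slack (start* l)))))
    ; F≤start = λ {l} op sl → ≤-trans (ceil-cancel u Fs)
        (≤-trans (+-monoˡ-≤ u (F≤start (open-x l op) sl)) (≤-reflexive (slack (start* l))))
    ; F≤ = ≤-trans (ceil-cancel u Fs) (≤-trans (+-monoˡ-≤ u F≤) (≤-reflexive (slack makespan)))
    ; budget = ≤-trans (+-mono-≤ c (≤-reflexive (sum-cong-≗
        λ l → if0-cong {p = P y l} {q = P x l} (sym (status l))))) budget }
    where
    open Follows f
    status : ∀ l → 1 ∸ P x l ≡ 1 ∸ P y l
    status l = cong proj₁ (cells l)
    arrivals : ∀ l w → ceil u (arrival (cell x l) w) ≡ ceil u (arrival (cell y l) w)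
    arrivals l server = cong (proj₁ ∘ proj₂) (cells l)
    arrivals l cloud  = cong (proj₂ ∘ proj₂) (cells l)
    open-x : ∀ l → P y l ≢ 0 → P x l ≢ 0
    open-x l = open-cong (sym (status l))
    closed-x : ∀ l → P y l ≡ 0 → P x l ≡ 0
    closed-x l h with P x l in eq
    ... | zero  = refl
    ... | suc _ = contradiction h (open-cong (status l) (λ eq′ → 1+n≢0 (trans (sym eq) eq′)))
    slack : ∀ a → a + e + u ≡ a + (u + e)
    slack a = trans (+-assoc a e u) (cong (a +_) (+-comm e u))

  Tracked : ℕ → List ⟦ StateTy ⟧ → ℕ → Set
  Tracked m ss e = Σ[ x ∈ St ] enc x ∈ ss × Inv x × assigned x ≡ m × Follows x e

  track-step : ∀ {m ss e} → (∀ {r} → r ∈ ss → GoodAt m r) → m < n → Tracked m ss e → Tracked (suc m) (step ss) (u + e)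
  track-step {m} {ss} {e} good m<n (x , i , inv , a , f) =
    let k₀ , open₀ = some-open {x} (subst (_< n) (sym a) m<n)
        k , k-next = next x k₀ open₀
        module N = Extend inv f k k-next
        rep : AllRep (fun successorsᶜ ((L , b) , u , ss))
        rep = λ j → Good⇒Rep (good-successors (λ l → Good⇐ (good l)) j)
        i′ : enc N.x′ ∈ fun successorsᶜ ((L , b) , u , ss)
        i′ = ∈-successors⁺ {u = u} (λ j → Good⇒Rep (Good⇐ (good j))) i N.allowed
        r , j , same , c = trim-cover rep i′
        y , eq , inv-y , a-y = good-next good j
        same′ : enc N.x′ ~ enc y
        same′ = subst (enc N.x′ ~_) eq same
    in y , subst (_∈ step ss) eq j , inv-y , a-y ,
       trim-Follows N.follows (~⇒SameKey N.x′ y same′) (subst (λ r → costOf r ≤ cost N.x′) eq c)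

  track : ∀ m → m ≤ n → Tracked m (layer m) (m * u)
  track zero    _   = initial , here refl , initial-Inv , assigned-initial , initial-Follows
  track (suc m) m<n = track-step (good-layer m) m<n (track m (<⇒≤ m<n))

  final : ∃[ x ] enc x ∈ layer n × F x ≤ makespan + n * u
  final = let x , i , _ , _ , f = track n ≤-refl in x , i , Follows.F≤ f

-- A feasible schedule always exists

pick : {E : Set} → Dec E → (E → ℕ) → ℕ
pick (yes e) f = f e
pick (no _)  f = 0

pick-cong : {E : Set} (d : Dec E) {f g : E → ℕ} → (∀ e → f e ≡ g e) → pick d f ≡ pick d g
pick-cong (yes e) h = h e
pick-cong (no _)  h = refl

module Sequential (G : Instance) where
  open Instance G
  open Semantics G
  open GraphFacts G

  -- Any function increasing along edges will do; a sum over the predecessors dominates each of its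
  -- terms. The recursion follows the accessibility proof, so independence of that proof is shown
  -- next.
  depth-acc : ∀ j → Acc Edge j → ℕ
  depth-acc j (acc rs) = suc (sum (λ i → pick (edge? i j) (λ e → depth-acc i (rs e))))

  depth-irrelevant : ∀ j (a a′ : Acc Edge j) → depth-acc j a ≡ depth-acc j a′
  depth-irrelevant j (acc rs) (acc rs′) = cong suc (sum-cong-≗ λ i →
    pick-cong (edge? i j) (λ e → depth-irrelevant i (rs e) (rs′ e)))

  depth : Job → ℕ
  depth j = depth-acc j (Edge-wf j)

  depth-edge : ∀ {i j} → Edge i j → depth i < depth j
  depth-edge {i} {j} e with Edge-wf j
  ... | acc rs = s≤s (≤-trans (here-edge (edge? i j)) (term≤sum (λ i → pick (edge? i j) (λ e → depth-acc i (rs e))) i))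
    where
    here-edge : (d : Dec (Edge i j)) → depth i ≤ pick d (λ e → depth-acc i (rs e))
    here-edge (yes e′) = ≤-reflexive (depth-irrelevant i (Edge-wf i) (rs e′))
    here-edge (no ¬e)  = contradiction e ¬e

  -- The lexicographic order by depth and index in one number; distinct jobs get distinct places.
  place : Job → ℕ
  place j = depth j * n + toℕ j

  depth-place : ∀ {i j} → depth i < depth j → place i < place j
  depth-place {i} {j} h = begin-strict
    depth i * n + toℕ i <⟨ +-monoʳ-< (depth i * n) (Finₚ.toℕ<n i) ⟩
    depth i * n + n     ≡⟨ +-comm (depth i * n) n ⟩
    suc (depth i) * n   ≤⟨ *-monoˡ-≤ n h ⟩
    depth j * n         ≤⟨ m≤m+n _ _ ⟩
    place j             ∎
    where open ≤-Reasoning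

  place-compare : ∀ {i j} → i ≢ j → place i < place j ⊎ place j < place i
  place-compare {i} {j} i≢j with <-cmp (depth i) (depth j)
  ... | tri< h _ _ = inj₁ (depth-place h)
  ... | tri> _ _ h = inj₂ (depth-place h)
  ... | tri≈ _ h _ with <-cmp (toℕ i) (toℕ j)
  ...   | tri< l _ _ = inj₁ (subst (λ d → d * n + toℕ i < place j) (sym h) (+-monoʳ-< (depth j * n) l))
  ...   | tri≈ _ l _ = contradiction (Finₚ.toℕ-injective l) i≢j
  ...   | tri> _ _ l = inj₂ (subst (λ d → d * n + toℕ j < place i) h (+-monoʳ-< (depth i * n) l))

  -- Each place is a time slot of length `sum ps`, enough for any single job. With everything on the
  -- server the cost is 0, within any budget.
  schedule : Schedule G
  schedule = record { side = λ _ → server ; C = λ j → suc (place j) * sum ps }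

  open Schedule schedule using () renaming (_≤start_ to _≤start′_; C to C′)

  later : ∀ {i j} → place i < place j → C′ i ≤start′ j
  later {i} {j} h = ≤⁺.[ (begin
    suc (place i) * sum ps + ps j   ≤⟨ +-mono-≤ (*-monoˡ-≤ (sum ps) h) (term≤sum ps j) ⟩
    place j * sum ps + sum ps       ≡⟨ +-comm (place j * sum ps) (sum ps) ⟩
    suc (place j) * sum ps          ∎) ]
    where open ≤-Reasoning

  feasible : ∀ b → Feasible G b schedule
  feasible b = record
    { server-exclusive = λ i j i≢j _ _ → exclusive (place-compare i≢j)
    ; precedence-same = λ i j e _ → later (depth-place (depth-edge e))
    ; precedence-cross = λ i j d _ cross → contradiction refl cross }
    , subst (_≤⁺ [ b ]) (sym (trans (sum∞ {n} (λ _ → 0) (λ _ → refl))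
        (cong [_] (sum≡0 {n} (λ _ → 0) (λ _ → refl))))) ≤⁺.[ z≤n ]
    where
    exclusive : ∀ {i j} → place i < place j ⊎ place j < place i → C′ i ≤start′ j ⊎ C′ j ≤start′ i
    exclusive (inj₁ h) = inj₁ (later h)
    exclusive (inj₂ h) = inj₂ (later h)

-- The output is a good approximation

LargestBelow : ℕ → List ℕ → Set
LargestBelow m vs = ∃[ L ] L ∈ vs × L ≤ m × (∀ {w} → w ∈ vs → w ≤ m → w ≤ L)

largest? : ∀ m vs → LargestBelow m vs ⊎ (∀ {w} → w ∈ vs → ¬ w ≤ m)
largest? m [] = inj₂ λ ()
largest? m (v ∷ vs) with v ≤? m | largest? m vs
... | no v≰m  | inj₂ none = inj₂ λ { (here refl) → v≰m ; (there i) → none i }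
... | yes v≤m | inj₂ none = inj₁ (v , here refl , v≤m ,
        λ { (here refl) _ → ≤-refl ; (there i) w≤m → contradiction w≤m (none i) })
... | no v≰m  | inj₁ (L , i , L≤m , top) = inj₁ (L , there i , L≤m ,
        λ { (here refl) v≤m → contradiction v≤m v≰m ; (there j) w≤m → top j w≤m })
... | yes v≤m | inj₁ (L , i , L≤m , top) with ≤-total v L
...   | inj₁ v≤L = inj₁ (L , there i , L≤m , λ { (here refl) _ → v≤L ; (there j) w≤m → top j w≤m })
...   | inj₂ L≤v = inj₁ (v , here refl , v≤m , λ { (here refl) _ → ≤-refl ; (there j) w≤m → ≤-trans (top j w≤m) L≤v })

largest-below : ∀ m vs {v} → v ∈ vs → v ≤ m → LargestBelow m vs
largest-below m vs i v≤m with largest? m vs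
... | inj₁ l    = l
... | inj₂ none = contradiction v≤m (none i)

quotient-≤ : ∀ m k → quotient m k * k ≤ m
quotient-≤ m zero    = z≤n
quotient-≤ m (suc k) = m/n*n≤m m (suc k)

<-quotient : ∀ m {k} → k ≢ 0 → m < suc (quotient m k) * k
<-quotient m {zero}  h = contradiction refl h
<-quotient m {suc k} _ = begin-strict
  m                                       ≡⟨ m≡m%n+[m/n]*n m (suc k) ⟩
  m % suc k + m / suc k * suc k           <⟨ +-monoˡ-< _ (m%n<n m (suc k)) ⟩
  suc k + m / suc k * suc k               ∎
  where open ≤-Reasoning

-- For ε = p / q, `x ≤ opt / E` and `1/ε ≤ E` give `x ≤ ε opt`; all is multiplied out to stay in ℕ.
scale-bound : ∀ {ms opt x p q E} → ms ≤ opt + x → x * E ≤ opt → q ≤ E * p → q * ms ≤ (q + p) * opt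
scale-bound {ms} {opt} {x} {p} {q} {E} h₁ h₂ h₃ = begin
  q * ms             ≤⟨ *-monoʳ-≤ q h₁ ⟩
  q * (opt + x)      ≡⟨ *-distribˡ-+ q opt x ⟩
  q * opt + q * x    ≤⟨ +-monoʳ-≤ (q * opt) (begin
      q * x            ≤⟨ *-monoˡ-≤ x h₃ ⟩
      E * p * x        ≡⟨ *-comm (E * p) x ⟩
      x * (E * p)      ≡⟨ sym (*-assoc x E p) ⟩
      x * E * p        ≤⟨ *-monoˡ-≤ p h₂ ⟩
      opt * p          ≡⟨ *-comm opt p ⟩
      p * opt          ∎) ⟩
  q * opt + p * opt  ≡⟨ sym (*-distribʳ-+ opt q p) ⟩
  (q + p) * opt      ∎
  where open ≤-Reasoning

module Output (G : Instance) (b : ℕ) (p q : ℕ) where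
  open Instance G
  open Semantics G
  open Preparation G

  I : ⟦ Input ⟧
  I = graph , b , p , q

  E : ℕ
  E = suc (quotient q p)

  scale : ℕ → ℕ
  scale L = quotient L (n * E)

  run-eq : ∀ L → fun runᶜ (fun runArgᶜ (I , L)) ≡ Layers.layer G L b (scale L) n
  run-eq L = trans (cong₂ (λ x u → fun runᶜ (graph , x , (L , b) , u)) init-eq
      (cong (quotient L) (trans (precision-eq graph b p q) (cong (_* E) length-graph))))
    (Layers.run-layer G L b (scale L))

  finals : List ⟦ StateTy ⟧
  finals = fun finalsᶜ I

  ∈-finals : ∀ {L r} → L ∈ guesses → r ∈ Layers.layer G L b (scale L) n → r ∈ finals
  ∈-finals {L} {r} i m = ∈-finals⁺ I i (subst (r ∈_) (sym (run-eq L)) m)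

  near-optimal : ∀ σ → Feasible G b σ →
    ∃[ r ] r ∈ finals × (∃[ x ] freeOf r ≤ Schedule.makespan σ + x × x * E ≤ Schedule.makespan σ)
  near-optimal σ f =
    -- The guess `ps s` is 0, so some guess always lies below the makespan. The program need not
    -- know the chosen one, as it tries all.
    let L , i , L≤m , top = largest-below (Schedule.makespan σ) guesses (ps∈guesses s) (≤-trans (≤-reflexive ps-s) z≤n)
        x , j , F≤ = Completeness.final G b σ f L (scale L) top
    in enc x , ∈-finals i j , n * scale L , F≤ , ≤-trans (slack L) L≤m
    where
    open ≤-Reasoning
    slack : ∀ L → n * scale L * E ≤ L
    slack L = begin
      n * scale L * E   ≡⟨ cong (_* E) (*-comm n (scale L)) ⟩
      scale L * n * E   ≡⟨ *-assoc (scale L) n E ⟩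
      scale L * (n * E) ≤⟨ quotient-≤ L (n * E) ⟩
      L                 ∎

  final-schedule : ∀ {r} → r ∈ finals →
    Σ[ σ ∈ Schedule G ] fun scheduleᶜ r ≡ encodeSchedule σ × Feasible G b σ × Schedule.makespan σ ≤ freeOf r
  final-schedule {r} m =
    let L , i , j = ∈-finals⁻ I m
        x , eq , inv , a = Layers.good-layer G L b (scale L) n (subst (r ∈_) (run-eq L) j)
        module Sound = Soundness G L b x inv (Layers.all-assigned G L b (scale L) {x} a)
    in Sound.schedule , trans (cong (fun scheduleᶜ) eq) (schedule-eq x) , Sound.feasible
       , ≤-trans Sound.makespan-≤ (≤-reflexive (sym (cong freeOf eq)))

  record Outcome : Set where
    field
      σ        : Schedule G
      output   : fun mainᶜ I ≡ encodeSchedule σ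
      feasible : Feasible G b σ
      close    : ∀ τ → Feasible G b τ →
        ∃[ x ] Schedule.makespan σ ≤ Schedule.makespan τ + x × x * E ≤ Schedule.makespan τ

  outcome : Outcome
  outcome = select finals refl
    where
    select : ∀ fs → finals ≡ fs → Outcome
    -- The list of final states cannot be empty: following the all-server schedule leads to a
    -- member.
    select [] eq = let r , i , _ = near-optimal (Sequential.schedule G) (Sequential.feasible G b)
                   in contradiction (subst (r ∈_) eq i) λ ()
    select (r ∷ rs) eq =
      let best∈ , best≤ = best-spec r rs
          σ , out , f , ms≤ = final-schedule (subst (fun bestᶜ (r , rs) ∈_) (sym eq) best∈)
      in record
        { σ = σ ; output = trans (cong (λ l → caseL l [] (λ s ss → fun scheduleᶜ (fun bestᶜ (s , ss)))) eq) out
        ; feasible = f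
        ; close = λ τ fτ → let r′ , i , x , F≤ , x≤ = near-optimal τ fτ in
            x , ≤-trans ms≤ (≤-trans (best≤ (subst (r′ ∈_) eq i)) F≤) , x≤ }

-- Running times of the program

Any-time : ℕ → X → Set
Any-time _ _ = ⊤

-- Indices are bounded as well as the length, since reaching position `i` takes `i` rounds of
-- `dropᶜ`.
Short : ℕ → ⟦ list EntryTy ⟧ → Set
Short N es = length es ≤ N × (∀ {e} → e ∈ es → proj₁ e ≤ N)

t-nth : TimeOn (λ N (_ , k) → k ≤ N) nthᶜ
t-nth = t-case t-drop t-const t-const

t-update : TimeOn (λ N (_ , e) → proj₁ e ≤ N) updateᶜ
t-update = t-⟪⟫ t-const (t-⟪⟫ t-const (t-if0 t-const t-const
  (t-▸ {R = Any-time} (t-⟪⟫ t-const (t-⟪⟫ t-const (t-⟪⟫ t-const (t-⟪⟫ (t-▸ t-const t-nth id) t-const)))) t-const (λ _ → tt))))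

t-assign : TimeOn (λ N (_ , _ , _ , _ , es) → Short N es) assignᶜ
t-assign = t-fold (λ _ _ _ → ⊤) poly-id t-const t-const
  (t-▸ {R = Any-time} (t-⟪⟫ (t-▸ t-const t-update (λ ((_ , sh) , i , _) → sh i)) t-const) t-const (λ _ → tt))
  proj₁ (λ _ → tt) (λ _ _ _ → tt)

t-try : TimeOn (λ N ((_ , s) , _) → Short N (proj₁ s)) tryᶜ
t-try = t-if0 t-const
  (t-▸ {R = Any-time} (t-⟪⟫ (t-⟪⟫ (t-▸ t-const t-assign id) t-const) t-const) t-const (λ _ → tt)) t-const

t-expand : TimeOn (λ N ((_ , s) , _) → Short N (proj₁ s)) expandᶜ
t-expand = t-fold (λ _ _ _ → ⊤) poly-id t-const t-const
  (t-▸ (t-⟪⟫ t-const (t-⟪⟫ t-const (t-⟪⟫ t-const (t-▸ t-const t-try proj₁)))) t-try proj₁)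
  proj₁ (λ _ → tt) (λ _ _ _ → tt)

t-diff : TimeOn (λ N (_ , x , _) → Short N (proj₁ x)) diffᶜ
t-diff = t-fold (λ _ _ _ → ⊤) poly-id t-const t-const
  (t-case (t-▸ t-const t-drop (λ ((_ , sh) , i , _) → sh i)) t-const t-const)
  proj₁ (λ _ → tt) (λ _ _ _ → tt)

t-insert : ∀ {ℓ} → IsPoly ℓ → TimeOn (λ N (_ , x , ss) → Short N (proj₁ x) × length ss ≤ ℓ N) insertᶜ
t-insert pℓ = t-▸ {R = Any-time}
  (t-fold (λ _ _ _ → ⊤) pℓ t-const t-const
    (t-if0 (t-▸ t-const t-diff (λ q → proj₁ (proj₁ q))) t-const t-const)
    proj₂ (λ _ → tt) (λ _ _ _ → tt))
  t-const (λ _ → tt)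

t-count : TimeOn (λ N g → length g ≤ N) countᶜ
t-count = t-fold (λ _ _ _ → ⊤) poly-id t-const t-const t-const id (λ _ → tt) (λ _ _ _ → tt)

t-indegree : TimeOn (λ N (g , k) → length g ≤ N × k ≤ N) indegreeᶜ
t-indegree = t-fold (λ _ _ _ → ⊤) poly-id t-const t-const
  (t-▸ {R = Any-time} (t-⟪⟫ (t-if0 (t-▸ t-const t-nth (λ q → proj₂ (proj₁ q))) t-const t-const) t-const) t-const (λ _ → tt))
  proj₁ (λ _ → tt) (λ _ _ _ → tt)

t-entries : TimeOn (λ N g → length g ≤ N) entriesᶜ
-- The counter in the accumulator becomes an index for `nthᶜ`, so its size belongs to the invariant.
t-entries = t-fold (λ N _ p → proj₁ p ≤ N) poly-id t-const (t-⟪⟫ t-count t-const)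
  (t-⟪⟫ t-const (t-▸ {R = Any-time} (t-⟪⟫ (t-⟪⟫ t-const (t-⟪⟫ t-const (t-⟪⟫ (t-⟪⟫
      (t-▸ {R = Any-time} (t-⟪⟫ t-const (t-▸ t-const t-indegree
        (λ (h , _ , c) → h , ≤-trans (m∸n≤m _ 1) c))) t-const (λ _ → tt)) t-const) t-const))) t-const) t-const (λ _ → tt)))
  id (λ {_} {g} h → ≤-trans (≤-reflexive (foldr-length g)) h) (λ _ _ c → ≤-trans (m∸n≤m _ 1) c)

t-init : TimeOn (λ N g → length g ≤ N) initᶜ
t-init = t-⟪⟫ (t-▸ {R = Any-time} t-entries t-const (λ _ → tt)) t-const

t-precision : TimeOn (λ N (g , _) → length g ≤ N) precisionᶜ
t-precision = t-fold (λ _ _ _ → ⊤) poly-id t-const t-const t-const id (λ _ → tt) (λ _ _ _ → tt)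

t-runArg : TimeOn (λ N (I , _) → length (proj₁ I) ≤ N) runArgᶜ
t-runArg = t-⟪⟫ t-const (t-⟪⟫ (t-▸ t-const t-init id) (t-⟪⟫ t-const
  (t-▸ {R = Any-time} (t-⟪⟫ t-const (t-▸ t-const t-precision id)) t-const (λ _ → tt))))

t-guesses : TimeOn (λ N g → length g ≤ N × (∀ {r} → r ∈ g → length (proj₂ (proj₂ r)) ≤ N)) guessesᶜ
t-guesses = t-fold (λ _ _ _ → ⊤) poly-id t-const t-const
  (t-▸ {R = Any-time} (t-⟪⟫ t-const (t-▸ {R = Any-time} (t-⟪⟫ t-const
    (t-fold (λ _ _ _ → ⊤) poly-id t-const t-const t-const (λ ((_ , h) , i , _) → h i) (λ _ → tt) (λ _ _ _ → tt)))
    t-const (λ _ → tt))) t-const (λ _ → tt))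
  proj₁ (λ _ → tt) (λ _ _ _ → tt)

t-best : ∀ {ℓ} → IsPoly ℓ → TimeOn (λ N (_ , ss) → length ss ≤ ℓ N) bestᶜ
t-best pℓ = t-fold (λ _ _ _ → ⊤) pℓ t-const t-const t-const id (λ _ → tt) (λ _ _ _ → tt)

t-schedule : TimeOn (λ N s → Short N (proj₁ s)) scheduleᶜ
t-schedule = t-fold (λ _ _ _ → ⊤) poly-id t-const t-const t-const proj₁ (λ _ → tt) (λ _ _ _ → tt)

if0-length : ∀ v {x : X} {xs} → length (if0 v (x ∷ xs) xs) ≤ suc (length xs)
if0-length zero    = ≤-refl
if0-length (suc v) = n≤1+n _

foldr-length-≤ : {f : X → List Y → List Y} {c : ℕ} {ys : List Y} (xs : List X) →
  (∀ {a} b → a ∈ xs → length (f a b) ≤ c + length b) → length (foldr f ys xs) ≤ length xs * c + length ys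
foldr-length-≤ []       h = ≤-refl
foldr-length-≤ {c = c} (x ∷ xs) h = ≤-trans (h _ (here refl))
  (≤-trans (+-monoʳ-≤ c (foldr-length-≤ xs (λ b i → h b (there i)))) (≤-reflexive (sym (+-assoc c _ _))))

try-length : ∀ c p e out → length (fun tryᶜ (c , p , e , out)) ≤ suc (length out)
try-length c p e out = if0-length (fun violationᶜ (c , p , e , out))

expand-length : ∀ c s out → length (fun expandᶜ ((c , s) , out)) ≤ length (proj₁ s) * 2 + length out
expand-length c s out = foldr-length-≤ (proj₁ s) λ {e} b _ → ≤-trans
  (try-length (c , s) (1 , fun (cellᶜ ▸ acᶜ) e , fun pcᶜ e) e _)
  (s≤s (try-length (c , s) (0 , fun (cellᶜ ▸ asᶜ) e , suc (fun psᶜ e)) e b))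

successors-length : ∀ {N} c u ss → (∀ {s} → s ∈ ss → length (proj₁ s) ≤ N) →
  length (fun successorsᶜ (c , u , ss)) ≤ length ss * (N * 2)
successors-length c u ss h = ≤-trans
  (foldr-length-≤ ss (λ {s} b i → ≤-trans (expand-length c s b) (+-monoˡ-≤ (length b) (*-monoˡ-≤ 2 (h i)))))
  (≤-reflexive (+-identityʳ _))

-- Time bounds uniform over all instances with cuts of size at most φ

module Running (φ : ℕ) where

  -- Bounds the rounded times: arrivals are at most `1 + 2 n L`, and `L < (1 + u) n E` with `n` and
  -- `E` at most `N`, so `1 + 2 N³` multiples of `1 + u` suffice.
  horizon : ℕ → ℕ
  horizon N = suc (N * (2 * (N * N)))

  maxStates : ℕ → ℕ
  maxStates N = suc (N * (suc (horizon N) * suc (horizon N))) ^ suc φ * suc (horizon N)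

  poly-horizon : IsPoly (λ N → suc (horizon N))
  poly-horizon = poly-+ (poly-const 2) (poly-* poly-id (poly-* (poly-const 2) (poly-* poly-id poly-id)))

  poly-maxStates : IsPoly maxStates
  poly-maxStates = poly-*
    (poly-^ (suc φ) (poly-+ (poly-const 1) (poly-* poly-id (poly-* poly-horizon poly-horizon)))) poly-horizon

  -- Time bounds speak of raw values. A `Scene` certifies that they stem from some instance with
  -- small cuts, which is what bounds the number of states.
  record Scene (N : ℕ) : Set where
    field
      G          : Instance
      small-cuts : ∀ A → Dividing G A → length (cut G A) ≤ φ
      n≤N        : Instance.n G ≤ N
      L b u      : ℕ
      coarse     : suc (Instance.n G * (L + L)) ≤ horizon N * suc u

    open Semantics G public
    open Invariants G L b public using (Good; Good⇒Rep)
    open Trimming G u public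
    open Layers G L b u public
    private module Cnt = Counting G φ small-cuts L b u (horizon N) coarse

    states-≤ : ∀ {ss} → AllGood ss → Distinct ss → length ss ≤ maxStates N
    states-≤ good distinct = ≤-trans (Cnt.distinct-length good distinct)
      (*-monoˡ-≤ (suc (horizon N)) (^-monoˡ-≤ (suc φ) (s≤s (*-monoˡ-≤ (suc (horizon N) * suc (horizon N)) n≤N))))

    short : ∀ {s} → Good s → Short N (proj₁ s)
    short (x , refl , _) = ≤-trans (≤-reflexive (Listₚ.length-tabulate (encEntry x))) n≤N ,
      λ i → let k , eq = ∈ₚ.∈-tabulate⁻ i in
        ≤-trans (≤-reflexive (cong proj₁ eq)) (≤-trans (<⇒≤ (Finₚ.toℕ<n k)) n≤N)

    distinct-layer : ∀ m → Distinct (layer m)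
    distinct-layer zero    = [] ∷ []
    distinct-layer (suc m) = distinct-step (λ i → Good⇐ (good-layer m i))

  open Scene

  TrimQ : ℕ → ⟦ nat ⊗ list StateTy ⟧ → Set
  TrimQ N (u′ , ss) = Σ[ S ∈ Scene N ] u′ ≡ u S × AllGood S ss × length ss ≤ maxStates N * (N * 2)

  -- During the whole fold the accumulator is the trimming of some list of members of `ss`; so its
  -- members are inequivalent and `maxStates` bounds each insertion.
  t-trim : TimeOn TrimQ trimᶜ
  t-trim = t-fold J (poly-* poly-maxStates (poly-* poly-id (poly-const 2))) t-const t-const
    (t-▸ t-const (t-insert poly-maxStates)
      (λ {N} {γ} → few N (proj₁ (proj₁ γ)) (proj₂ (proj₁ γ)) (proj₁ (proj₂ γ)) (proj₂ (proj₂ γ))))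
    (λ (_ , _ , _ , h) → h) (λ _ → [] , (λ ()) , refl)
    (λ { _ i (xs , sub , refl) → _ ∷ xs , (λ { (here refl) → i ; (there j) → sub j }) , refl })
    where
    J : ℕ → ⟦ nat ⊗ list StateTy ⟧ → ⟦ list StateTy ⟧ → Set
    J N (u′ , ss) kept = ∃[ xs ] (∀ {x} → x ∈ xs → x ∈ ss) × kept ≡ fun trimᶜ (u′ , xs)
    few : ∀ N u′ ss s kept → TrimQ N (u′ , ss) × s ∈ ss × J N (u′ , ss) kept →
      Short N (proj₁ s) × length kept ≤ maxStates N
    few N u′ ss s kept ((S , refl , good , _) , i , xs , sub , refl) =
      short S (good i) , states-≤ S (λ j → good (sub (trim-⊆ S rep j))) (trim-distinct S rep)
      where
      rep : AllRep S xs
      rep j = Good⇒Rep S (good (sub j))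

  StepQ : ℕ → ⟦ StepTy ⟧ → Set
  StepQ N ((L′ , b′) , u′ , ss) = Σ[ S ∈ Scene N ] L′ ≡ L S × b′ ≡ b S × u′ ≡ u S × AllGood S ss × length ss ≤ maxStates N

  t-step : TimeOn StepQ stepᶜ
  t-step = t-▸ (t-⟪⟫ t-const
    (t-fold (λ _ _ _ → ⊤) poly-maxStates t-const t-const
      (t-▸ t-const t-expand (λ ((S , _ , _ , _ , good , _) , i , _) → short S (good i)))
      (λ (_ , _ , _ , _ , _ , h) → h) (λ _ → tt) (λ _ _ _ → tt)))
    t-trim trim-arg
    where
    trim-arg : ∀ {N γ} → StepQ N γ → TrimQ N (proj₁ (proj₂ γ) , fun successorsᶜ γ)
    trim-arg {N} {γ} (S , refl , refl , refl , good , h) = S , refl , good-successors S good ,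
      ≤-trans (successors-length (L S , b S) (u S) (proj₂ (proj₂ γ)) (λ i → proj₁ (short S (good i)))) (*-monoˡ-≤ (N * 2) h)

  RunQ : ℕ → ⟦ RunTy ⟧ → Set
  RunQ N (g , x , (L′ , b′) , u′) = Σ[ S ∈ Scene N ] L′ ≡ L S × b′ ≡ b S × u′ ≡ u S
    × g ≡ encodeInstance (G S) × x ≡ enc S (Preparation.initial (G S))

  layer-≤ : ∀ {N} (S : Scene N) m → length (layer S m) ≤ maxStates N
  layer-≤ S m = states-≤ S (λ i → Good⇐ S (good-layer S m i)) (distinct-layer S m)

  -- The accumulator does not reveal the number of rounds made, so the invariant says that it is
  -- some layer.
  t-run : TimeOn RunQ runᶜ
  t-run = t-fold J poly-id t-const t-const (t-▸ t-const t-step (λ {N} {((g , x , c , u′) , r , ss)} → step-arg N g x c u′ r ss))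
    (λ { (S , _ , _ , _ , refl , _) → ≤-trans (≤-reflexive (Preparation.length-graph (G S))) (n≤N S) })
    (λ _ → 0 , refl) (λ { _ _ (m , refl) → suc m , refl })
    where
    J : ℕ → ⟦ RunTy ⟧ → ⟦ list StateTy ⟧ → Set
    J N (g , x , c , u′) ss = ∃[ m ] ss ≡ fold (x ∷ []) (λ ss → fun stepᶜ (c , u′ , ss)) m
    step-arg : ∀ N g x c u′ r ss → RunQ N (g , x , c , u′) × r ∈ g × J N (g , x , c , u′) ss → StepQ N (c , u′ , ss)
    step-arg N g x c u′ r ss ((S , refl , refl , refl , refl , refl) , _ , m , refl) =
      S , refl , refl , refl , (λ i → Good⇐ S (good-layer S m i)) , layer-≤ S m

  record Problem (N : ℕ) (I : ⟦ Input ⟧) : Set where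
    field
      G          : Instance
      small-cuts : ∀ A → Dividing G A → length (cut G A) ≤ φ
      n≤N        : Instance.n G ≤ N
      b p q      : ℕ
      E≤N        : suc (quotient q p) ≤ N
      input      : I ≡ (encodeInstance G , b , p , q)

  module _ {N : ℕ} {I : ⟦ Input ⟧} (Π : Problem N I) where
    private module Π = Problem Π

    n≢0 : Instance.n Π.G ≢ 0
    n≢0 eq with subst Fin eq (Instance.s Π.G)
    ... | ()

    coarse-scale : ∀ L → suc (Instance.n Π.G * (L + L)) ≤ horizon N * suc (Output.scale Π.G Π.b Π.p Π.q L)
    coarse-scale L = begin
      suc (n * (L + L))           ≤⟨ s≤s (*-monoʳ-≤ n (≤-trans (+-mono-≤ L≤ L≤) (≤-reflexive (double (v * W))))) ⟩
      suc (n * (2 * (v * W)))     ≤⟨ s≤s (≤-reflexive (rearrange n v W)) ⟩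
      suc (n * (2 * W) * v)       ≤⟨ s≤s (*-monoˡ-≤ v (*-mono-≤ Π.n≤N (*-monoʳ-≤ 2 (*-mono-≤ Π.n≤N Π.E≤N)))) ⟩
      suc (N * (2 * (N * N)) * v) ≤⟨ +-monoˡ-≤ _ (s≤s z≤n) ⟩
      horizon N * v               ∎
      where
      open ≤-Reasoning
      n = Instance.n Π.G
      W = n * suc (quotient Π.q Π.p)
      v = suc (quotient L W)
      W≢0 : W ≢ 0
      W≢0 eq with m*n≡0⇒m≡0∨n≡0 n eq
      ... | inj₁ n≡0 = n≢0 n≡0
      L≤ : L ≤ v * W
      L≤ = <⇒≤ (<-quotient L W≢0)
      double : ∀ a → a + a ≡ 2 * a
      double a = cong (a +_) (sym (+-identityʳ a))
      rearrange : ∀ a c d → a * (2 * (c * d)) ≡ a * (2 * d) * c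
      rearrange a c d = trans (cong (a *_) (trans (cong (2 *_) (*-comm c d)) (sym (*-assoc 2 d c)))) (sym (*-assoc a (2 * d) c))

    scene : ℕ → Scene N
    scene L = record { G = Π.G ; small-cuts = Π.small-cuts ; n≤N = Π.n≤N ; L = L ; b = Π.b
                     ; u = Output.scale Π.G Π.b Π.p Π.q L ; coarse = coarse-scale L }

    run-arg : ∀ L → RunQ N (fun runArgᶜ (I , L))
    run-arg L rewrite Π.input = scene L , refl , refl ,
      cong (quotient L) (trans (precision-eq graph Π.b Π.p Π.q) (cong (_* suc (quotient Π.q Π.p)) length-graph)) ,
      refl , init-eq
      where open Preparation Π.G

    run-≤ : ∀ L → length (fun runᶜ (fun runArgᶜ (I , L))) ≤ maxStates N
    run-≤ L rewrite Π.input = ≤-trans (≤-reflexive (cong length (Output.run-eq Π.G Π.b Π.p Π.q L)))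
      (layer-≤ (scene L) (Instance.n Π.G))

    graph-≤ : length (proj₁ I) ≤ N
    graph-≤ rewrite Π.input = ≤-trans (≤-reflexive (Preparation.length-graph Π.G)) Π.n≤N

    rows-≤ : ∀ {r} → r ∈ proj₁ I → length (proj₂ (proj₂ r)) ≤ N
    rows-≤ i rewrite Π.input with ∈ₚ.∈-tabulate⁻ i
    ... | j , refl = ≤-trans (≤-reflexive (Listₚ.length-tabulate (Semantics.dl Π.G j))) Π.n≤N

    guesses-≤ : length (fun guessesᶜ (proj₁ I)) ≤ N * (2 + N)
    guesses-≤ rewrite Π.input = ≤-trans (≤-reflexive (Preparation.length-guesses Π.G)) (*-mono-≤ Π.n≤N (+-monoʳ-≤ 2 Π.n≤N))

    finals-≤ : length (fun finalsᶜ I) ≤ N * (2 + N) * maxStates N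
    finals-≤ = ≤-trans (foldr-length-≤ (fun guessesᶜ (proj₁ I)) (λ {L} ss _ →
        ≤-trans (foldr-length-≤ {c = 1} (fun runᶜ (fun runArgᶜ (I , L))) (λ _ _ → ≤-refl))
                (+-monoˡ-≤ (length ss) (≤-trans (≤-reflexive (*-identityʳ _)) (run-≤ L)))))
      (≤-trans (≤-reflexive (+-identityʳ _)) (*-monoˡ-≤ (maxStates N) guesses-≤))

    final-short : ∀ {r} → r ∈ fun finalsᶜ I → Short N (proj₁ r)
    final-short i rewrite Π.input with ∈-finals⁻ (encodeInstance Π.G , Π.b , Π.p , Π.q) i
    ... | L , _ , j = short (scene L) (Good⇐ (scene L) (good-layer (scene L) (Instance.n Π.G)
            (subst (_ ∈_) (Output.run-eq Π.G Π.b Π.p Π.q L) j)))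

    best-short : ∀ {r rs} → fun finalsᶜ I ≡ r ∷ rs → Short N (proj₁ (fun bestᶜ (r , rs)))
    best-short {r} {rs} eq = final-short (subst (fun bestᶜ (r , rs) ∈_) (sym eq) (proj₁ (best-spec r rs)))

  poly-guesses : IsPoly (λ N → N * (2 + N))
  poly-guesses = poly-* poly-id (poly-+ (poly-const 2) poly-id)

  t-finals : TimeOn Problem finalsᶜ
  t-finals = t-fold (λ _ _ _ → ⊤) poly-guesses
    (t-▸ t-const t-guesses (λ Π → graph-≤ Π , rows-≤ Π)) t-const
    (t-fold (λ _ _ _ → ⊤) poly-maxStates
      (t-▸ {R = RunQ} (t-▸ t-const t-runArg (λ (Π , _) → graph-≤ Π)) t-run (λ {_} {γ} (Π , _) → run-arg Π (proj₁ (proj₂ γ))))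
      t-const t-const (λ {_} {γ} (Π , _) → run-≤ Π (proj₁ (proj₂ γ))) (λ _ → tt) (λ _ _ _ → tt))
    guesses-≤ (λ _ → tt) (λ _ _ _ → tt)

  t-main : TimeOn Problem mainᶜ
  t-main = t-case t-finals t-const
    (t-▸ {R = λ N s → Short N (proj₁ s)}
      (t-▸ t-const (t-best (poly-* poly-guesses poly-maxStates))
        (λ (Π , eq) → ≤-trans (n≤1+n _) (≤-trans (≤-reflexive (cong length (sym eq))) (finals-≤ Π))))
      t-schedule
      (λ (Π , eq) → best-short Π eq))

-- Passing to the rationals

¬Positive : ∀ (ε : ℚ) .{{_ : ℚ.Positive ε}} → ¬ ε ℚ.≤ ℚ.0ℚ
¬Positive ε h = ℚₚ.<-irrefl refl (ℚₚ.<-≤-trans (ℚₚ.positive⁻¹ ε) h)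

-- A floor never exceeds a ceiling. The ceiling is a negated floor of a negative number, whose
-- integer quotient is defined by cases on the remainder; hence the split.
⌈1/⌉-≥ : ∀ (ε : ℚ) .{{_ : ℚ.Positive ε}} → quotient (ℚ.denominatorℕ ε) ℤ.∣ ℚ.numerator ε ∣ ≤ ⌈1/ ε ⌉
⌈1/⌉-≥ (mkℚ ℤ.+[1+ p ] q c) with suc q % suc p
... | zero  rewrite ℤₚ.*-identityˡ (ℤ.- ℤ.+ (suc q / suc p)) | ℤₚ.neg-involutive (ℤ.+ (suc q / suc p)) = ≤-refl
... | suc _ = m≤n⇒m≤1+n (m≤m+n (suc q / suc p) 0)
⌈1/⌉-≥ ε@(mkℚ (ℤ.+ 0) q c) = ⊥-elim (¬Positive ε (ℚ.*≤* (ℤ.+≤+ z≤n)))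
⌈1/⌉-≥ ε@(mkℚ ℤ.-[1+ _ ] q c) = ⊥-elim (¬Positive ε (ℚ.*≤* ℤ.-≤+))

-- Unnormalised fractions have explicit numerators and denominators, so the claim becomes a cross
-- multiplication in ℕ, free of common divisors.
ratio-≤ : ∀ ms opt (ε : ℚ) .{{_ : ℚ.Positive ε}} →
  ℚ.denominatorℕ ε * ms ≤ (ℚ.denominatorℕ ε + ℤ.∣ ℚ.numerator ε ∣) * opt →
  ℕtoℚ ms ℚ.≤ (1ℚ ℚ.+ ε) ℚ.* ℕtoℚ opt
ratio-≤ ms opt ε@(mkℚ (ℤ.+ 0) q c) = ⊥-elim (¬Positive ε (ℚ.*≤* (ℤ.+≤+ z≤n)))
ratio-≤ ms opt ε@(mkℚ ℤ.-[1+ _ ] q c) = ⊥-elim (¬Positive ε (ℚ.*≤* ℤ.-≤+))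
ratio-≤ ms opt ε@(mkℚ ℤ.+[1+ p ] q c) h = ℚₚ.toℚᵘ-cancel-≤ (begin
  ℚ.toℚᵘ (ℕtoℚ ms)                          ≃⟨ ℚₚ.toℚᵘ-fromℚᵘ (ℚᵘ.mkℚᵘ (ℤ.+ ms) 0) ⟩
  ℚᵘ.mkℚᵘ (ℤ.+ ms) 0                        ≤⟨ ℚᵘ.*≤* core ⟩
  (ℚᵘ.1ℚᵘ ℚᵘ.+ ℚ.toℚᵘ ε) ℚᵘ.* ℚᵘ.mkℚᵘ (ℤ.+ opt) 0
    ≃⟨ ℚᵘₚ.*-cong (ℚᵘₚ.≃-sym (ℚₚ.toℚᵘ-homo-+ 1ℚ ε)) (ℚᵘₚ.≃-sym (ℚₚ.toℚᵘ-fromℚᵘ (ℚᵘ.mkℚᵘ (ℤ.+ opt) 0))) ⟩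
  ℚ.toℚᵘ (1ℚ ℚ.+ ε) ℚᵘ.* ℚ.toℚᵘ (ℕtoℚ opt)  ≃⟨ ℚᵘₚ.≃-sym (ℚₚ.toℚᵘ-homo-* (1ℚ ℚ.+ ε) (ℕtoℚ opt)) ⟩
  ℚ.toℚᵘ ((1ℚ ℚ.+ ε) ℚ.* ℕtoℚ opt)          ∎)
  where
  open ℚᵘₚ.≤-Reasoning
  -- The terms `+ 0` and `* 1` here and in `nat-core` are those to which unnormalised addition and
  -- multiplication reduce.
  num : ℕ
  num = suc (q + 0 + suc (p * 1))
  nat-core : ms * suc ((q + 0) * 1) ≤ num * opt
  nat-core = subst₂ _≤_
    (trans (*-comm (suc q) ms) (cong (λ d → ms * suc d) (sym (trans (*-identityʳ (q + 0)) (+-identityʳ q)))))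
    (cong (λ a → suc a * opt) (sym (cong₂ _+_ (+-identityʳ q) (cong suc (*-identityʳ p))))) h
  core : ℤ.+ ms ℤ.* ℚᵘ.↧ ((ℚᵘ.1ℚᵘ ℚᵘ.+ ℚ.toℚᵘ ε) ℚᵘ.* ℚᵘ.mkℚᵘ (ℤ.+ opt) 0)
    ℤ.≤ ℚᵘ.↥ ((ℚᵘ.1ℚᵘ ℚᵘ.+ ℚ.toℚᵘ ε) ℚᵘ.* ℚᵘ.mkℚᵘ (ℤ.+ opt) 0) ℤ.* ℤ.+ 1
  core = subst₂ ℤ._≤_ (ℤₚ.pos-* ms _)
    (trans (ℤₚ.pos-* num opt) (sym (ℤₚ.*-identityʳ (ℤ.+ num ℤ.* ℤ.+ opt)))) (ℤ.+≤+ nat-core)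

*-^ : ∀ m n k → (m * n) ^ k ≡ m ^ k * n ^ k
*-^ m n zero    = refl
*-^ m n (suc k) = trans (cong (m * n *_) (*-^ m n k)) (*-interchange m n (m ^ k) (n ^ k))

approximates : ∀ G b (ε : ℚ) .{{_ : ℚ.Positive ε}} →
  (o : Output.Outcome G b ℤ.∣ ℚ.numerator ε ∣ (ℚ.denominatorℕ ε)) → Approximates G b ε (Output.Outcome.σ o)
approximates G b ε o = feasible , near
  where
  open Output.Outcome o
  p q : ℕ
  p = ℤ.∣ ℚ.numerator ε ∣
  q = ℚ.denominatorℕ ε
  p≢0 : (ε : ℚ) .{{_ : ℚ.Positive ε}} → ℤ.∣ ℚ.numerator ε ∣ ≢ 0
  p≢0 ε@(mkℚ (ℤ.+ 0) _ _)  _ = ¬Positive ε (ℚ.*≤* (ℤ.+≤+ z≤n))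
  p≢0 (mkℚ ℤ.+[1+ _ ] _ _) ()
  p≢0 (mkℚ ℤ.-[1+ _ ] _ _) ()
  near : ∀ opt → IsMinMakespan G b opt → ℕtoℚ (Schedule.makespan σ) ℚ.≤ (1ℚ ℚ.+ ε) ℚ.* ℕtoℚ opt
  near opt ((τ , τ-feasible , refl) , _) =
    let x , ms≤ , x≤ = close τ τ-feasible
    in ratio-≤ (Schedule.makespan σ) opt ε (scale-bound {E = suc (quotient q p)} ms≤ x≤ (<⇒≤ (<-quotient q (p≢0 ε))))

IsAccurate : Code Input Output → Set
IsAccurate c = ∀ G b (ε : ℚ) .{{_ : ℚ.Positive ε}} →
  Σ[ σ ∈ Schedule G ] fun c (encodeInput G b ε) ≡ encodeSchedule σ × Approximates G b ε σ

main-accurate : IsAccurate mainᶜ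
main-accurate G b ε = Output.Outcome.σ o , Output.Outcome.output o , approximates G b ε o
  where o = Output.outcome G b ℤ.∣ ℚ.numerator ε ∣ (ℚ.denominatorℕ ε)

accurate⇒FPTAS : ∀ φ (c : Code Input Output) → TimeOn (Running.Problem φ) c → IsAccurate c →
  IsFPTASOn (HasMaxDividingCutAtMost φ) (prog c)
accurate⇒FPTAS φ c (timed f ((K , d) , f≤) f-bounds) accurate = K * 2 ^ d , d , λ G cuts b ε →
  let σ , out , approx = accurate G b ε
      N = Instance.n G + ⌈1/ ε ⌉
  in (σ , trans (correct c (encodeInput G b ε)) out , approx)
   , ≤-trans (f-bounds {N} {encodeInput G b ε} (problem G cuts b ε))
             (≤-trans (f≤ N) (absorb N (≤-trans (n≥1 G) (m≤m+n _ _))))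
  where
  n≥1 : ∀ G → 1 ≤ Instance.n G
  n≥1 G with Instance.n G | Instance.s G
  ... | suc _ | _ = s≤s z≤n
  problem : ∀ G → HasMaxDividingCutAtMost φ G → ∀ b (ε : ℚ) .{{_ : ℚ.Positive ε}} →
    Running.Problem φ (Instance.n G + ⌈1/ ε ⌉) (encodeInput G b ε)
  problem G (m , (_ , m-max) , m≤φ) b ε = record
    { G = G ; small-cuts = λ A dividing → ≤-trans (m-max A dividing) m≤φ ; n≤N = m≤m+n _ _
    ; b = b ; p = ℤ.∣ ℚ.numerator ε ∣ ; q = ℚ.denominatorℕ ε
    ; E≤N = +-mono-≤ (n≥1 G) (⌈1/⌉-≥ ε) ; input = refl }
  -- From `1 ≤ N` follows `suc N ≤ 2 * N`, which costs the factor `2 ^ d`.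
  absorb : ∀ N → 1 ≤ N → K * suc N ^ d ≤ K * 2 ^ d * N ^ d
  absorb N 1≤N = begin
    K * suc N ^ d       ≤⟨ *-monoʳ-≤ K (^-monoˡ-≤ d (+-mono-≤ 1≤N (≤-reflexive (sym (+-identityʳ N))))) ⟩
    K * (2 * N) ^ d     ≡⟨ cong (K *_) (*-^ 2 N d) ⟩
    K * (2 ^ d * N ^ d) ≡⟨ sym (*-assoc K (2 ^ d) (N ^ d)) ⟩
    K * 2 ^ d * N ^ d   ∎
    where open ≤-Reasoning

theorem9 : (φ : ℕ) → Σ[ prog ∈ (Input ⇒ Output) ] IsFPTASOn (HasMaxDividingCutAtMost φ) prog
theorem9 φ = prog mainᶜ , accurate⇒FPTAS φ mainᶜ (Running.t-main φ) main-accurate
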